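{- For every 2-connected chordal graph $G$, $\mathrm{lct}(G)\leq\max\{1,\omega(G)-3\}$.
   Context: A graph is chordal if every induced cycle has length three. $\omega(G)$ is the cardinality of a maximum clique of $G$. $\mathrm{lct}(G)$ is the minimum cardinality of a set of vertices that intersects every longest cycle (cycle of maximum length) of $G$. -}

module Defs where

open import Data.Fin.Base using (Fin; zero; suc)
import Data.Fin.Properties as Fin
open import Data.Fin.Subset using (Subset; _∈_; _∉_; ∣_∣; ⊤; ⊥)
open import Data.Fin.Subset.Properties using (_∈?_; anySubset?; ∣p∣≤n; ∈⊤; ∉⊥)
open import Data.List.Base using (List; []; _∷_; _++_; [_]; length; lookup)
import Data.List.Membership.Propositional as List
open import Data.List.Membership.Propositional.Properties using (∈-lookup)
open import Data.List.Relation.Unary.All as All using ()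
open import Data.List.Relation.Unary.AllPairs using (_∷_)
open import Data.List.Relation.Unary.Any as Any using (Any; here)
open import Data.List.Relation.Unary.Linked using (Linked; linked?)
open import Data.List.Relation.Unary.Unique.Propositional using (Unique)
open import Data.List.Relation.Unary.Unique.DecPropositional using (unique?)
open import Data.Nat.Base using (ℕ; zero; suc; _≤_; _<_; z≤n; s≤s)
open import Data.Nat.Properties using (_≤?_; _≟_; ≤-pred; ≤∧≢⇒<)
open import Data.Product.Base using (∃; _×_; _,_; proj₁; proj₂)
open import Data.Sum.Base using (_⊎_; inj₁; inj₂)
open import Function.Base using (_∘_)
open import Function.Definitions using (Injective)
open import Level using (0ℓ)
open import Relation.Binary.Core using (Rel)
open import Relation.Binary.Definitions as Binary using (Symmetric)
open import Relation.Binary.Construct.Closure.ReflexiveTransitive using (Star)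
open import Relation.Binary.PropositionalEquality using (_≡_; _≢_; refl; sym; cong)
open import Relation.Nullary.Decidable using (Dec; yes; no; map′; _×-dec_; _⊎-dec_; _→-dec_; ¬?; decidable-stable)
open import Relation.Nullary.Negation using (¬_; contradiction)
open import Relation.Unary using (Pred; Decidable)

-- Adjacency is decidable, so that the constructive reading of the notions
-- below agrees with the classical one.
record Graph (n : ℕ) : Set₁ where
  field
    Adj    : Rel (Fin n) 0ℓ
    adj?   : Binary.Decidable Adj
    symm   : Symmetric Adj
    irrefl : ∀ {v} → ¬ Adj v v

-- A cycle v₁ v₂ … vₖ v₁ is represented by the list v₁ ∷ v₂ ∷ … ∷ vₖ ∷ [],
-- whose length k is the length of the cycle; `close` repeats v₁ at the end.
close : {A : Set} → List A → List A
close []       = []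
close (x ∷ xs) = x ∷ xs ++ [ x ]

CyclicSucc : {A : Set} → List A → Rel A 0ℓ
CyclicSucc xs u v = ∃ λ ps → ∃ λ qs → close xs ≡ ps ++ u ∷ v ∷ qs

module _ {n : ℕ} (G : Graph n) where
  open Graph G

  IsCycle : Pred (List (Fin n)) 0ℓ
  IsCycle xs = 3 ≤ length xs × Unique xs × Linked Adj (close xs)

  -- The subgraph induced by the vertices of the cycle has no further edges.
  IsInducedCycle : Pred (List (Fin n)) 0ℓ
  IsInducedCycle xs = IsCycle xs ×
    (∀ {u v} → u List.∈ xs → v List.∈ xs → Adj u v →
       CyclicSucc xs u v ⊎ CyclicSucc xs v u)

  Chordal : Set
  Chordal = ∀ xs → IsInducedCycle xs → length xs ≡ 3

  -- G − X is connected.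
  ConnectedAfterRemoving : Pred (Subset n) 0ℓ
  ConnectedAfterRemoving X = ∀ {u v} → u ∉ X → v ∉ X →
    Star (λ x y → x ∉ X × y ∉ X × Adj x y) u v

  KConnected : ℕ → Set
  KConnected k = k < n × (∀ X → ∣ X ∣ < k → ConnectedAfterRemoving X)

  IsClique : Pred (Subset n) 0ℓ
  IsClique S = ∀ u v → u ∈ S → v ∈ S → u ≢ v → Adj u v

  IsCliqueNumber : Pred ℕ 0ℓ
  IsCliqueNumber k =
    (∃ λ S → IsClique S × ∣ S ∣ ≡ k) × (∀ S → IsClique S → ∣ S ∣ ≤ k)

  IsLongestCycle : Pred (List (Fin n)) 0ℓ
  IsLongestCycle xs = IsCycle xs × (∀ ys → IsCycle ys → length ys ≤ length xs)

  IsLongestCycleTransversal : Pred (Subset n) 0ℓ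
  IsLongestCycleTransversal S = ∀ xs → IsLongestCycle xs → Any (_∈ S) xs

  IsLongestCycleTransversalNumber : Pred ℕ 0ℓ
  IsLongestCycleTransversalNumber k =
    (∃ λ S → IsLongestCycleTransversal S × ∣ S ∣ ≡ k) ×
    (∀ S → IsLongestCycleTransversal S → k ≤ ∣ S ∣)

least : {P : Pred ℕ 0ℓ} → Decidable P → ∀ m → P m →
        ∃ λ k → P k × (∀ j → P j → k ≤ j)
least P? m pm with P? 0
... | yes p0 = 0 , p0 , λ _ _ → z≤n
least P? zero    pm | no ¬p0 = contradiction pm ¬p0
least P? (suc m) pm | no ¬p0 with least (P? ∘ suc) m pm
... | k , pk , min = suc k , pk , λ where
  zero    p0 → contradiction p0 ¬p0
  (suc j) pj → s≤s (min j pj)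

greatest : {P : Pred ℕ 0ℓ} → Decidable P → ∃ P →
           ∀ b → (∀ j → P j → j ≤ b) →
           ∃ λ k → P k × (∀ j → P j → j ≤ k)
greatest P? e b bd with P? b
... | yes pb = b , pb , bd
greatest P? (m , pm) zero bd | no ¬pb with bd m pm
... | z≤n = contradiction pm ¬pb
greatest P? e (suc b) bd | no ¬pb =
  greatest P? e b λ j pj →
    ≤-pred (≤∧≢⇒< (bd j pj) λ { refl → ¬pb pj })

unique-lookup-injective : {A : Set} {xs : List A} → Unique xs →
                          Injective _≡_ _≡_ (lookup xs)
unique-lookup-injective (_  ∷ _) {zero}  {zero}  _  = refl
unique-lookup-injective {xs = _ ∷ xs} (px ∷ _) {zero}  {suc j} eq =
  contradiction eq (All.lookup px (∈-lookup j))
unique-lookup-injective {xs = _ ∷ xs} (px ∷ _) {suc i} {zero}  eq =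
  contradiction (sym eq) (All.lookup px (∈-lookup i))
unique-lookup-injective (_  ∷ u) {suc i} {suc j} eq =
  cong suc (unique-lookup-injective u eq)

unique⇒length≤ : ∀ {n} {xs : List (Fin n)} → Unique xs → length xs ≤ n
unique⇒length≤ u = Fin.injective⇒≤ (unique-lookup-injective u)

anyShortList? : ∀ {n} b {P : Pred (List (Fin n)) 0ℓ} → Decidable P →
                Dec (∃ λ xs → length xs ≤ b × P xs)
anyShortList? zero P? = map′
  (λ p → [] , z≤n , p) (λ { ([] , _ , p) → p }) (P? [])
anyShortList? (suc b) P? = map′
  (λ { (inj₁ p) → [] , z≤n , p
     ; (inj₂ (x , xs , le , p)) → x ∷ xs , s≤s le , p })
  (λ { ([] , _ , p) → inj₁ p
     ; (x ∷ xs , s≤s le , p) → inj₂ (x , xs , le , p) })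
  (P? [] ⊎-dec Fin.any? λ x → anyShortList? b (P? ∘ (x ∷_)))

module _ {n : ℕ} (G : Graph n) where
  open Graph G

  isCycle? : Decidable (IsCycle G)
  isCycle? xs =
    3 ≤? length xs ×-dec unique? Fin._≟_ xs ×-dec linked? adj? (close xs)

  allCycles? : {P : Pred (List (Fin n)) 0ℓ} → Decidable P →
               Dec (∀ xs → IsCycle G xs → P xs)
  allCycles? P? = map′
    (λ ¬e xs c → decidable-stable (P? xs) λ ¬p →
       ¬e (xs , unique⇒length≤ (proj₁ (proj₂ c)) , c , ¬p))
    (λ { all (xs , _ , c , ¬p) → ¬p (all xs c) })
    (¬? (anyShortList? n λ xs → isCycle? xs ×-dec ¬? (P? xs)))

  isLongestCycle? : Decidable (IsLongestCycle G)
  isLongestCycle? xs =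
    isCycle? xs ×-dec allCycles? (λ ys → length ys ≤? length xs)

  isLongestCycleTransversal? : Decidable (IsLongestCycleTransversal G)
  isLongestCycleTransversal? S = map′
    (λ f xs l → f xs (proj₁ l) l)
    (λ f xs _ → f xs)
    (allCycles? λ xs → isLongestCycle? xs →-dec Any.any? (_∈? S) xs)

  isClique? : Decidable (IsClique G)
  isClique? S = Fin.all? λ u → Fin.all? λ v →
    u ∈? S →-dec v ∈? S →-dec ¬? (u Fin.≟ v) →-dec adj? u v

  cliqueNumber : ∃ (IsCliqueNumber G)
  cliqueNumber with greatest
    (λ k → anySubset? λ S → isClique? S ×-dec ∣ S ∣ ≟ k)
    (∣ ⊥ {n} ∣ , ⊥ , (λ _ _ u∈⊥ → contradiction u∈⊥ ∉⊥) , refl)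
    n (λ { _ (S , _ , refl) → ∣p∣≤n S })
  ... | k , attained , max = k , attained , λ S c → max ∣ S ∣ (S , c , refl)

  longestCycleTransversalNumber : ∃ (IsLongestCycleTransversalNumber G)
  longestCycleTransversalNumber with least
    (λ k → anySubset? λ S → isLongestCycleTransversal? S ×-dec ∣ S ∣ ≟ k)
    ∣ ⊤ {n} ∣ (⊤ , (λ { (_ ∷ _) _ → here ∈⊤ ; [] ((() , _) , _) }) , refl)
  ... | k , attained , min = k , attained , λ S t → min ∣ S ∣ (S , t , refl)

  ω : ℕ
  ω = proj₁ cliqueNumber

  lct : ℕ
  lct = proj₁ longestCycleTransversalNumber

{-# OPTIONS --safe #-}
module Submission where

open import Defs
import Data.Bool.Properties as Bool
open import Data.Empty using (⊥; ⊥-elim)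
open import Data.Fin.Base using (Fin; fromℕ<)
import Data.Fin.Properties as Fin
open import Data.Fin.Subset using (Subset; _∈_; _∉_; _⊆_; _∪_; _-_; ⁅_⁆; ∣_∣)
import Data.Fin.Subset as Subset
open import Data.Fin.Subset.Properties using (_∈?_; x∈⁅y⁆⇒x≡y; x∈⁅x⁆; ∣⁅x⁆∣≡1; ∣⊥∣≡0; ∉⊥; ⊆-antisym; p⊆p∪q; q⊆p∪q; x∈p∪q⁻; ∣p∣≤n; p⊂q⇒∣p∣<∣q∣; x∈p∧x≢y⇒x∈p-y; x∈p⇒∣p-x∣<∣p∣)
open import Data.List.Base using (List; []; _∷_; _++_; [_]; length; reverse; allFin; filter)
open import Data.List.Properties using (length-++; length-reverse; unfold-reverse; ++-assoc)
import Data.List.Membership.DecPropositional as DecMem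
open import Data.List.Membership.Propositional using (find) renaming (_∈_ to _∈ˡ_; _∉_ to _∉ˡ_)
open import Data.List.Membership.Propositional.Properties using (∈-++⁺ˡ; ∈-++⁺ʳ; ∈-++⁻; ∈-∃++; ∈-allFin; ∈-filter⁺; ∈-filter⁻)
open import Data.List.Relation.Unary.All as All using (All; []; _∷_)
import Data.List.Relation.Unary.All.Properties as All
open import Data.List.Relation.Unary.AllPairs using ([]; _∷_)
open import Data.List.Relation.Unary.Any as Any using (Any; here; there)
import Data.List.Relation.Unary.Any.Properties as Any
open import Data.List.Relation.Unary.Linked using (Linked; [-]; _∷_)
open import Data.List.Relation.Unary.Unique.Propositional using (Unique)
import Data.List.Relation.Unary.Unique.Propositional.Properties as Unique
open import Data.Nat.Base using (ℕ; zero; suc; _+_; _∸_; _⊔_; _≤_; _<_; z≤n; s≤s)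
open import Data.Nat.Induction using (<-wellFounded)
open import Data.Nat.Properties hiding (_≟_)
open import Data.Nat.Tactic.RingSolver using (solve-∀)
open import Data.Product.Base using (∃; ∃₂; _×_; _,_; proj₁; proj₂)
open import Data.Sum.Base using (_⊎_; inj₁; inj₂; [_,_]′; swap)
open import Data.Unit.Base using (⊤; tt)
open import Data.Vec.Base using (tabulate)
open import Data.Vec.Properties using (lookup∘tabulate; lookup⇒[]=; []=⇒lookup; ≡-dec)
open import Function.Base using (_∘_; id)
open import Induction.WellFounded using (Acc; acc)
open import Level using (0ℓ)
open import Relation.Binary.Construct.Closure.ReflexiveTransitive as Star using (Star; ε; _◅_; _◅◅_)
open import Relation.Binary.PropositionalEquality using (_≡_; _≢_; refl; sym; trans; cong; subst)
open import Relation.Nullary.Decidable using (Dec; yes; no; does; map′; _×-dec_; _⊎-dec_; _→-dec_; ¬?; dec-true; decidable-stable)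
open import Relation.Nullary.Negation using (¬_; contradiction)
open import Relation.Unary using (Pred; Decidable)

-- Suppose that every set of at most max {1, ω − 3} vertices is avoided by a
-- longest cycle. Call a longest cycle fenced by a maximal clique K if it leaves
-- a vertex of K out, meets K in at most three vertices, and lies, apart from
-- these, in one component A of G − K. As a longest cycle that misses a vertex of
-- K has no two consecutive vertices in K, it splits into at most three segments
-- with ends in K. Chordality gives a vertex of A adjacent to all neighbours of A
-- in K, so each component misses a vertex of K, and recombining the segments of
-- several longest cycles shows that every maximal clique fences one.
--
-- Choose K, A and a cycle C fenced by K in A with A minimal, and let K′ be a
-- maximal clique containing S = N(A) ∩ K and a vertex of A adjacent to all of S.
-- By minimality K′ fences a cycle C′ on the other side of S. Two longest cycles
-- of a 2-connected graph share at least two vertices, so the traces of C and C′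
-- on S overlap in two vertices, and C, C′ and a further longest cycle with a
-- prescribed trace on K can be recombined into a longer cycle.

-- Why `ω − 3`: deleting three chosen vertices from a clique leaves a set small enough to be avoided
-- by a longest cycle, so the trace on K can be confined to any three vertices of K. The 1 in the
-- maximum serves cliques that are too small for this.
--
-- Most contradictions count in the same way. Segments of two longest cycles are regrouped into two
-- new cycles, with edges of K filling the gaps. The interiors cancel, while the vertices of K are
-- used more often than before, so the total exceeds twice the maximum length.
--
-- The obstacle is that segments of different cycles may intersect. Relative to a single clique,
-- disjointness comes from the components containing the segments: a segment that ends at d does not
-- lie in a component missing d. This gives nothing for cycles confined to one component, which is
-- why fenced cycles have to be excluded separately. Across the separator S disjointness is free,
-- since one cycle lives in A ∪ S and the other avoids A.

Disj : {A : Set} → Pred A 0ℓ → Pred A 0ℓ → Set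
Disj M N = ∀ u → M u → N u → ⊥

unique-++⁻ : {A : Set} (xs : List A) {ys : List A} → Unique (xs ++ ys) →
             Unique xs × Unique ys × Disj (_∈ˡ xs) (_∈ˡ ys)
unique-++⁻ [] u = [] , u , λ _ ()
unique-++⁻ (x ∷ xs) (px ∷ u) with unique-++⁻ xs u
... | uxs , uys , d = All.++⁻ˡ xs px ∷ uxs , uys , λ where
  _ (here refl) m → All.lookup (All.++⁻ʳ xs px) m refl
  v (there l)   m → d v l m

unique-reverse : {A : Set} (xs : List A) → Unique xs → Unique (reverse xs)
unique-reverse [] u = []
unique-reverse (x ∷ xs) (px ∷ u) = subst Unique (sym (unfold-reverse x xs))
  (Unique.++⁺ (unique-reverse xs u) ([] ∷ [])
    λ { (m , here refl) → All.lookup px (Any.reverse⁻ m) refl })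

-- Walks, chains and rotations of cycles.

module _ {n : ℕ} (G : Graph n) where
  open Graph G

  Walk : Fin n → List (Fin n) → Fin n → Set
  Walk x []       y = Adj x y
  Walk x (z ∷ zs) y = Adj x z × Walk z zs y

  walk-++ : ∀ {x y z} xs {ys} → Walk x xs y → Walk y ys z → Walk x (xs ++ y ∷ ys) z
  walk-++ []       a       w = a , w
  walk-++ (_ ∷ xs) (a , v) w = a , walk-++ xs v w

  walk-split : ∀ {x y z} xs {ys} → Walk x (xs ++ y ∷ ys) z → Walk x xs y × Walk y ys z
  walk-split []       (a , w) = a , w
  walk-split (_ ∷ xs) (a , w) with walk-split xs w
  ... | v , w′ = (a , v) , w′

  walk-reverse : ∀ {x y} xs → Walk x xs y → Walk y (reverse xs) x
  walk-reverse []       a       = symm a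
  walk-reverse {x} {y} (z ∷ xs) (a , w) = subst (λ l → Walk y l x) (sym (unfold-reverse z xs))
    (walk-++ (reverse xs) (walk-reverse xs w) (symm a))

  walk⇒linked : ∀ {x y} xs → Walk x xs y → Linked Adj (x ∷ xs ++ [ y ])
  walk⇒linked []       a       = a ∷ [-]
  walk⇒linked (_ ∷ xs) (a , w) = a ∷ walk⇒linked xs w

  linked⇒walk : ∀ {x y} xs → Linked Adj (x ∷ xs ++ [ y ]) → Walk x xs y
  linked⇒walk []       (a ∷ _) = a
  linked⇒walk (_ ∷ xs) (a ∷ l) = a , linked⇒walk xs l

  -- `M` bounds the interior from above only, and nothing is said about the ends. Gluing therefore
  -- asks for disjoint predicates and for ends outside them, never for a comparison of lists.
  record Chain (x y : Fin n) (ℓ : ℕ) (M : Pred (Fin n) 0ℓ) : Set where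
    constructor chain
    field
      int   : List (Fin n)
      walk  : Walk x int y
      uniq  : Unique int
      len   : length int ≡ ℓ
      inner : ∀ {u} → u ∈ˡ int → M u

  ∅ : Pred (Fin n) 0ℓ
  ∅ _ = ⊥

  edge : ∀ {x y} → Adj x y → Chain x y 0 ∅
  edge a = chain [] a [] refl λ ()

  chain-map : ∀ {x y ℓ M N} → (∀ {u} → M u → N u) → Chain x y ℓ M → Chain x y ℓ N
  chain-map f (chain xs w u l i) = chain xs w u l (f ∘ i)

  chain-rev : ∀ {x y ℓ M} → Chain x y ℓ M → Chain y x ℓ M
  chain-rev (chain xs w u l i) =
    chain (reverse xs) (walk-reverse xs w) (unique-reverse xs u)
      (trans (length-reverse xs) l) (i ∘ Any.reverse⁻)

  chain-++ : ∀ {x y z ℓ m M N} → Chain x y ℓ M → Chain y z m N →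
             ¬ M y → ¬ N y → Disj M N → Chain x z (ℓ + suc m) (λ u → u ≡ y ⊎ M u ⊎ N u)
  chain-++ {y = y} {M = M} {N} (chain xs v u refl i) (chain ys w t refl j) ¬M ¬N d =
    chain (xs ++ y ∷ ys) (walk-++ xs v w)
      (Unique.++⁺ u (All.tabulate (λ m y≡ → ¬N (subst N (sym y≡) (j m))) ∷ t)
        λ { (m , here refl) → ¬M (i m) ; (m , there m′) → d _ (i m) (j m′) })
      (length-++ xs) λ {u} → inn {u}
    where
    inn : ∀ {u} → u ∈ˡ xs ++ y ∷ ys → u ≡ y ⊎ M u ⊎ N u
    inn m with ∈-++⁻ xs m
    ... | inj₁ l           = inj₂ (inj₁ (i l))
    ... | inj₂ (here refl) = inj₁ refl
    ... | inj₂ (there r)   = inj₂ (inj₂ (j r))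

  closed-chain-cycle : ∀ {x ℓ M} → (c : Chain x x ℓ M) → ¬ M x → 2 ≤ ℓ → IsCycle G (x ∷ Chain.int c)
  closed-chain-cycle {x} {M = M} (chain xs w u refl i) ¬M le =
    s≤s le , All.tabulate (λ m x≡ → ¬M (subst M (sym x≡) (i m))) ∷ u , walk⇒linked xs w

  cycle⇒walk : ∀ {x xs} → IsCycle G (x ∷ xs) → Walk x xs x
  cycle⇒walk {xs = xs} (_ , _ , l) = linked⇒walk xs l

  record RotatedTo (v : Fin n) (C : List (Fin n)) : Set where
    field
      rest  : List (Fin n)
      cycle : IsCycle G (v ∷ rest)
      size  : suc (length rest) ≡ length C
      from  : ∀ {u} → u ∈ˡ C → u ∈ˡ v ∷ rest
      to    : ∀ {u} → u ∈ˡ v ∷ rest → u ∈ˡ C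

  rotate : ∀ {v C} → IsCycle G C → v ∈ˡ C → RotatedTo v C
  rotate {v} {C} c v∈C with ∈-∃++ v∈C
  rotate c v∈C | [] , ys , refl = record
    { rest = ys ; cycle = c ; size = refl ; from = id ; to = id }
  rotate {v} c@(le , u , l) v∈C | x ∷ xs , ys , refl with unique-++⁻ (x ∷ xs) u | walk-split xs (cycle⇒walk c)
  ... | uxs , (py ∷ uys) , d | w₁ , w₂ = record
    { rest  = ys ++ x ∷ xs
    ; cycle = subst (3 ≤_) (sym eq) le
            , Unique.++⁺ (py ∷ uys) uxs (λ (p , q) → d _ q p)
            , walk⇒linked (ys ++ x ∷ xs) (walk-++ ys w₂ w₁)
    ; size  = eq
    ; from  = ++-swap (x ∷ xs)
    ; to    = ++-swap (v ∷ ys) }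
    where
    eq : suc (length (ys ++ x ∷ xs)) ≡ length (x ∷ xs ++ v ∷ ys)
    eq = trans (cong suc (length-++ ys))
         (trans (+-comm (suc (length ys)) (suc (length xs))) (cong suc (sym (length-++ xs))))
    ++-swap : ∀ {u} as {bs} → u ∈ˡ as ++ bs → u ∈ˡ bs ++ as
    ++-swap as {bs} m with ∈-++⁻ as m
    ... | inj₁ l = ∈-++⁺ʳ bs l
    ... | inj₂ r = ∈-++⁺ˡ r

  -- Cycles through a clique, assembled from segments.

  module Longest (L : ℕ) (maxL : ∀ ys → IsCycle G ys → length ys ≤ L) where

    -- The condition `1 ≤ ℓ + m` excludes the closed walk that runs back and forth along one edge.
    close-chains : ∀ {x y ℓ m M N} → Chain x y ℓ M → Chain y x m N → x ≢ y →
      ¬ M x → ¬ M y → ¬ N x → ¬ N y → Disj M N → 1 ≤ ℓ + m → 2 + (ℓ + m) ≤ L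
    close-chains {x} {y} {ℓ} {m} {M} {N} s t x≢y Mx My Nx Ny d le =
      subst (_≤ L) (cong suc (trans (Chain.len c) (+-suc ℓ m)))
        (maxL _ (closed-chain-cycle c out (subst (2 ≤_) (sym (+-suc ℓ m)) (s≤s le))))
      where
      c : Chain x x (ℓ + suc m) (λ u → u ≡ y ⊎ M u ⊎ N u)
      c = chain-++ s t My Ny d
      out : ¬ (x ≡ y ⊎ M x ⊎ N x)
      out (inj₁ e)        = x≢y e
      out (inj₂ (inj₁ p)) = Mx p
      out (inj₂ (inj₂ p)) = Nx p

    -- `vs` lists the vertices of K passed on the way, M contains all the others.
    record Route (K : Subset n) (x y : Fin n) (vs : List (Fin n)) (ℓ : ℕ) (M : Pred (Fin n) 0ℓ) : Set where
      constructor route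
      field
        links : Chain x y ℓ (λ u → u ∈ˡ vs ⊎ M u)
        avoid : ∀ {u} → M u → u ∉ K
        via   : ∀ {u} → u ∈ˡ vs → u ∈ K

    Seg : Subset n → Fin n → Fin n → ℕ → Pred (Fin n) 0ℓ → Set
    Seg K x y = Route K x y []

    seg : ∀ {K x y ℓ M} → Chain x y ℓ M → (∀ {u} → M u → u ∉ K) → Seg K x y ℓ M
    seg c av = route (chain-map inj₂ c) av λ ()

    seg-chain : ∀ {K x y ℓ M} → Seg K x y ℓ M → Chain x y ℓ M
    seg-chain s = chain-map (λ { (inj₁ ()) ; (inj₂ m) → m }) (Route.links s)

    seg-rev : ∀ {K x y ℓ M} → Seg K x y ℓ M → Seg K y x ℓ M
    seg-rev (route l a v) = route (chain-rev l) a v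

    step : ∀ {K x y z vs ℓ m M N} → Seg K x y ℓ M → Route K y z vs m N →
           y ∈ K → y ∉ˡ vs → Disj M N → Route K x z (y ∷ vs) (ℓ + suc m) (λ u → M u ⊎ N u)
    step {y = y} {vs} {M = M} {N} s (route l a v) y∈K y∉vs d = route
      (chain-map
        (λ { (inj₁ refl) → inj₁ (here refl) ; (inj₂ (inj₁ m)) → inj₂ (inj₁ m)
           ; (inj₂ (inj₂ (inj₁ m))) → inj₁ (there m) ; (inj₂ (inj₂ (inj₂ m))) → inj₂ (inj₂ m) })
        (chain-++ (seg-chain s) l (λ m → Route.avoid s m y∈K)
          (λ { (inj₁ m) → y∉vs m ; (inj₂ m) → a m y∈K })
          (λ { _ m (inj₁ q) → Route.avoid s m (v q) ; u m (inj₂ q) → d u m q })))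
      (λ { (inj₁ m) → Route.avoid s m ; (inj₂ m) → a m })
      (λ { (here refl) → y∈K ; (there m) → v m })

    close-route : ∀ {K x y vs ℓ m M N} → Seg K x y ℓ M → Route K y x vs m N →
      x ∈ K → y ∈ K → x ≢ y → x ∉ˡ vs → y ∉ˡ vs → Disj M N → 1 ≤ ℓ + m → 2 + (ℓ + m) ≤ L
    close-route s r x∈K y∈K x≢y x∉ y∉ d =
      close-chains (seg-chain s) (Route.links r) x≢y
        (λ m → Route.avoid s m x∈K) (λ m → Route.avoid s m y∈K)
        (λ { (inj₁ m) → x∉ m ; (inj₂ m) → Route.avoid r m x∈K })
        (λ { (inj₁ m) → y∉ m ; (inj₂ m) → Route.avoid r m y∈K })
        (λ { _ m (inj₁ q) → Route.avoid s m (Route.via r q) ; u m (inj₂ q) → d u m q })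

    module Shapes {K : Subset n} (clique : IsClique G K) where

      kedge : ∀ {x y} → x ∈ K → y ∈ K → x ≢ y → Seg K x y 0 ∅
      kedge x∈ y∈ ne = seg (edge (clique _ _ x∈ y∈ ne)) λ ()

      seg∪ : ∀ {M N O : Pred (Fin n) 0ℓ} → Disj M N → Disj M O → Disj M (λ u → N u ⊎ O u)
      seg∪ d e u m (inj₁ p) = d u m p
      seg∪ d e u m (inj₂ p) = e u m p

      -- Here and in the two larger versions any side may be a `kedge`, so segments with distinct
      -- ends in K can be closed up with edges of K. The constant counts the vertices of K on the
      -- cycle.
      cyc3 : ∀ {a b c p q r M N O} → Seg K a b p M → Seg K b c q N → Seg K c a r O →
        a ∈ K → b ∈ K → c ∈ K → a ≢ b → b ≢ c → a ≢ c →
        Disj M N → Disj M O → Disj N O → 3 + p + q + r ≤ L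
      cyc3 {p = p} {q} {r} s t w a∈ b∈ c∈ ab bc ac d e f =
        subst (_≤ L) (eq p q r) (close-route s (step t w c∈ (λ ()) f) a∈ b∈ ab
          (λ { (here z) → ac z }) (λ { (here z) → bc z }) (seg∪ d e)
          (≤-trans (s≤s z≤n) (≤-reflexive (sym (eq′ p q r)))))
        where
        eq : ∀ p q r → 2 + (p + (q + suc r)) ≡ 3 + p + q + r
        eq = solve-∀
        eq′ : ∀ p q r → p + (q + suc r) ≡ suc (p + q + r)
        eq′ = solve-∀

      cyc4 : ∀ {a b c d p q r s M N O P} →
        Seg K a b p M → Seg K b c q N → Seg K c d r O → Seg K d a s P →
        a ∈ K → b ∈ K → c ∈ K → d ∈ K →
        a ≢ b → a ≢ c → a ≢ d → b ≢ c → b ≢ d → c ≢ d →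
        Disj M N → Disj M O → Disj M P → Disj N O → Disj N P → Disj O P → 4 + p + q + r + s ≤ L
      cyc4 {p = p} {q} {r} {s} S T U V a∈ b∈ c∈ d∈ ab ac ad bc bd cd mn mo mp nO np op =
        subst (_≤ L) (eq p q r s) (close-route S (step T (step U V d∈ (λ ()) op) c∈
            (λ { (here z) → cd z }) (seg∪ nO np)) a∈ b∈ ab
          (λ { (here z) → ac z ; (there (here z)) → ad z }) (λ { (here z) → bc z ; (there (here z)) → bd z })
          (seg∪ mn (seg∪ mo mp))
          (≤-trans (s≤s z≤n) (≤-reflexive (sym (eq′ p q r s)))))
        where
        eq : ∀ p q r s → 2 + (p + (q + suc (r + suc s))) ≡ 4 + p + q + r + s
        eq = solve-∀
        eq′ : ∀ p q r s → p + (q + suc (r + suc s)) ≡ suc (suc (p + q + r + s))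
        eq′ = solve-∀

      cyc5 : ∀ {a b c d e p q r s t M N O P Q} →
        Seg K a b p M → Seg K b c q N → Seg K c d r O → Seg K d e s P → Seg K e a t Q →
        a ∈ K → b ∈ K → c ∈ K → d ∈ K → e ∈ K →
        a ≢ b → a ≢ c → a ≢ d → a ≢ e → b ≢ c → b ≢ d → b ≢ e → c ≢ d → c ≢ e → d ≢ e →
        Disj M N → Disj M O → Disj M P → Disj M Q → Disj N O → Disj N P → Disj N Q →
        Disj O P → Disj O Q → Disj P Q → 5 + p + q + r + s + t ≤ L
      cyc5 {p = p} {q} {r} {s} {t} S T U V W a∈ b∈ c∈ d∈ e∈ ab ac ad ae bc bd be cd ce de
          mn mo mp mq nO np nq op oq pq =
        subst (_≤ L) (eq p q r s t) (close-route S
          (step T (step U (step V W e∈ (λ ()) pq) d∈ (λ { (here z) → de z }) (seg∪ op oq)) c∈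
            (λ { (here z) → cd z ; (there (here z)) → ce z }) (seg∪ nO (seg∪ np nq))) a∈ b∈ ab
          (λ { (here z) → ac z ; (there (here z)) → ad z ; (there (there (here z))) → ae z })
          (λ { (here z) → bc z ; (there (here z)) → bd z ; (there (there (here z))) → be z })
          (seg∪ mn (seg∪ mo (seg∪ mp mq)))
          (≤-trans (s≤s z≤n) (≤-reflexive (sym (eq′ p q r s t)))))
        where
        eq : ∀ p q r s t → 2 + (p + (q + suc (r + suc (s + suc t)))) ≡ 5 + p + q + r + s + t
        eq = solve-∀
        eq′ : ∀ p q r s t → p + (q + suc (r + suc (s + suc t))) ≡ suc (suc (suc (p + q + r + s + t)))
        eq′ = solve-∀

-- Both `suc i` and `suc j` are at least half of `L`, so their sum is at least `L`.
halves-too-long : ∀ {L i j} → L ≤ suc i + suc i → L ≤ suc j + suc j → suc (suc i + suc j) ≤ L → ⊥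
halves-too-long {L} {i} {j} p q r with ≤-total i j
... | inj₁ i≤j = <-irrefl refl (≤-trans r (≤-trans p (+-monoʳ-≤ (suc i) (s≤s i≤j))))
... | inj₂ j≤i = <-irrefl refl (≤-trans r (≤-trans q (+-monoˡ-≤ (suc j) (s≤s j≤i))))

-- Paths, induced paths and decidable reachability.

module _ {n : ℕ} (G : Graph n) where
  open Graph G
  open DecMem (Fin._≟_ {n}) using () renaming (_∈?_ to _∈ˡ?_)

  -- The list omits the first vertex and ends with the last one.
  Path : Fin n → List (Fin n) → Fin n → Set
  Path u []       v = u ≡ v
  Path u (w ∷ ws) v = Adj u w × Path w ws v

  path? : ∀ u xs v → Dec (Path u xs v)
  path? u []       v = u Fin.≟ v
  path? u (w ∷ ws) v = adj? u w ×-dec path? w ws v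

  path-++ : ∀ {u q v} xs {ys} → Path u xs q → Path q ys v → Path u (xs ++ ys) v
  path-++ []       refl    p = p
  path-++ (_ ∷ xs) (a , w) p = a , path-++ xs w p

  path-suffix : ∀ {u xs v q} → Path u xs v → q ∈ˡ u ∷ xs →
    ∃ λ ys → Path q ys v × (∀ {z} → z ∈ˡ q ∷ ys → z ∈ˡ u ∷ xs)
  path-suffix p (here refl) = _ , p , id
  path-suffix {xs = w ∷ ws} (a , p) (there m) with path-suffix p m
  ... | ys , p′ , sub = ys , p′ , there ∘ sub

  path-suffix⁺ : ∀ {u xs v q} → Path u xs v → q ∈ˡ xs →
    ∃ λ ys → Path q ys v × (∀ {z} → z ∈ˡ q ∷ ys → z ∈ˡ xs)
  path-suffix⁺ {xs = w ∷ ws} (a , p) m = path-suffix p m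

  last-exit : ∀ X {u xs v} → Path u xs v → Any (_∈ˡ X) (u ∷ xs) →
    ∃₂ λ u′ xs′ → u′ ∈ˡ X × Path u′ xs′ v × (∀ {z} → z ∈ˡ xs′ → z ∉ˡ X) ×
      (∀ {z} → z ∈ˡ u′ ∷ xs′ → z ∈ˡ u ∷ xs)
  last-exit X {u} {xs} p h with Any.any? (_∈ˡ? X) xs
  last-exit X {xs = w ∷ ws} (a , p) h | yes h′ with last-exit X p h′
  ... | u′ , xs′ , i , p′ , av , sub = u′ , xs′ , i , p′ , av , there ∘ sub
  last-exit X {u} {xs} p (here i)  | no ¬h = u , xs , i , p , (λ m k → ¬h (Any.map (λ { refl → k }) m)) , id
  last-exit X          p (there h) | no ¬h = contradiction h ¬h

  first-entry : ∀ Y {u} xs {v} → Path u xs v → v ∈ˡ Y →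
    ∃₂ λ v′ xs′ → v′ ∈ˡ Y × Path u xs′ v′ × (∀ {z} → z ∈ˡ u ∷ xs′ → z ∈ˡ Y → z ≡ v′) ×
      (∀ {z} → z ∈ˡ u ∷ xs′ → z ∈ˡ u ∷ xs)
  first-entry Y {u} xs p v∈Y with u ∈ˡ? Y
  ... | yes i = u , [] , i , refl , (λ { (here e) _ → e }) , (λ { (here refl) → here refl })
  first-entry Y []       refl    v∈Y | no ¬i = contradiction v∈Y ¬i
  first-entry Y (w ∷ ws) (a , p) v∈Y | no ¬i with first-entry Y ws p v∈Y
  ... | v′ , xs′ , i , p′ , av , sub = v′ , w ∷ xs′ , i , (a , p′) ,
    (λ { (here refl) k → contradiction k ¬i ; (there m) k → av m k }) ,
    (λ { (here refl) → here refl ; (there m) → there (sub m) })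

  -- The first entry is exempt from non-adjacency because it is the next vertex of the path.
  Far : Fin n → List (Fin n) → Set
  Far x []       = ⊤
  Far x (y ∷ ys) = x ≢ y × All (λ z → x ≢ z × ¬ Adj x z) ys

  Induced : List (Fin n) → Set
  Induced []       = ⊤
  Induced (x ∷ xs) = Far x xs × Induced xs

  induced-unique : ∀ xs → Induced xs → Unique xs
  induced-unique []           _             = []
  induced-unique (x ∷ [])     _             = [] ∷ []
  induced-unique (x ∷ y ∷ ys) ((ne , f) , i) = (ne ∷ All.map proj₁ f) ∷ induced-unique (y ∷ ys) i

  -- The path is cut off before its last vertex that is equal or adjacent to `u`; beyond that vertex
  -- no chord at `u` can remain.
  induced-cons : ∀ u {w ys v} → Path w ys v → Induced (w ∷ ys) → Any (λ z → Adj u z ⊎ u ≡ z) (w ∷ ys) →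
    ∃ λ zs → Path u zs v × Induced (u ∷ zs) × (∀ {z} → z ∈ˡ zs → z ∈ˡ w ∷ ys)
  induced-cons u {w} {ys} p i h with Any.any? (λ z → adj? u z ⊎-dec u Fin.≟ z) ys
  induced-cons u {ys = y ∷ ys} (_ , p) (_ , i) h | yes h′ with induced-cons u p i h′
  ... | zs , p′ , i′ , sub = zs , p′ , i′ , there ∘ sub
  induced-cons u {w} {ys} p i (here (inj₁ a)) | no ¬h = w ∷ ys , (a , p) ,
    (((λ { refl → irrefl a }) ,
      All.tabulate (λ m → (λ { refl → ¬h (Any.map inj₂ m) }) , λ b → ¬h (Any.map (λ { refl → inj₁ b }) m))) , i) ,
    id
  induced-cons u {w} {ys} p i (here (inj₂ refl)) | no ¬h = ys , p , i , there
  induced-cons u p i (there h) | no ¬h = contradiction h ¬h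

  shorten : ∀ {u} xs {v} → Path u xs v →
    ∃ λ ys → Path u ys v × Induced (u ∷ ys) × (∀ {z} → z ∈ˡ ys → z ∈ˡ xs)
  shorten []       p       = [] , p , _ , id
  shorten {u} (w ∷ ws) (a , p) with shorten ws p
  ... | ys , p′ , i , sub with induced-cons u p′ i (here (inj₁ a))
  ... | zs , p″ , i″ , sub′ = zs , p″ , i″ , λ m → lift (sub′ m)
    where
    lift : ∀ {z} → z ∈ˡ w ∷ ys → z ∈ˡ w ∷ ws
    lift (here e)  = here e
    lift (there m) = there (sub m)

  path-last : ∀ {u} xs {v} → Path u xs v → v ∈ˡ u ∷ xs
  path-last []       refl    = here refl
  path-last (_ ∷ xs) (_ , p) = there (path-last xs p)

  path-walk : ∀ {u} w ws {v} → Path u (w ∷ ws) v → ∃ λ is → Walk G u is v × w ∷ ws ≡ is ++ [ v ]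
  path-walk w []       (a , refl) = [] , a , refl
  path-walk w (x ∷ ws) (a , p) with path-walk x ws p
  ... | is , wk , eq = w ∷ is , (a , wk) , cong (w ∷_) eq

  -- The path is trimmed to run from its last vertex in `X` to the first subsequent one in `Y`.
  -- Shortening it to an induced path makes the interior free of repetitions. The equality arises
  -- when only one vertex is left.
  connecting-chain : ∀ X Y {u xs v} → Path u xs v → u ∈ˡ X → v ∈ˡ Y →
    ∃₂ λ u′ v′ → u′ ∈ˡ X × v′ ∈ˡ Y × u′ ∈ˡ u ∷ xs × v′ ∈ˡ u ∷ xs ×
      (u′ ≡ v′ ⊎ ∃ λ m → Chain G u′ v′ m (λ z → z ∈ˡ u ∷ xs × z ∉ˡ X × z ∉ˡ Y))
  connecting-chain X Y {u} {xs} {v} p u∈X v∈Y with last-exit X p (here u∈X)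
  ... | u₁ , xs₁ , u₁∈X , p₁ , av₁ , sub₁ with first-entry Y xs₁ p₁ v∈Y
  ... | v₂ , xs₂ , v₂∈Y , p₂ , av₂ , sub₂ with shorten xs₂ p₂
  ... | [] , refl , _ , _ =
    u₁ , u₁ , u₁∈X , v₂∈Y , sub₁ (here refl) , sub₁ (here refl) , inj₁ refl
  ... | w ∷ ws , p₃ , i₃ , sub₃ with path-walk w ws p₃ | induced-unique _ i₃
  ... | is , wk , eq | pu ∷ uq with subst Unique eq uq
  ... | uq′ with unique-++⁻ is uq′
  ... | uis , _ , d =
    u₁ , v₂ , u₁∈X , v₂∈Y , sub₁ (here refl) , sub₁ (sub₂ (path-last xs₂ p₂)) ,
    inj₂ (length is , chain is wk uis refl λ m →
      let m₃ = subst (_ ∈ˡ_) (sym eq) (∈-++⁺ˡ m)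
          m₂ = sub₃ m₃
          m₁ = sub₂ (there m₂)
      in sub₁ m₁ , not-X (λ { refl → All.lookup pu m₃ refl }) m₁ ,
         λ z∈Y → d _ m (here (av₂ (there m₂) z∈Y)))
    where
    not-X : ∀ {z} → z ≢ u₁ → z ∈ˡ u₁ ∷ xs₁ → z ∉ˡ X
    not-X ne (here e)  = contradiction e ne
    not-X ne (there m) = av₁ m

  Step : Subset n → Fin n → Fin n → Set
  Step X x y = x ∉ X × y ∉ X × Adj x y

  star⇒path : ∀ {X u v} → Star (Step X) u v → ∃ λ xs → Path u xs v × All (_∉ X) xs
  star⇒path ε = [] , refl , []
  star⇒path ((_ , y∉ , a) ◅ s) with star⇒path s
  ... | xs , p , al = _ ∷ xs , (a , p) , y∉ ∷ al

  path⇒star : ∀ {X u} xs {v} → Path u xs v → u ∉ X → All (_∉ X) xs → Star (Step X) u v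
  path⇒star []       refl    u∉ al        = ε
  path⇒star (w ∷ ws) (a , p) u∉ (w∉ ∷ al) = (u∉ , w∉ , a) ◅ path⇒star ws p w∉ al

  abstract
    -- A shortened path repeats no vertex, so it suffices to search lists of length at most `n`.
    -- From a vertex of `X` no step is possible, and only the empty star remains.
    reach? : ∀ X u v → Dec (Star (Step X) u v)
    reach? X u v with u ∈? X
    ... | yes u∈ = map′ (λ { refl → ε }) (λ { ε → refl ; ((u∉ , _) ◅ _) → contradiction u∈ u∉ }) (u Fin.≟ v)
    ... | no  u∉ = map′
      (λ (xs , _ , p , al) → path⇒star xs p u∉ al)
      (λ s → let xs , p , al = star⇒path s
                 ys , q , i , sub = shorten xs p
             in ys , ≤-trans (n≤1+n _) (unique⇒length≤ (induced-unique _ i)) , q ,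
                All.tabulate (All.lookup al ∘ sub))
      (anyShortList? n λ xs → path? u xs v ×-dec All.all? (λ z → ¬? (z ∈? X)) xs)

  -- Two disjoint paths, and longest cycles of 2-connected graphs.

  module TwoConnected (conn : KConnected G 2) where

    connected : ∀ u v → ∃ λ xs → Path u xs v
    connected u v with star⇒path (proj₂ conn Subset.⊥ (subst (_< 2) (sym (∣⊥∣≡0 n)) (s≤s z≤n)) {u} {v} ∉⊥ ∉⊥)
    ... | xs , p , _ = xs , p

    no-cut : ∀ w {u v} → u ≢ w → v ≢ w → ∃ λ xs → Path u xs v × w ∉ˡ u ∷ xs
    no-cut w u≢ v≢ with star⇒path (proj₂ conn ⁅ w ⁆ (subst (_< 2) (sym (∣⁅x⁆∣≡1 w)) (s≤s (s≤s z≤n)))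
                              (u≢ ∘ x∈⁅y⁆⇒x≡y w) (v≢ ∘ x∈⁅y⁆⇒x≡y w))
    ... | xs , p , al = xs , p , λ { (here refl) → u≢ refl ; (there m) → All.lookup al m (x∈⁅x⁆ w) }

    record TwoPaths (X Y : List (Fin n)) : Set where
      constructor twoPaths
      field
        {x₁ x₂ y₁ y₂} : Fin n
        {ps₁ ps₂}     : List (Fin n)
        x₁∈ : x₁ ∈ˡ X
        x₂∈ : x₂ ∈ˡ X
        y₁∈ : y₁ ∈ˡ Y
        y₂∈ : y₂ ∈ˡ Y
        path₁ : Path x₁ ps₁ y₁
        path₂ : Path x₂ ps₂ y₂
        disjoint : ∀ z → z ∈ˡ x₁ ∷ ps₁ → z ∈ˡ x₂ ∷ ps₂ → ⊥

    two-paths-swap : ∀ {X Y} → TwoPaths X Y → TwoPaths X Y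
    two-paths-swap (twoPaths a b c d p q e) = twoPaths b a d c q p λ z m m′ → e z m′ m

    AtLeastTwo : List (Fin n) → Set
    AtLeastTwo X = ∀ v → ∃ λ u → u ∈ˡ X × u ≢ v

    -- The two disjoint paths from p ∷ X are repaired when the first starts at p.
    reroute : ∀ {X Y} → AtLeastTwo X → ∀ {x₀ p x₂ y₁ y₂ ps₁ ps₂} → Adj x₀ p →
      x₀ ∈ˡ X → x₂ ∈ˡ X → y₁ ∈ˡ Y → y₂ ∈ˡ Y → p ∉ˡ X →
      Path p ps₁ y₁ → (∀ {z} → z ∈ˡ ps₁ → z ∉ˡ p ∷ X) →
      Path x₂ ps₂ y₂ → (∀ {z} → z ∈ˡ ps₂ → z ∉ˡ p ∷ X) →
      (∀ z → z ∈ˡ p ∷ ps₁ → z ∈ˡ x₂ ∷ ps₂ → ⊥) → TwoPaths X Y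
    reroute {X} {Y} two {x₀} {p} {x₂} {y₁} {y₂} {ps₁} {ps₂} a x₀∈ x₂∈ y₁∈ y₂∈ p∉X p₁ av₁ p₂ av₂ dis
      with x₂ Fin.≟ x₀
    ... | no x₂≢x₀ = twoPaths x₀∈ x₂∈ y₁∈ y₂∈ (a , p₁) p₂ λ where
      _ (here refl) (here e)  → x₂≢x₀ (sym e)
      _ (here refl) (there m) → av₂ m (there x₀∈)
      z (there m)   m′        → dis z m m′
    -- Both paths would now start at `x₀`. A path from another vertex `x′` of `X` to `p` that avoids
    -- `x₀` first meets the two paths at some `q`. The path through `q` is entered there from `x′`,
    -- and the other one is started at `x₀`.
    ... | yes refl with two x₀
    ... | x′ , x′∈ , x′≢x₀ with no-cut x₀ x′≢x₀ (λ { refl → p∉X x₀∈ })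
    ... | rs , r , x₀∉r with first-entry ((p ∷ ps₁) ++ (x₀ ∷ ps₂)) rs r (here refl)
    ... | q , rs′ , q∈ , r′ , only-q , sub with ∈-++⁻ (p ∷ ps₁) q∈
    ... | inj₁ q∈₁ with path-suffix p₁ q∈₁
    ... | ys , s , sub′ = twoPaths x′∈ x₀∈ y₁∈ y₂∈ (path-++ rs′ r′ s) p₂ λ z m m′ →
      [ (λ m₁ → dis z (subst (_∈ˡ p ∷ ps₁) (sym (only-q m₁ (∈-++⁺ʳ (p ∷ ps₁) m′))) q∈₁) m′)
      , (λ m₂ → dis z (sub′ (there m₂)) m′) ]′ (∈-++⁻ (x′ ∷ rs′) m)
    reroute two {p = p} {ps₁ = ps₁} a x₀∈ x₂∈ y₁∈ y₂∈ p∉X p₁ av₁ p₂ av₂ dis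
      | yes refl | x′ , x′∈ , x′≢x₀ | rs , r , x₀∉r | q , rs′ , q∈ , r′ , only-q , sub | inj₂ (here refl) =
      contradiction (sub (path-last rs′ r′)) x₀∉r
    reroute {X} two {x₀} {p = p} {ps₁ = ps₁} {ps₂} a x₀∈ x₂∈ y₁∈ y₂∈ p∉X p₁ av₁ p₂ av₂ dis
      | yes refl | x′ , x′∈ , x′≢x₀ | rs , r , x₀∉r | q , rs′ , q∈ , r′ , only-q , sub | inj₂ (there q∈₂)
      with path-suffix⁺ p₂ q∈₂
    ... | ys , s , sub′ = twoPaths x₀∈ x′∈ y₁∈ y₂∈ (a , p₁) (path-++ rs′ r′ s) λ z m m′ →
      [ in-r z m , (λ m₂ → in-s z m (sub′ (there m₂))) ]′ (∈-++⁻ (x′ ∷ rs′) m′)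
      where
      in-s : ∀ z → z ∈ˡ x₀ ∷ p ∷ ps₁ → z ∈ˡ ps₂ → ⊥
      in-s z (here refl) m₂ = av₂ m₂ (there x₀∈)
      in-s z (there m)   m₂ = dis z m (there m₂)
      in-r : ∀ z → z ∈ˡ x₀ ∷ p ∷ ps₁ → z ∈ˡ x′ ∷ rs′ → ⊥
      in-r z (here refl) m₁ = x₀∉r (sub m₁)
      in-r z (there m)   m₁ with only-q m₁ (∈-++⁺ˡ m)
      ... | refl = in-s z (there m) q∈₂

    -- Menger's theorem for two paths, by induction on one path from X to Y: its
    -- second vertex is added to X.
    two-paths : ∀ {X Y} → AtLeastTwo X → AtLeastTwo Y →
      ∀ {x₀} xs {y₀} → x₀ ∈ˡ X → Path x₀ xs y₀ → y₀ ∈ˡ Y → TwoPaths X Y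
    two-paths twoX twoY {x₀} [] x₀∈ refl y₀∈ with twoX x₀ | twoY x₀
    ... | x , x∈ , x≢ | y , y∈ , y≢ with no-cut x₀ x≢ y≢
    ... | xs , p , x₀∉ = twoPaths x₀∈ x∈ y₀∈ y∈ refl p λ { z (here refl) m → x₀∉ m }
    two-paths {X} {Y} twoX twoY {x₀} (p ∷ ps) x₀∈ (a , w) y₀∈
      with two-paths {p ∷ X} (λ v → let u , u∈ , ne = twoX v in u , there u∈ , ne) twoY ps (here refl) w y₀∈
    ... | twoPaths x₁∈ x₂∈ y₁∈ y₂∈ p₁ p₂ dis
      with last-exit (p ∷ X) p₁ (here x₁∈) | last-exit (p ∷ X) p₂ (here x₂∈)
    ... | u₁ , ps₁ , u₁∈ , q₁ , av₁ , sub₁ | u₂ , ps₂ , u₂∈ , q₂ , av₂ , sub₂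
      with u₁ ∈ˡ? X | u₂ ∈ˡ? X
    ... | yes i | yes j = twoPaths i j y₁∈ y₂∈ q₁ q₂ λ z m m′ → dis z (sub₁ m) (sub₂ m′)
    two-paths twoX twoY (p ∷ ps) x₀∈ (a , w) y₀∈
      | twoPaths _ _ y₁∈ y₂∈ _ _ dis | _ , _ , there i , _ , _ , _ | _ | no ¬i | _ = contradiction i ¬i
    two-paths twoX twoY (p ∷ ps) x₀∈ (a , w) y₀∈
      | twoPaths _ _ y₁∈ y₂∈ _ _ dis | _ | _ , _ , there j , _ , _ , _ | _ | no ¬j = contradiction j ¬j
    two-paths twoX twoY (p ∷ ps) x₀∈ (a , w) y₀∈
      | twoPaths _ _ y₁∈ y₂∈ _ _ dis | u₁ , ps₁ , here refl , q₁ , av₁ , sub₁ | u₂ , ps₂ , here refl , q₂ , av₂ , sub₂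
      | no ¬i | no _ = ⊥-elim (dis _ (sub₁ (here refl)) (sub₂ (here refl)))
    two-paths twoX twoY (p ∷ ps) x₀∈ (a , w) y₀∈
      | twoPaths _ _ y₁∈ y₂∈ _ _ dis | u₁ , ps₁ , here refl , q₁ , av₁ , sub₁ | u₂ , ps₂ , _ , q₂ , av₂ , sub₂
      | no ¬i | yes j = reroute twoX a x₀∈ j y₁∈ y₂∈ ¬i q₁ av₁ q₂ av₂ λ z m m′ → dis z (sub₁ m) (sub₂ m′)
    two-paths twoX twoY (p ∷ ps) x₀∈ (a , w) y₀∈
      | twoPaths _ _ y₁∈ y₂∈ _ _ dis | u₁ , ps₁ , _ , q₁ , av₁ , sub₁ | u₂ , ps₂ , here refl , q₂ , av₂ , sub₂
      | yes i | no ¬j = two-paths-swap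
        (reroute twoX a x₀∈ i y₂∈ y₁∈ ¬j q₂ av₂ q₁ av₁ λ z m m′ → dis z (sub₁ m′) (sub₂ m))

    cycle-two : ∀ {C} → IsCycle G C → AtLeastTwo C
    cycle-two {[]} (() , _)
    cycle-two {_ ∷ []} (s≤s () , _)
    cycle-two {x ∷ y ∷ C} (_ , (px ∷ _) , _) v with x Fin.≟ v
    ... | no  ne   = x , here refl , ne
    ... | yes refl = y , there (here refl) , λ { refl → All.lookup px (here refl) refl }

    module _ (L : ℕ) (maxL : ∀ ys → IsCycle G ys → length ys ≤ L) where
      open Longest G L maxL

      -- The longer of the two arcs is taken: the two interiors together with `u` and `v` make up
      -- `L` vertices.
      long-arc : ∀ {C} → IsCycle G C → length C ≡ L → ∀ {u v} → u ∈ˡ C → v ∈ˡ C → u ≢ v →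
        ∃ λ i → Chain G u v i (λ z → z ∈ˡ C × z ≢ u × z ≢ v) × L ≤ suc i + suc i
      long-arc {C} c eq {u} {v} u∈ v∈ u≢v with rotate G c u∈
      ... | record { rest = rest ; cycle = c′ ; size = size ; from = from ; to = to } with from v∈
      ... | here e = contradiction (sym e) u≢v
      ... | there v∈r with ∈-∃++ v∈r
      ... | as , bs , refl with walk-split G as (cycle⇒walk G c′) | proj₁ (proj₂ c′)
      ... | w₁ , w₂ | pu ∷ ur with unique-++⁻ as ur
      ... | uas , (pv ∷ ubs) , d with ≤-total (length as) (length bs)
      ... | inj₁ le = length bs , chain-rev G (chain bs w₂ ubs refl λ m →
              to (there (∈-++⁺ʳ as (there m))) , (λ { refl → All.lookup pu (∈-++⁺ʳ as (there m)) refl }) ,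
              (λ { refl → All.lookup pv m refl })) ,
            ≤-trans (≤-reflexive (trans (sym eq) (trans (sym size) (cong suc (length-++ as)))))
              (+-monoˡ-≤ (suc (length bs)) (s≤s le))
      ... | inj₂ le = length as , (chain as w₁ uas refl λ m →
              to (there (∈-++⁺ˡ m)) , (λ { refl → All.lookup pu (∈-++⁺ˡ m) refl }) ,
              (λ { refl → d _ m (here refl) })) ,
            ≤-trans (≤-reflexive (trans (sym eq) (trans (sym size) (cong suc (length-++ as)))))
              (+-monoʳ-≤ (suc (length as)) (s≤s le))

      -- If the cycles meet in one vertex, long arcs from it are joined by a path that avoids it. If
      -- they do not meet, a long arc of each is used between the ends of two disjoint connecting
      -- paths. In both cases two halves and at least one more vertex lie on a cycle.
      share-two : ∀ {C C′} → IsCycle G C → length C ≡ L → IsCycle G C′ → length C′ ≡ L →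
        ∀ w → (∀ {z} → z ∈ˡ C → z ∈ˡ C′ → z ≡ w) → ⊥
      share-two {C} {C′} c eq c′ eq′ w only with Any.any? (_∈ˡ? C′) C
      ... | yes h with find h
      ... | v , v∈C , v∈C′ = go
        where
        common : ∀ {z} → z ∈ˡ C → z ∈ˡ C′ → z ≡ v
        common p q = trans (only p q) (sym (only v∈C v∈C′))
        go : ⊥
        go with cycle-two c v | cycle-two c′ v
        ... | x , x∈ , x≢ | y , y∈ , y≢ with no-cut v x≢ y≢
        ... | xs , p , v∉ with connecting-chain C C′ p x∈ y∈
        ... | u , u′ , u∈ , u′∈ , u∈p , u′∈p , inj₁ refl = v∉ (subst (_∈ˡ x ∷ xs) (common u∈ u′∈) u∈p)
        ... | u , u′ , u∈ , u′∈ , u∈p , u′∈p , inj₂ (m , ch)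
          with long-arc c eq v∈C u∈ (λ { refl → v∉ u∈p }) | long-arc c′ eq′ u′∈ v∈C′ (λ { refl → v∉ u′∈p })
        ... | i , A , li | j , B , lj = halves-too-long {L} {i} {j} li lj
          (≤-trans (≤-trans (m≤m+n _ m) (≤-reflexive (arith i j m)))
            (close-chains (chain-++ G A ch (λ (_ , _ , ne) → ne refl) (λ (_ , ∉C , _) → ∉C u∈)
                             λ z (z∈C , _) (_ , ∉C , _) → ∉C z∈C)
              B (λ { refl → v∉ u′∈p })
              (λ { (inj₁ refl) → v∉ u∈p ; (inj₂ (inj₁ (_ , ne , _))) → ne refl ; (inj₂ (inj₂ (_ , ∉C , _))) → ∉C v∈C })
              (λ { (inj₁ refl) → v∉ (subst (_∈ˡ x ∷ xs) (common u∈ u′∈) u∈p)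
                 ; (inj₂ (inj₁ (z∈C , ne , _))) → ne (common z∈C u′∈) ; (inj₂ (inj₂ (_ , _ , ∉C′))) → ∉C′ u′∈ })
              (λ (_ , _ , ne) → ne refl) (λ (_ , ne , _) → ne refl)
              (λ { z (inj₁ refl) (z∈C′ , _ , ne) → ne (common u∈ z∈C′)
                 ; z (inj₂ (inj₁ (z∈C , ne , _))) (z∈C′ , _) → ne (common z∈C z∈C′)
                 ; z (inj₂ (inj₂ (_ , _ , ∉C′))) (z∈C′ , _) → ∉C′ z∈C′ })
              (≤-trans (s≤s z≤n) (≤-reflexive (sym (arith′ i j m))))))
          where
          arith : ∀ i j m → suc (suc i + suc j) + m ≡ 2 + (i + suc m + j)
          arith = solve-∀
          arith′ : ∀ i j m → i + suc m + j ≡ suc (i + m + j)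
          arith′ = solve-∀
      share-two {C} {C′} c eq c′ eq′ w only | no ¬h = go
        where
        none : ∀ {z} → z ∈ˡ C → z ∈ˡ C′ → ⊥
        none p q = ¬h (Any.map (λ { refl → q }) p)
        go : ⊥
        go with cycle-two c w | cycle-two c′ w
        ... | x , x∈ , _ | y , y∈ , _ with connected x y
        ... | xs , p with two-paths (cycle-two c) (cycle-two c′) xs x∈ p y∈
        ... | twoPaths x₁∈ x₂∈ y₁∈ y₂∈ p₁ p₂ dis
          with connecting-chain C C′ p₁ x₁∈ y₁∈ | connecting-chain C C′ p₂ x₂∈ y₂∈
        ... | _ , _ , u∈ , u′∈ , _ , _ , inj₁ refl | _ = none u∈ u′∈
        ... | _ | _ , _ , u∈ , u′∈ , _ , _ , inj₁ refl = none u∈ u′∈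
        ... | u , u′ , u∈ , u′∈ , u∈p , u′∈p , inj₂ (k , P) | v , v′ , v∈ , v′∈ , v∈p , v′∈p , inj₂ (l , Q)
          with long-arc c eq v∈ u∈ (λ { refl → dis _ u∈p v∈p }) | long-arc c′ eq′ u′∈ v′∈ (λ { refl → dis _ u′∈p v′∈p })
        ... | i , A , li | j , B , lj = halves-too-long {L} {i} {j} li lj
          (≤-trans (≤-trans (m≤m+n _ (k + suc l)) (≤-reflexive (arith i j k l)))
            (close-chains
              (chain-++ G A P (λ (_ , _ , ne) → ne refl) (λ (_ , ∉C , _) → ∉C u∈)
                 λ z (z∈C , _) (_ , ∉C , _) → ∉C z∈C)
              (chain-++ G B (chain-rev G Q) (λ (_ , _ , ne) → ne refl) (λ (_ , _ , ∉C′) → ∉C′ v′∈)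
                 λ z (z∈C′ , _) (_ , _ , ∉C′) → ∉C′ z∈C′)
              (λ { refl → none v∈ u′∈ })
              (λ { (inj₁ refl) → dis _ u∈p v∈p ; (inj₂ (inj₁ (_ , ne , _))) → ne refl ; (inj₂ (inj₂ (_ , ∉C , _))) → ∉C v∈ })
              (λ { (inj₁ refl) → none u∈ u′∈ ; (inj₂ (inj₁ (z∈C , _))) → none z∈C u′∈ ; (inj₂ (inj₂ (_ , _ , ∉C′))) → ∉C′ u′∈ })
              (λ { (inj₁ refl) → none v∈ v′∈ ; (inj₂ (inj₁ (z∈C′ , _))) → none v∈ z∈C′ ; (inj₂ (inj₂ (_ , ∉C , _))) → ∉C v∈ })
              (λ { (inj₁ refl) → dis _ u′∈p v′∈p ; (inj₂ (inj₁ (_ , ne , _))) → ne refl ; (inj₂ (inj₂ (_ , _ , ∉C′))) → ∉C′ u′∈ })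
              (λ { z (inj₁ refl) (inj₁ refl) → none u∈ v′∈
                 ; z (inj₁ refl) (inj₂ (inj₁ (z∈C′ , _))) → none u∈ z∈C′
                 ; z (inj₁ refl) (inj₂ (inj₂ (_ , ∉C , _))) → ∉C u∈
                 ; z (inj₂ (inj₁ (z∈C , _))) (inj₁ refl) → none z∈C v′∈
                 ; z (inj₂ (inj₁ (z∈C , _))) (inj₂ (inj₁ (z∈C′ , _))) → none z∈C z∈C′
                 ; z (inj₂ (inj₁ (z∈C , _))) (inj₂ (inj₂ (_ , ∉C , _))) → ∉C z∈C
                 ; z (inj₂ (inj₂ (_ , _ , ∉C′))) (inj₁ refl) → ∉C′ v′∈
                 ; z (inj₂ (inj₂ (_ , _ , ∉C′))) (inj₂ (inj₁ (z∈C′ , _))) → ∉C′ z∈C′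
                 ; z (inj₂ (inj₂ (z∈ , _))) (inj₂ (inj₂ (z∈′ , _))) → dis z z∈ z∈′ })
              (≤-trans (s≤s z≤n) (≤-reflexive (sym (arith′ i j k l))))))
          where
          arith : ∀ i j k l → suc (suc i + suc j) + (k + suc l) ≡ 2 + (i + suc k + (j + suc l))
          arith = solve-∀
          arith′ : ∀ i j k l → i + suc k + (j + suc l) ≡ suc (suc (i + j + k + l))
          arith′ = solve-∀

-- Components of G - K, their neighbours in K, and maximal cliques.

module _ {n : ℕ} {P : Pred (Fin n) 0ℓ} (P? : Decidable P) where

  ⟦_⟧ : Subset n
  ⟦_⟧ = tabulate (does ∘ P?)

  ∈⟦⟧⁺ : ∀ {u} → P u → u ∈ ⟦_⟧
  ∈⟦⟧⁺ {u} p = lookup⇒[]= u ⟦_⟧ (trans (lookup∘tabulate (does ∘ P?) u) (dec-true (P? u) p))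

  ∈⟦⟧⁻ : ∀ {u} → u ∈ ⟦_⟧ → P u
  ∈⟦⟧⁻ {u} m with P? u | trans (sym (lookup∘tabulate (does ∘ P?) u)) ([]=⇒lookup m)
  ... | yes p | _ = p

module _ {n : ℕ} (G : Graph n) where
  open Graph G

  -- For `v ∈ K` this is just the singleton of `v`, hence the condition `u ∉ K` that accompanies an
  -- equality of components below.
  comp : Subset n → Fin n → Subset n
  comp K v = ⟦ reach? G K v ⟧

  module _ {K : Subset n} where

    star-sym : ∀ {u v} → Star (Step G K) u v → Star (Step G K) v u
    star-sym = Star.reverse λ (p , q , a) → q , p , symm a

    comp-≡ : ∀ {u v} → Star (Step G K) u v → comp K u ≡ comp K v
    comp-≡ {u} {v} s = ⊆-antisym
      (λ m → ∈⟦⟧⁺ (reach? G K v) (star-sym s ◅◅ ∈⟦⟧⁻ (reach? G K u) m))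
      (λ m → ∈⟦⟧⁺ (reach? G K u) (s ◅◅ ∈⟦⟧⁻ (reach? G K v) m))

    comp-≡⁻ : ∀ {u v} → comp K u ≡ comp K v → Star (Step G K) u v
    comp-≡⁻ {u} {v} e = ∈⟦⟧⁻ (reach? G K u) (subst (v ∈_) (sym e) (∈⟦⟧⁺ (reach? G K v) ε))

    comp-adj : ∀ {u v} → u ∉ K → v ∉ K → Adj u v → comp K u ≡ comp K v
    comp-adj p q a = comp-≡ ((p , q , a) ◅ ε)

  Nbr : Subset n → Subset n → Fin n → Set
  Nbr K A d = ∃ λ u → u ∉ K × comp K u ≡ A × Adj u d

  _≟ˢ_ : (A B : Subset n) → Dec (A ≡ B)
  _≟ˢ_ = ≡-dec Bool._≟_

  nbr? : ∀ K A d → Dec (Nbr K A d)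
  nbr? K A d = Fin.any? λ u → ¬? (u ∈? K) ×-dec comp K u ≟ˢ A ×-dec adj? u d

  IsMaximal : Subset n → Set
  IsMaximal K = ∀ u → ¬ (∀ w → w ∈ K → Adj u w)

  -- `m` bounds the number of vertices that can still be added and serves as the measure of the
  -- recursion.
  extend-clique : ∀ m S → n ≤ ∣ S ∣ + m → IsClique G S →
    ∃ λ K → IsClique G K × IsMaximal K × S ⊆ K
  extend-clique m S le c with Fin.any? (λ u → Fin.all? λ w → w ∈? S →-dec adj? u w)
  ... | no ¬e = S , c , (λ u h → ¬e (u , h)) , id
  ... | yes (u , h) = grow m le
    where
    S′ = S ∪ ⁅ u ⁆
    bigger : ∣ S ∣ < ∣ S′ ∣
    bigger = p⊂q⇒∣p∣<∣q∣ (p⊆p∪q ⁅ u ⁆ , u , q⊆p∪q S ⁅ u ⁆ (x∈⁅x⁆ u) , λ u∈ → irrefl (h u u∈))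
    c′ : IsClique G S′
    c′ a b a∈ b∈ a≢b with x∈p∪q⁻ S ⁅ u ⁆ a∈ | x∈p∪q⁻ S ⁅ u ⁆ b∈
    ... | inj₁ p | inj₁ q = c a b p q a≢b
    ... | inj₁ p | inj₂ q with x∈⁅y⁆⇒x≡y u q
    ...   | refl = symm (h a p)
    c′ a b a∈ b∈ a≢b | inj₂ p | inj₁ q with x∈⁅y⁆⇒x≡y u p
    ...   | refl = h b q
    c′ a b a∈ b∈ a≢b | inj₂ p | inj₂ q = contradiction (trans (x∈⁅y⁆⇒x≡y u p) (sym (x∈⁅y⁆⇒x≡y u q))) a≢b
    grow : ∀ m → n ≤ ∣ S ∣ + m → ∃ λ K → IsClique G K × IsMaximal K × S ⊆ K
    grow zero le = contradiction (≤-trans bigger (≤-trans (∣p∣≤n S′) (subst (n ≤_) (+-identityʳ _) le))) (<-irrefl refl)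
    grow (suc m) le with extend-clique m S′ (≤-trans le (≤-trans (≤-reflexive (+-suc _ m)) (+-monoˡ-≤ m bigger))) c′
    ... | K , cK , mK , sub = K , cK , mK , sub ∘ p⊆p∪q ⁅ u ⁆

  -- Consequences of chordality.

  module _ (chordal : Chordal G) where

    Consecutive : Fin n → Fin n → List (Fin n) → Set
    Consecutive a b xs = ∃₂ λ ps qs → xs ≡ ps ++ a ∷ b ∷ qs

    consecutive-∷ : ∀ {a b xs} x → Consecutive a b xs → Consecutive a b (x ∷ xs)
    consecutive-∷ x (ps , qs , refl) = x ∷ ps , qs , refl

    induced-adj : ∀ xs {a b} → Induced G xs → a ∈ˡ xs → b ∈ˡ xs → Adj a b →
                  Consecutive a b xs ⊎ Consecutive b a xs
    induced-adj (x ∷ xs) i (here refl) (here refl) e = contradiction e irrefl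
    induced-adj (x ∷ y ∷ ys) i (here refl) (there (here refl)) e = inj₁ ([] , ys , refl)
    induced-adj (x ∷ y ∷ ys) ((_ , f) , _) (here refl) (there (there m)) e = contradiction e (proj₂ (All.lookup f m))
    induced-adj (x ∷ y ∷ ys) i (there (here refl)) (here refl) e = inj₂ ([] , ys , refl)
    induced-adj (x ∷ y ∷ ys) ((_ , f) , _) (there (there m)) (here refl) e = contradiction (symm e) (proj₂ (All.lookup f m))
    induced-adj (x ∷ xs) (_ , i) (there m) (there m′) e with induced-adj xs i m m′ e
    ... | inj₁ c = inj₁ (consecutive-∷ x c)
    ... | inj₂ c = inj₂ (consecutive-∷ x c)

    path-linked : ∀ {u xs v t} → Path G u xs v → Adj v t → Walk G u xs t
    path-linked {xs = []}     refl    a = a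
    path-linked {xs = x ∷ xs} (e , p) a = e , path-linked p a

    path-snoc : ∀ {u} xs {v} → Path G u xs v → ∃ λ ps → u ∷ xs ≡ ps ++ [ v ]
    path-snoc []       refl = [] , refl
    path-snoc {u} (x ∷ xs) (_ , p) with path-snoc xs p
    ... | ps , eq = u ∷ ps , cong (u ∷_) eq

    -- An induced path closed up by a vertex adjacent to its two ends only is an
    -- induced cycle.
    no-hole : ∀ {d y w ws v u} → Path G d (y ∷ w ∷ ws) v → Induced G (d ∷ y ∷ w ∷ ws) →
      u ∉ˡ d ∷ y ∷ w ∷ ws → Adj u d → Adj u v →
      (∀ {z} → z ∈ˡ d ∷ y ∷ w ∷ ws → Adj u z → z ≡ d ⊎ z ≡ v) → ⊥
    no-hole {d} {y} {w} {ws} {v} {u} p i u∉ ud uv only with chordal (u ∷ q) ((len , uniq , lnk) , succ)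
      where
      q = d ∷ y ∷ w ∷ ws
      len : 3 ≤ length (u ∷ q)
      len = s≤s (s≤s (s≤s z≤n))
      uniq : Unique (u ∷ q)
      uniq = All.tabulate (λ { m refl → u∉ m }) ∷ induced-unique G q i
      lnk = walk⇒linked G q (ud , path-linked p (symm uv))
      ending : CyclicSucc (u ∷ q) v u
      ending with path-snoc (y ∷ w ∷ ws) p
      ... | ps , eq = u ∷ ps , [] , cong (u ∷_) (trans (cong (_++ [ u ]) eq) (++-assoc ps [ v ] [ u ]))
      lift : ∀ {a b} → Consecutive a b q → CyclicSucc (u ∷ q) a b
      lift (ps , qs , eq) = u ∷ ps , qs ++ [ u ] , cong (u ∷_) (trans (cong (_++ [ u ]) eq) (++-assoc ps _ [ u ]))
      at-u : ∀ {b} → b ∈ˡ q → Adj u b → CyclicSucc (u ∷ q) u b ⊎ CyclicSucc (u ∷ q) b u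
      at-u m e with only m e
      ... | inj₁ refl = inj₁ ([] , y ∷ w ∷ ws ++ [ u ] , refl)
      ... | inj₂ refl = inj₂ ending
      succ : ∀ {a b} → a ∈ˡ u ∷ q → b ∈ˡ u ∷ q → Adj a b → CyclicSucc (u ∷ q) a b ⊎ CyclicSucc (u ∷ q) b a
      succ (here refl) (here refl) e = contradiction e irrefl
      succ (here refl) (there m)   e = at-u m e
      succ (there m)   (here refl) e = swap (at-u m (symm e))
      succ (there m)   (there m′)  e with induced-adj q i m m′ e
      ... | inj₁ c = inj₁ (lift c)
      ... | inj₂ c = inj₂ (lift c)
    ... | ()

    first-neighbour : ∀ u {x xs} {v} → Path G x xs v → Induced G (x ∷ xs) → Any (Adj u) (x ∷ xs) →
      ∃₂ λ v′ xs′ → Path G x xs′ v′ × Induced G (x ∷ xs′) × Adj u v′ ×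
        (∀ {z} → z ∈ˡ x ∷ xs′ → Adj u z → z ≡ v′) × ∃ λ zs → xs ≡ xs′ ++ zs
    first-neighbour u {x} {xs} p i h with adj? u x
    ... | yes a = x , [] , refl , _ , a , (λ { (here e) _ → e }) , xs , refl
    first-neighbour u p i (here a) | no ¬a = contradiction a ¬a
    first-neighbour u {x} {y ∷ ys} (e , p) ((x≢y , f) , i) (there h) | no ¬a with first-neighbour u p i h
    ... | v′ , xs′ , p′ , i′ , a , only , zs , refl =
      v′ , y ∷ xs′ , (e , p′) , ((x≢y , All.++⁻ˡ xs′ f) , i′) , a ,
      (λ { (here refl) b → contradiction b ¬a ; (there m) b → only m b }) , zs , refl

    -- Otherwise the first neighbour of `u` after `d` on the path lies beyond `y`, and the stretch
    -- from `d` up to it closes through `u` to an induced cycle of length at least four.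
    hole-free : ∀ {d y ys v u} → Path G d (y ∷ ys) v → Induced G (d ∷ y ∷ ys) →
      u ∉ˡ d ∷ y ∷ ys → Adj u d → Adj u v → Adj u y
    hole-free {d} {y} {ys} {v} {u} (e , p) ((d≢y , f) , i) u∉ ud uv
      with first-neighbour u p i (Any.map (λ { refl → uv }) (path-last G ys p))
    ... | v′ , [] , refl , i′ , a , only , zs , refl = a
    ... | v′ , w ∷ ws , p′ , i′ , a , only , zs , refl = ⊥-elim
      (no-hole {d} {y} {w} {ws} (e , p′) ((d≢y , All.++⁻ˡ (w ∷ ws) f) , i′)
        (λ { (here e) → u∉ (here e) ; (there (here e)) → u∉ (there (here e))
           ; (there (there m)) → u∉ (there (there (∈-++⁺ˡ m))) })
        ud a
        (λ { (here e) _ → inj₁ e ; (there m) b → inj₂ (only m b) }))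

    module _ {K : Subset n} (clique : IsClique G K) where

      -- `y` follows `d` on an induced path from `d` through the component to `x`. A neighbour of
      -- `x` in K other than `d` is adjacent to both ends of that path, hence to `y` by `hole-free`.
      improve : ∀ {x d} → x ∉ K → d ∈ K → Nbr K (comp K x) d →
        ∃ λ y → y ∉ K × comp K y ≡ comp K x × Adj y d × (∀ u → u ∈ K → Adj x u → Adj y u)
      improve {x} {d} x∉ d∈ (u₀ , u₀∉ , eq , a) with star⇒path G (comp-≡⁻ eq)
      ... | xs , p , al with shorten G {d} (u₀ ∷ xs) {x} (symm a , p)
      ... | [] , refl , _ , _ = contradiction d∈ x∉
      ... | y ∷ ys , (e , p′) , i , sub =
        y , y∉ , comp-≡ (path⇒star G ys p′ y∉ (All.tabulate (out ∘ there))) , symm e , adj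
        where
        out : ∀ {z} → z ∈ˡ y ∷ ys → z ∉ K
        out m with sub m
        ... | here refl = u₀∉
        ... | there m′  = All.lookup al m′
        y∉ = out (here refl)
        adj : ∀ u → u ∈ K → Adj x u → Adj y u
        adj u u∈ xu with u Fin.≟ d
        ... | yes refl = symm e
        ... | no  u≢d  = symm (hole-free (e , p′) i
          (λ { (here e) → u≢d e ; (there m) → out m u∈ }) (clique u d u∈ d∈ u≢d) (symm xu))

      -- Since `improve` keeps all neighbours in K gained so far, the list can be treated one vertex
      -- at a time.
      dominate : ∀ {v} → v ∉ K → ∀ ds → All (λ d → d ∈ K × Nbr K (comp K v) d) ds →
        ∃ λ x → x ∉ K × comp K x ≡ comp K v × All (Adj x) ds
      dominate {v} v∉ [] [] = v , v∉ , refl , []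
      dominate {v} v∉ (d ∷ ds) ((d∈ , nb) ∷ al) with dominate v∉ ds al
      ... | x , x∉ , eq , adjs with improve x∉ d∈ (subst (λ A → Nbr K A d) (sym eq) nb)
      ... | y , y∉ , eq′ , yd , keep = y , y∉ , trans eq′ eq ,
        yd ∷ All.zipWith (λ ((d∈ , _) , a) → keep _ d∈ a) (al , adjs)

      simplicial-contact : ∀ {v} → v ∉ K →
        ∃ λ x → x ∉ K × comp K x ≡ comp K v × (∀ d → d ∈ K → Nbr K (comp K v) d → Adj x d)
      simplicial-contact {v} v∉ with dominate v∉ (filter Q? (allFin n)) (All.tabulate λ m → proj₂ (∈-filter⁻ Q? {xs = allFin n} m))
        where
        Q? = λ d → d ∈? K ×-dec nbr? K (comp K v) d
      ... | x , x∉ , eq , al = x , x∉ , eq , λ d d∈ nb → All.lookup al (∈-filter⁺ _ (∈-allFin d) (d∈ , nb))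

      -- If every vertex of K had a neighbour in the component, the vertex from `simplicial-contact`
      -- would be adjacent to all of K.
      non-neighbour : IsMaximal K → ∀ {v} → v ∉ K → ∃ λ d → d ∈ K × ¬ Nbr K (comp K v) d
      non-neighbour maxK {v} v∉ with Fin.any? (λ d → d ∈? K ×-dec ¬? (nbr? K (comp K v) d))
      ... | yes e = e
      ... | no ¬e with simplicial-contact v∉
      ... | x , x∉ , eq , adj = ⊥-elim (maxK x λ w w∈ → adj w w∈ (decidable-stable (nbr? K (comp K v) w) λ ¬nb → ¬e (w , w∈ , ¬nb)))

  -- Splitting a longest cycle along a clique.

  module Segments (L : ℕ) (maxL : ∀ ys → IsCycle G ys → length ys ≤ L) where
    open Longest G L maxL

    -- The colour is the component of G − K containing the interior.
    record CSeg (K : Subset n) (x y : Fin n) : Set₁ where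
      constructor cseg
      field
        {len}    : ℕ
        {M}      : Pred (Fin n) 0ℓ
        colour   : Subset n
        path     : Seg K x y len M
        mono     : ∀ u → M u → u ∉ K × comp K u ≡ colour
        member   : ∃ M
        start    : Nbr K colour x
        end      : Nbr K colour y
    open CSeg public

    crev : ∀ {K x y} → CSeg K x y → CSeg K y x
    crev (cseg A p m s nx ny) = cseg A (seg-rev p) m s ny nx

    colour-disj : ∀ {K x y z w} (s : CSeg K x y) (t : CSeg K z w) → colour s ≢ colour t → Disj (M s) (M t)
    colour-disj s t ne u p q = ne (trans (sym (proj₂ (mono s u p))) (proj₂ (mono t u q)))

    walk-reach : ∀ {K i is y} → Walk G i is y → All (_∉ K) (i ∷ is) →
      ∀ {u} → u ∈ˡ i ∷ is → Star (Step G K) i u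
    walk-reach w al (here refl) = ε
    walk-reach {is = j ∷ js} (a , w) (i∉ ∷ al@(j∉ ∷ _)) (there m) = (i∉ , j∉ , a) ◅ walk-reach w al m

    walk-last : ∀ {x i y} is → Walk G x (i ∷ is) y → ∃ λ l → l ∈ˡ i ∷ is × Adj l y
    walk-last [] (_ , a) = _ , here refl , a
    walk-last (j ∷ js) (_ , w) with walk-last js w
    ... | l , m , a = l , there m , a

    list-seg : ∀ {K x y} I → Walk G x I y → Unique I → All (_∉ K) I → Seg K x y (length I) (_∈ˡ I)
    list-seg I w u al = seg (chain I w u refl id) (All.lookup al)

    list-cseg : ∀ {K x y} i is → Walk G x (i ∷ is) y → Unique (i ∷ is) → All (_∉ K) (i ∷ is) → CSeg K x y
    list-cseg {K} i is w u al = cseg {len = length (i ∷ is)} {M = _∈ˡ i ∷ is} (comp K i) (list-seg (i ∷ is) w u al)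
        mono′ (i , here refl) (i , All.head al , refl , symm (proj₁ w))
        (let l , m , a = walk-last is w in l , proj₁ (mono′ l m) , proj₂ (mono′ l m) , a)
      where
      mono′ : ∀ u → u ∈ˡ i ∷ is → u ∉ K × comp K u ≡ comp K i
      mono′ u m = All.lookup al m , sym (comp-≡ (walk-reach {is = is} (proj₂ w) al m))

    record Two (K : Subset n) (a b : Fin n) : Set₁ where
      constructor two
      field
        p q  : CSeg K a b
        a≢b  : a ≢ b
        pq   : Disj (M p) (M q)
        size : 2 + len p + len q ≡ L

    record Three (K : Subset n) (a b c : Fin n) : Set₁ where
      constructor three
      field
        p : CSeg K a b
        q : CSeg K b c
        r : CSeg K c a
        a≢b : a ≢ b
        b≢c : b ≢ c
        a≢c : a ≢ c
        pq : Disj (M p) (M q)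
        pr : Disj (M p) (M r)
        qr : Disj (M q) (M r)
        size : 3 + len p + len q + len r ≡ L

    data Cut (K : Subset n) : List (Fin n) → Set where
      none : ∀ {xs} → All (_∉ K) xs → Cut K xs
      some : ∀ I v ys → All (_∉ K) I → v ∈ K → Cut K (I ++ v ∷ ys)

    cut : ∀ K xs → Cut K xs
    cut K [] = none []
    cut K (x ∷ xs) with x ∈? K | cut K xs
    ... | yes x∈ | _                   = some [] x xs [] x∈
    ... | no  x∉ | none al             = none (x∉ ∷ al)
    ... | no  x∉ | some I v ys al v∈   = some (x ∷ I) v ys (x∉ ∷ al) v∈

    -- The case `one` includes cycles that miss K altogether; `w` is then arbitrary.
    data Decomp (K : Subset n) (C : List (Fin n)) : Set₁ where
      one : ∀ {v} w → v ∉ K → (∀ {u} → u ∈ˡ C → (u ∉ K × comp K u ≡ comp K v) ⊎ (u ≡ w × u ∈ K × Nbr K (comp K v) u)) → Decomp K C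
      two : ∀ {a b} → a ∈ˡ C → b ∈ˡ C → a ∈ K → b ∈ K → (t : Two K a b) →
        (∀ {u} → u ∈ˡ C → (u ≡ a ⊎ u ≡ b) ⊎ (M (Two.p t) u ⊎ M (Two.q t) u)) → Decomp K C
      three : ∀ {a b c} → a ∈ˡ C → b ∈ˡ C → c ∈ˡ C → a ∈ K → b ∈ K → c ∈ K → (t : Three K a b c) →
        (∀ {u} → u ∈ˡ C → (u ≡ a ⊎ u ≡ b ⊎ u ≡ c) ⊎ (M (Three.p t) u ⊎ M (Three.q t) u ⊎ M (Three.r t) u)) →
        Decomp K C

    nonzero₂ : ∀ {K} → IsClique G K → ∀ {a b z p q M N} → Seg K a b p M → Seg K a b q N →
      a ∈ K → b ∈ K → z ∈ K → a ≢ b → z ≢ a → z ≢ b → 2 + p + q ≡ L → p ≢ 0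
    nonzero₂ cl {q = q} s t a∈ b∈ z∈ ab za zb size refl =
      <-irrefl size (cyc3 (kedge a∈ z∈ (za ∘ sym)) (kedge z∈ b∈ zb) (seg-rev t) a∈ z∈ b∈ (za ∘ sym) zb ab
        (λ _ ()) (λ _ ()) (λ _ ()))
      where open Shapes cl

    nonzero₃ : ∀ {K} → IsClique G K → ∀ {a b c z p q r M N O} → Seg K a b p M → Seg K b c q N → Seg K c a r O →
      a ∈ K → b ∈ K → c ∈ K → z ∈ K → a ≢ b → b ≢ c → a ≢ c → z ≢ a → z ≢ b → z ≢ c →
      Disj N O → 3 + p + q + r ≡ L → p ≢ 0
    nonzero₃ cl s t w a∈ b∈ c∈ z∈ ab bc ac za zb zc d size refl =
      <-irrefl size (cyc4 (kedge a∈ z∈ (za ∘ sym)) (kedge z∈ b∈ zb) t w a∈ z∈ b∈ c∈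
        (za ∘ sym) ab ac zb zc bc (λ _ ()) (λ _ ()) (λ _ ()) (λ _ ()) (λ _ ()) d)
      where open Shapes cl

    four-in-three : ∀ {a b c d x y z : Fin n} → a ≡ x ⊎ a ≡ y ⊎ a ≡ z → b ≡ x ⊎ b ≡ y ⊎ b ≡ z →
      c ≡ x ⊎ c ≡ y ⊎ c ≡ z → d ≡ x ⊎ d ≡ y ⊎ d ≡ z →
      a ≢ b → a ≢ c → a ≢ d → b ≢ c → b ≢ d → c ≢ d → ⊥
    four-in-three (inj₁ refl) (inj₁ refl) _ _ ab _ _ _ _ _ = ab refl
    four-in-three (inj₂ (inj₁ refl)) (inj₂ (inj₁ refl)) _ _ ab _ _ _ _ _ = ab refl
    four-in-three (inj₂ (inj₂ refl)) (inj₂ (inj₂ refl)) _ _ ab _ _ _ _ _ = ab refl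
    four-in-three (inj₁ refl) _ (inj₁ refl) _ _ ac _ _ _ _ = ac refl
    four-in-three (inj₂ (inj₁ refl)) _ (inj₂ (inj₁ refl)) _ _ ac _ _ _ _ = ac refl
    four-in-three (inj₂ (inj₂ refl)) _ (inj₂ (inj₂ refl)) _ _ ac _ _ _ _ = ac refl
    four-in-three (inj₁ refl) _ _ (inj₁ refl) _ _ ad _ _ _ = ad refl
    four-in-three (inj₂ (inj₁ refl)) _ _ (inj₂ (inj₁ refl)) _ _ ad _ _ _ = ad refl
    four-in-three (inj₂ (inj₂ refl)) _ _ (inj₂ (inj₂ refl)) _ _ ad _ _ _ = ad refl
    four-in-three _ (inj₁ refl) (inj₁ refl) _ _ _ _ bc _ _ = bc refl
    four-in-three _ (inj₂ (inj₁ refl)) (inj₂ (inj₁ refl)) _ _ _ _ bc _ _ = bc refl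
    four-in-three _ (inj₂ (inj₂ refl)) (inj₂ (inj₂ refl)) _ _ _ _ bc _ _ = bc refl
    four-in-three _ (inj₁ refl) _ (inj₁ refl) _ _ _ _ bd _ = bd refl
    four-in-three _ (inj₂ (inj₁ refl)) _ (inj₂ (inj₁ refl)) _ _ _ _ bd _ = bd refl
    four-in-three _ (inj₂ (inj₂ refl)) _ (inj₂ (inj₂ refl)) _ _ _ _ bd _ = bd refl
    four-in-three _ _ (inj₁ refl) (inj₁ refl) _ _ _ _ _ cd = cd refl
    four-in-three _ _ (inj₂ (inj₁ refl)) (inj₂ (inj₁ refl)) _ _ _ _ _ cd = cd refl
    four-in-three _ _ (inj₂ (inj₂ refl)) (inj₂ (inj₂ refl)) _ _ _ _ _ cd = cd refl

    build₂ : ∀ {K C} → IsClique G K → ∀ {a b z} → z ∈ K → z ≢ a → z ≢ b → ∀ I J → Walk G a I b → Walk G b J a →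
      a ∈ K → b ∈ K → Unique I → Unique J → All (_∉ K) I → All (_∉ K) J → a ≢ b → Disj (_∈ˡ I) (_∈ˡ J) →
      2 + length I + length J ≡ L → a ∈ˡ C → b ∈ˡ C →
      (∀ {u} → u ∈ˡ C → (u ≡ a ⊎ u ≡ b) ⊎ (u ∈ˡ I ⊎ u ∈ˡ J)) → Decomp K C
    build₂ cl z∈ za zb [] J v w a∈ b∈ uI uJ aI aJ ab d size _ _ _ =
      contradiction refl (nonzero₂ cl (list-seg [] v uI aI) (seg-rev (list-seg J w uJ aJ)) a∈ b∈ z∈ ab za zb size)
    build₂ cl z∈ za zb I@(_ ∷ _) [] v w a∈ b∈ uI uJ aI aJ ab d size _ _ _ =
      contradiction refl (nonzero₂ cl (seg-rev (list-seg [] w uJ aJ)) (list-seg I v uI aI) a∈ b∈ z∈ ab za zb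
        (trans (cong (2 +_) (+-comm 0 (length I))) size))
    build₂ cl z∈ za zb (i ∷ I) (j ∷ J) v w a∈ b∈ uI uJ aI aJ ab d size a∈C b∈C cover =
      two a∈C b∈C a∈ b∈ (two (list-cseg i I v uI aI) (crev (list-cseg j J w uJ aJ)) ab d size) cover

    build₃ : ∀ {K C} → IsClique G K → ∀ {a b c z} → z ∈ K → z ≢ a → z ≢ b → z ≢ c →
      ∀ I J H → Walk G a I b → Walk G b J c → Walk G c H a →
      a ∈ K → b ∈ K → c ∈ K → Unique I → Unique J → Unique H → All (_∉ K) I → All (_∉ K) J → All (_∉ K) H →
      a ≢ b → b ≢ c → a ≢ c → Disj (_∈ˡ I) (_∈ˡ J) → Disj (_∈ˡ I) (_∈ˡ H) → Disj (_∈ˡ J) (_∈ˡ H) →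
      3 + length I + length J + length H ≡ L → a ∈ˡ C → b ∈ˡ C → c ∈ˡ C →
      (∀ {u} → u ∈ˡ C → (u ≡ a ⊎ u ≡ b ⊎ u ≡ c) ⊎ (u ∈ˡ I ⊎ u ∈ˡ J ⊎ u ∈ˡ H)) → Decomp K C
    build₃ cl z∈ za zb zc [] J H wI wJ wH a∈ b∈ c∈ uI uJ uH aI aJ aH ab bc ac IJ IH JH size _ _ _ _ =
      contradiction refl (nonzero₃ cl (list-seg [] wI uI aI) (list-seg J wJ uJ aJ) (list-seg H wH uH aH)
        a∈ b∈ c∈ z∈ ab bc ac za zb zc JH size)
    build₃ cl z∈ za zb zc I@(_ ∷ _) [] H wI wJ wH a∈ b∈ c∈ uI uJ uH aI aJ aH ab bc ac IJ IH JH size _ _ _ _ =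
      contradiction refl (nonzero₃ cl (list-seg [] wJ uJ aJ) (list-seg H wH uH aH) (list-seg I wI uI aI)
        b∈ c∈ a∈ z∈ bc (ac ∘ sym) (ab ∘ sym) zb zc za (λ u x y → IH u y x)
        (trans (eq (length I) (length H)) size))
      where
      eq : ∀ i h → 3 + 0 + h + i ≡ 3 + i + 0 + h
      eq = solve-∀
    build₃ cl z∈ za zb zc I@(_ ∷ _) J@(_ ∷ _) [] wI wJ wH a∈ b∈ c∈ uI uJ uH aI aJ aH ab bc ac IJ IH JH size _ _ _ _ =
      contradiction refl (nonzero₃ cl (list-seg [] wH uH aH) (list-seg I wI uI aI) (list-seg J wJ uJ aJ)
        c∈ a∈ b∈ z∈ (ac ∘ sym) ab (bc ∘ sym) zc za zb IJ
        (trans (eq (length I) (length J)) size))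
      where
      eq : ∀ i j → 3 + 0 + i + j ≡ 3 + i + j + 0
      eq = solve-∀
    build₃ cl z∈ za zb zc (i ∷ I) (j ∷ J) (h ∷ H) wI wJ wH a∈ b∈ c∈ uI uJ uH aI aJ aH ab bc ac IJ IH JH size a∈C b∈C c∈C cover =
      three a∈C b∈C c∈C a∈ b∈ c∈
        (three (list-cseg i I wI uI aI) (list-cseg j J wJ uJ aJ) (list-cseg h H wH uH aH) ab bc ac IJ IH JH size) cover

    single : ∀ {K C v₁} rest → v₁ ∈ K → Walk G v₁ rest v₁ → All (_∉ K) rest → 2 ≤ length rest →
      (∀ {u} → u ∈ˡ C → u ∈ˡ v₁ ∷ rest) → Decomp K C
    single {K} {C} {v₁} (r ∷ rs) v₁∈ w al _ from = one v₁ (All.head al) λ m → cover (from m)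
      where
      cover : ∀ {u} → u ∈ˡ v₁ ∷ r ∷ rs →
        (u ∉ K × comp K u ≡ comp K r) ⊎ (u ≡ v₁ × u ∈ K × Nbr K (comp K r) u)
      cover (here refl) = inj₂ (refl , v₁∈ , r , All.head al , refl , symm (proj₁ w))
      cover (there m) = inj₁ (All.lookup al m , sym (comp-≡ (walk-reach {is = rs} (proj₂ w) al m)))

    -- The cycle is cut at its successive vertices in K. A fourth one would give four distinct
    -- vertices among `t₁`, `t₂`, `t₃`; the missed vertex `z` keeps the segments nonempty when there
    -- are two or three.
    decompose-from : ∀ {K C} → IsClique G K → ∀ {z} → z ∈ K → z ∉ˡ C →
      ∀ {t₁ t₂ t₃} → (∀ {u} → u ∈ˡ C → u ∈ K → u ≡ t₁ ⊎ u ≡ t₂ ⊎ u ≡ t₃) →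
      ∀ v₁ rest → Walk G v₁ rest v₁ → Unique (v₁ ∷ rest) → 2 ≤ length rest → suc (length rest) ≡ L →
      (∀ {u} → u ∈ˡ C → u ∈ˡ v₁ ∷ rest) → (∀ {u} → u ∈ˡ v₁ ∷ rest → u ∈ˡ C) → v₁ ∈ K → Decomp K C
    decompose-from {K} cl z∈ z∉ bound v₁ rest w uq le size from to v₁∈ with cut K rest
    ... | none al = single rest v₁∈ w al le from
    decompose-from {K} {C} cl {z} z∈ z∉ bound v₁ .(_) w (p₁ ∷ ur) le size from to v₁∈
      | some I v₂ ys aI v₂∈
      with walk-split G I w | unique-++⁻ I ur | cut K ys
    ... | wI , wY | uI , (p₂ ∷ uY) , dI | none aY =
      build₂ cl z∈ (λ { refl → z∉ (to (here refl)) }) (λ { refl → z∉ (to (there (∈-++⁺ʳ I (here refl)))) })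
        I ys wI wY v₁∈ v₂∈ uI uY aI aY (All.lookup p₁ (∈-++⁺ʳ I (here refl))) (λ u m m′ → dI u m (there m′))
        (trans (cong suc (trans (sym (+-suc (length I) (length ys))) (sym (length-++ I)))) size)
        (to (here refl)) (to (there (∈-++⁺ʳ I (here refl)))) (λ m → cover (from m))
      where
      cover : ∀ {u} → u ∈ˡ v₁ ∷ I ++ v₂ ∷ ys → (u ≡ v₁ ⊎ u ≡ v₂) ⊎ (u ∈ˡ I ⊎ u ∈ˡ ys)
      cover (here e) = inj₁ (inj₁ e)
      cover (there m) with ∈-++⁻ I m
      ... | inj₁ i         = inj₂ (inj₁ i)
      ... | inj₂ (here e)  = inj₁ (inj₂ e)
      ... | inj₂ (there j) = inj₂ (inj₂ j)
    ... | wI , wY | uI , (p₂ ∷ uY) , dI | some J v₃ zs aJ v₃∈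
      with walk-split G J wY | unique-++⁻ J uY | cut K zs
    ... | wJ , wZ | uJ , (p₃ ∷ uZ) , dJ | none aZ =
      build₃ cl z∈ (λ { refl → z∉ (to (here refl)) }) (λ { refl → z∉ (to v₂∈r) }) (λ { refl → z∉ (to v₃∈r) })
        I J zs wI wJ wZ v₁∈ v₂∈ v₃∈ uI uJ uZ aI aJ aZ (All.lookup p₁ (∈-++⁺ʳ I (here refl)))
        (All.lookup p₂ (∈-++⁺ʳ J (here refl))) (All.lookup p₁ (∈-++⁺ʳ I (there (∈-++⁺ʳ J (here refl)))))
        (λ u m m′ → dI u m (there (∈-++⁺ˡ m′)))
        (λ u m m′ → dI u m (there (∈-++⁺ʳ J (there m′))))
        (λ u m m′ → dJ u m (there m′))
        (trans (arith (length I) (length J) (length zs))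
          (trans (cong suc (sym (trans (length-++ I) (cong (λ k → length I + suc k) (length-++ J))))) size))
        (to (here refl)) (to v₂∈r) (to v₃∈r) (λ m → cover (from m))
      where
      v₂∈r : v₂ ∈ˡ v₁ ∷ I ++ v₂ ∷ J ++ v₃ ∷ zs
      v₂∈r = there (∈-++⁺ʳ I (here refl))
      v₃∈r : v₃ ∈ˡ v₁ ∷ I ++ v₂ ∷ J ++ v₃ ∷ zs
      v₃∈r = there (∈-++⁺ʳ I (there (∈-++⁺ʳ J (here refl))))
      arith : ∀ i j k → 3 + i + j + k ≡ suc (i + suc (j + suc k))
      arith = solve-∀
      cover : ∀ {u} → u ∈ˡ v₁ ∷ I ++ v₂ ∷ J ++ v₃ ∷ zs → (u ≡ v₁ ⊎ u ≡ v₂ ⊎ u ≡ v₃) ⊎ (u ∈ˡ I ⊎ u ∈ˡ J ⊎ u ∈ˡ zs)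
      cover (here e) = inj₁ (inj₁ e)
      cover (there m) with ∈-++⁻ I m
      ... | inj₁ i         = inj₂ (inj₁ i)
      ... | inj₂ (here e)  = inj₁ (inj₂ (inj₁ e))
      ... | inj₂ (there j) with ∈-++⁻ J j
      ... | inj₁ k         = inj₂ (inj₂ (inj₁ k))
      ... | inj₂ (here e)  = inj₁ (inj₂ (inj₂ e))
      ... | inj₂ (there k) = inj₂ (inj₂ (inj₂ k))
    decompose-from {K} {C} cl {z} z∈ z∉ bound v₁ .(_) w (p₁ ∷ ur) le size from to v₁∈
      | some I v₂ ys aI v₂∈
      | wI , wY | uI , (p₂ ∷ uY) , dI | some J v₃ zs aJ v₃∈
      | wJ , wZ | uJ , (p₃ ∷ uZ) , dJ | some H v₄ ts aH v₄∈ = ⊥-elim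
      (four-in-three (bound (to (here refl)) v₁∈) (bound (to (there in₂)) v₂∈) (bound (to (there in₃)) v₃∈) (bound (to (there in₄)) v₄∈)
        (All.lookup p₁ in₂) (All.lookup p₁ in₃) (All.lookup p₁ in₄)
        (All.lookup p₂ (∈-++⁺ʳ J (here refl))) (All.lookup p₂ (∈-++⁺ʳ J (there (∈-++⁺ʳ H (here refl)))))
        (All.lookup p₃ (∈-++⁺ʳ H (here refl))))
      where
      in₂ : v₂ ∈ˡ I ++ v₂ ∷ J ++ v₃ ∷ H ++ v₄ ∷ ts
      in₂ = ∈-++⁺ʳ I (here refl)
      in₃ : v₃ ∈ˡ I ++ v₂ ∷ J ++ v₃ ∷ H ++ v₄ ∷ ts
      in₃ = ∈-++⁺ʳ I (there (∈-++⁺ʳ J (here refl)))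
      in₄ : v₄ ∈ˡ I ++ v₂ ∷ J ++ v₃ ∷ H ++ v₄ ∷ ts
      in₄ = ∈-++⁺ʳ I (there (∈-++⁺ʳ J (there (∈-++⁺ʳ H (here refl)))))

    decompose : ∀ {K C} → IsClique G K → ∀ {z} → z ∈ K → z ∉ˡ C → IsCycle G C → length C ≡ L →
      ∀ {t₁ t₂ t₃} → (∀ {u} → u ∈ˡ C → u ∈ K → u ≡ t₁ ⊎ u ≡ t₂ ⊎ u ≡ t₃) → Decomp K C
    decompose {K} {[]} cl z∈ z∉ (() , _) eq bound
    decompose {K} {C@(c₀ ∷ cs)} cl {z} z∈ z∉ c eq bound with Any.any? (_∈? K) C
    ... | no ¬h = one c₀ (λ k → ¬h (here k)) λ m → inj₁ (All.lookup (All.¬Any⇒All¬ C ¬h) m ,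
        sym (comp-≡ (walk-reach {is = cs} (cycle⇒walk G c) (All.¬Any⇒All¬ C ¬h) m)))
    ... | yes h with find h
    ... | v₁ , v₁∈C , v₁∈ with rotate G c v₁∈C
    ... | record { rest = rest ; cycle = c′ ; size = size ; from = from ; to = to } =
      decompose-from cl z∈ z∉ bound v₁ rest (cycle⇒walk G {xs = rest} c′) (proj₁ (proj₂ c′)) (≤-pred (proj₁ c′))
        (trans size eq) from to v₁∈

-- `u` and `v` are the lengths of two longest cycles, `x` and `y` those of the cycles into which
-- their segments are regrouped, and `suc k` is the surplus in vertices of the clique.
overflow : ∀ {L x y u v} k → x ≤ L → y ≤ L → u ≡ L → v ≡ L → x + y ≡ suc k + (u + v) → ⊥
overflow {L} {x} {y} k p q refl refl e =
  <-irrefl refl (≤-trans (s≤s (m≤n+m (L + L) k)) (≤-trans (≤-reflexive (sym e)) (+-mono-≤ p q)))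

In3 : {A : Set} → A → A → A → A → Set
In3 a b c u = u ≡ a ⊎ u ≡ b ⊎ u ≡ c

-- Regrouping the segments of two longest cycles.

module Traces {n : ℕ} (G : Graph n) (L : ℕ)
  (maxL : ∀ ys → IsCycle G ys → length ys ≤ L) where
  open Graph G
  open Longest G L maxL
  open Segments G L maxL

  rot : ∀ {K a b c} → Three K a b c → Three K b c a
  rot (three p q r ab bc ac pq pr qr s) =
    three q r p bc (ac ∘ sym) (ab ∘ sym) qr (λ u x y → pq u y x) (λ u x y → pr u y x)
      (trans (eq (len p) (len q) (len r)) s)
    where
    eq : ∀ p q r → 3 + q + r + p ≡ 3 + p + q + r
    eq = solve-∀

  mirror : ∀ {K a b c} → Three K a b c → Three K a c b
  mirror (three p q r ab bc ac pq pr qr s) =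
    three (crev r) (crev q) (crev p) ac (bc ∘ sym) ab (λ u x y → qr u y x) (λ u x y → pr u y x) (λ u x y → pq u y x)
      (trans (eq (len p) (len q) (len r)) s)
    where
    eq : ∀ p q r → 3 + r + q + p ≡ 3 + p + q + r
    eq = solve-∀

  Crossing : ∀ {K a b c} → Three K a b c → Set
  Crossing t = ¬ (colour (Three.p t) ≡ colour (Three.q t) × colour (Three.q t) ≡ colour (Three.r t))

  crossing-rot : ∀ {K a b c} (t : Three K a b c) → Crossing t → Crossing (rot t)
  crossing-rot t x (e , f) = x (sym (trans e f) , e)

  crossing-mirror : ∀ {K a b c} (t : Three K a b c) → Crossing t → Crossing (mirror t)
  crossing-mirror t x (e , f) = x (sym f , sym e)

  -- `rot` and `mirror` generate all six labellings of the triangle, so properties invariant under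
  -- both may be carried to any labelling of the same trace.
  module Relabel {K : Subset n} (Q : ∀ {x y z} → Three K x y z → Set)
    (Q-rot : ∀ {x y z} (t : Three K x y z) → Q t → Q (rot t))
    (Q-mirror : ∀ {x y z} (t : Three K x y z) → Q t → Q (mirror t)) where

    relabel₂ : ∀ {a b x y z} → In3 x y z a → In3 x y z b → a ≢ b → (t : Three K x y z) → Q t →
      ∃ λ g → In3 x y z g × ∃ λ (t′ : Three K a b g) → Q t′
    relabel₂ (inj₁ refl) (inj₁ refl) ab t m = contradiction refl ab
    relabel₂ (inj₂ (inj₁ refl)) (inj₂ (inj₁ refl)) ab t m = contradiction refl ab
    relabel₂ (inj₂ (inj₂ refl)) (inj₂ (inj₂ refl)) ab t m = contradiction refl ab
    relabel₂ (inj₁ refl) (inj₂ (inj₁ refl)) ab t m = _ , inj₂ (inj₂ refl) , t , m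
    relabel₂ (inj₁ refl) (inj₂ (inj₂ refl)) ab t m = _ , inj₂ (inj₁ refl) , mirror t , Q-mirror t m
    relabel₂ (inj₂ (inj₁ refl)) (inj₁ refl) ab t m = _ , inj₂ (inj₂ refl) , mirror (rot t) , Q-mirror (rot t) (Q-rot t m)
    relabel₂ (inj₂ (inj₁ refl)) (inj₂ (inj₂ refl)) ab t m = _ , inj₁ refl , rot t , Q-rot t m
    relabel₂ (inj₂ (inj₂ refl)) (inj₁ refl) ab t m = _ , inj₂ (inj₁ refl) , rot (rot t) , Q-rot (rot t) (Q-rot t m)
    relabel₂ (inj₂ (inj₂ refl)) (inj₂ (inj₁ refl)) ab t m = _ , inj₁ refl , rot (mirror t) , Q-rot (mirror t) (Q-mirror t m)

    relabel : ∀ {a b c x y z} → In3 a b c x → In3 a b c y → In3 a b c z → (t : Three K x y z) → Q t →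
      ∃ λ (t′ : Three K a b c) → Q t′
    relabel (inj₁ refl) (inj₁ refl) _ t m = contradiction refl (Three.a≢b t)
    relabel (inj₂ (inj₁ refl)) (inj₂ (inj₁ refl)) _ t m = contradiction refl (Three.a≢b t)
    relabel (inj₂ (inj₂ refl)) (inj₂ (inj₂ refl)) _ t m = contradiction refl (Three.a≢b t)
    relabel (inj₁ refl) _ (inj₁ refl) t m = contradiction refl (Three.a≢c t)
    relabel (inj₂ (inj₁ refl)) _ (inj₂ (inj₁ refl)) t m = contradiction refl (Three.a≢c t)
    relabel (inj₂ (inj₂ refl)) _ (inj₂ (inj₂ refl)) t m = contradiction refl (Three.a≢c t)
    relabel _ (inj₁ refl) (inj₁ refl) t m = contradiction refl (Three.b≢c t)
    relabel _ (inj₂ (inj₁ refl)) (inj₂ (inj₁ refl)) t m = contradiction refl (Three.b≢c t)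
    relabel _ (inj₂ (inj₂ refl)) (inj₂ (inj₂ refl)) t m = contradiction refl (Three.b≢c t)
    relabel (inj₁ refl) (inj₂ (inj₁ refl)) (inj₂ (inj₂ refl)) t m = t , m
    relabel (inj₁ refl) (inj₂ (inj₂ refl)) (inj₂ (inj₁ refl)) t m = mirror t , Q-mirror t m
    relabel (inj₂ (inj₂ refl)) (inj₁ refl) (inj₂ (inj₁ refl)) t m = rot t , Q-rot t m
    relabel (inj₂ (inj₁ refl)) (inj₂ (inj₂ refl)) (inj₁ refl) t m = rot (rot t) , Q-rot (rot t) (Q-rot t m)
    relabel (inj₂ (inj₁ refl)) (inj₁ refl) (inj₂ (inj₂ refl)) t m = mirror (rot t) , Q-mirror (rot t) (Q-rot t m)
    relabel (inj₂ (inj₂ refl)) (inj₂ (inj₁ refl)) (inj₁ refl) t m = rot (mirror t) , Q-rot (mirror t) (Q-mirror t m)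

  data Fenced (K : Subset n) (v : Fin n) (C : List (Fin n)) : Set₁ where
    one : ∀ w → (∀ {u} → u ∈ˡ C → (u ∉ K × comp G K u ≡ comp G K v) ⊎ (u ≡ w × u ∈ K × Nbr G K (comp G K v) u)) → Fenced K v C
    two : ∀ {a b} → a ∈ K → b ∈ K → (t : Two K a b) →
      colour (Two.p t) ≡ comp G K v → colour (Two.q t) ≡ comp G K v →
      (∀ {u} → u ∈ˡ C → (u ∉ K × comp G K u ≡ comp G K v) ⊎ (u ≡ a ⊎ u ≡ b)) → Fenced K v C
    three : ∀ {a b c} → a ∈ K → b ∈ K → c ∈ K → (t : Three K a b c) →
      colour (Three.p t) ≡ comp G K v → colour (Three.q t) ≡ comp G K v → colour (Three.r t) ≡ comp G K v →
      (∀ {u} → u ∈ˡ C → (u ∉ K × comp G K u ≡ comp G K v) ⊎ In3 a b c u) → Fenced K v C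

  nbr≢ : ∀ {K A x d} → Nbr G K A x → ¬ Nbr G K A d → d ≢ x
  nbr≢ nx nd refl = nd nx

  -- The standard source of disjointness: a segment ending at `x` does not lie in a component
  -- without neighbours of `x`.
  colour≢ : ∀ {K A B x} → Nbr G K A x → ¬ Nbr G K B x → A ≢ B
  colour≢ na nb refl = nb na

  module Combine {K : Subset n} (cl : IsClique G K) where
    open Shapes cl

    -- If the segments share an end, one edge of K closes them to a cycle with three vertices of K.
    -- Otherwise two edges do, with four, and the weaker bound is kept.
    joint : ∀ {a b c d p q M N} → Seg K a b p M → Seg K c d q N → a ∈ K → b ∈ K → c ∈ K → d ∈ K →
      a ≢ b → c ≢ d → a ≢ c → a ≢ d → Disj M N → 3 + p + q ≤ L
    joint {a} {b} {c} {d} {p} {q} s t a∈ b∈ c∈ d∈ ab cd ac ad dis with b Fin.≟ c | b Fin.≟ d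
    ... | yes refl | _ = subst (_≤ L) (+-identityʳ _)
      (cyc3 s t (kedge d∈ a∈ (ad ∘ sym)) a∈ b∈ d∈ ab cd ad dis (λ _ _ ()) (λ _ _ ()))
    ... | no _ | yes refl = subst (_≤ L) (+-identityʳ _)
      (cyc3 s (seg-rev t) (kedge c∈ a∈ (ac ∘ sym)) a∈ b∈ c∈ ab (cd ∘ sym) ac dis (λ _ _ ()) (λ _ _ ()))
    ... | no bc | no bd = ≤-trans (≤-trans (n≤1+n _) (≤-reflexive (eq p q)))
      (cyc4 s (kedge b∈ c∈ bc) t (kedge d∈ a∈ (ad ∘ sym)) a∈ b∈ c∈ d∈ ab ac ad bc bd cd
        (λ _ _ ()) dis (λ _ _ ()) (λ _ ()) (λ _ ()) (λ _ _ ()))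
      where
      eq : ∀ p q → 4 + p + q ≡ 4 + p + 0 + q + 0
      eq = solve-∀

    bridge4 : ∀ {a b c d p q r M N O} → Seg K a b p M → Seg K b c q N → Seg K c d r O →
      a ∈ K → b ∈ K → c ∈ K → d ∈ K → a ≢ b → a ≢ c → a ≢ d → b ≢ c → b ≢ d → c ≢ d →
      Disj M N → Disj M O → Disj N O → 4 + p + q + r ≤ L
    bridge4 s t u a∈ b∈ c∈ d∈ ab ac ad bc bd cd mn mo no′ = subst (_≤ L) (+-identityʳ _)
      (cyc4 s t u (kedge d∈ a∈ (ad ∘ sym)) a∈ b∈ c∈ d∈ ab ac ad bc bd cd
        mn mo (λ _ _ ()) no′ (λ _ _ ()) (λ _ _ ()))

    -- `p` is paired with `p′` and `q` with `q′`: at least 3 + 3 vertices of K instead of 2 + 2.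
    two-two : ∀ {a b c d} → (t : Two K a b) (t′ : Two K c d) → a ∈ K → b ∈ K → c ∈ K → d ∈ K → a ≢ c → a ≢ d →
      Disj (M (Two.p t)) (M (Two.p t′)) → Disj (M (Two.q t)) (M (Two.q t′)) → ⊥
    two-two (two p q ab _ s) (two p′ q′ cd _ s′) a∈ b∈ c∈ d∈ ac ad dp dq =
      overflow 1 (joint (path p) (path p′) a∈ b∈ c∈ d∈ ab cd ac ad dp) (joint (path q) (path q′) a∈ b∈ c∈ d∈ ab cd ac ad dq)
        s s′ (eq (len p) (len q) (len p′) (len q′))
      where
      eq : ∀ p q p′ q′ → (3 + p + p′) + (3 + q + q′) ≡ 2 + ((2 + p + q) + (2 + p′ + q′))
      eq = solve-∀

    -- One cycle is `p`, `p′`, `q′`, the other `q` and `r′`, which meet in `b`. Both are closed by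
    -- the edge between `y` and `a`, with 4 + 3 vertices of K instead of 2 + 3.
    two-three : ∀ {a b x y} → (t : Two K a b) (t′ : Three K b x y) → a ∈ K → b ∈ K → x ∈ K → y ∈ K →
      x ≢ a → y ≢ a → Disj (M (Two.p t)) (M (Three.p t′)) → Disj (M (Two.p t)) (M (Three.q t′)) →
      Disj (M (Two.q t)) (M (Three.r t′)) → ⊥
    two-three (two p q ab _ s) (three p′ q′ r′ bx xy by p′q′ p′r′ q′r′ s′) a∈ b∈ x∈ y∈ xa ya d₁ d₂ d₃ =
      overflow 1 (bridge4 (path p) (path p′) (path q′) a∈ b∈ x∈ y∈ ab (xa ∘ sym) (ya ∘ sym) bx by xy d₁ d₂ p′q′)
        (joint (path q) (path (crev r′)) a∈ b∈ b∈ y∈ ab by ab (ya ∘ sym) d₃)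
        s s′ (eq (len p) (len q) (len p′) (len q′) (len r′))
      where
      eq : ∀ p q p′ q′ r′ → (4 + p + p′ + q′) + (3 + q + r′) ≡ 2 + ((2 + p + q) + (3 + p′ + q′ + r′))
      eq = solve-∀

    -- `r` and `r′` change places. Both new cycles are closed by the edge between `c` and `d` and
    -- use 4 + 4 vertices of K instead of 3 + 3.
    share-ab : ∀ {a b c d} (t : Three K a b c) (t′ : Three K a b d) → a ∈ K → b ∈ K → c ∈ K → d ∈ K → d ≢ c →
      Disj (M (Three.r t)) (M (Three.p t′)) → Disj (M (Three.r t)) (M (Three.q t′)) →
      Disj (M (Three.p t)) (M (Three.r t′)) → Disj (M (Three.q t)) (M (Three.r t′)) → ⊥
    share-ab (three p q r ab bc ac pq pr qr s) (three p′ q′ r′ _ bd ad p′q′ p′r′ q′r′ s′) a∈ b∈ c∈ d∈ dc d₁ d₂ d₃ d₄ =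
      overflow 1
        (bridge4 (path r) (path p′) (path q′) c∈ a∈ b∈ d∈ (ac ∘ sym) (bc ∘ sym) (dc ∘ sym) ab ad bd d₁ d₂ p′q′)
        (bridge4 (path r′) (path p) (path q) d∈ a∈ b∈ c∈ (ad ∘ sym) (bd ∘ sym) dc ab ac bc
          (λ u x y → d₃ u y x) (λ u x y → d₄ u y x) pq)
        s s′ (eq (len p) (len q) (len r) (len p′) (len q′) (len r′))
      where
      eq : ∀ p q r p′ q′ r′ → (4 + r + p′ + q′) + (4 + r′ + p + q) ≡ 2 + ((3 + p + q + r) + (3 + p′ + q′ + r′))
      eq = solve-∀

    -- `q`, `r`, `p′`, `q′` form a cycle through all five vertices, while `p` and `r′` meet in `a`.
    -- The edge between `b` and `e` closes both, giving 5 + 3 vertices of K instead of 3 + 3.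
    share-a : ∀ {a b c d e} (t : Three K a b c) (t′ : Three K a d e) →
      a ∈ K → b ∈ K → c ∈ K → d ∈ K → e ∈ K → d ≢ b → d ≢ c → e ≢ b → e ≢ c →
      Disj (M (Three.r t)) (M (Three.p t′)) → Disj (M (Three.r t)) (M (Three.q t′)) →
      Disj (M (Three.q t)) (M (Three.p t′)) → Disj (M (Three.q t)) (M (Three.q t′)) →
      Disj (M (Three.p t)) (M (Three.r t′)) → ⊥
    share-a (three p q r ab bc ac pq pr qr s) (three p′ q′ r′ ad de ae p′q′ p′r′ q′r′ s′)
        a∈ b∈ c∈ d∈ e∈ db dc eb ec d₁ d₂ d₃ d₄ d₅ =
      overflow 1
        (cyc5 (path q) (path r) (path p′) (path q′) (kedge e∈ b∈ eb) b∈ c∈ a∈ d∈ e∈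
          bc (ab ∘ sym) (db ∘ sym) (eb ∘ sym) (ac ∘ sym) (dc ∘ sym) (ec ∘ sym) ad ae de
          qr d₃ d₄ (λ _ _ ()) d₁ d₂ (λ _ _ ()) p′q′ (λ _ _ ()) (λ _ _ ()))
        (joint (seg-rev (path p)) (path r′) b∈ a∈ e∈ a∈ (ab ∘ sym) (ae ∘ sym) (eb ∘ sym) (ab ∘ sym) d₅)
        s s′ (eq (len p) (len q) (len r) (len p′) (len q′) (len r′))
      where
      eq : ∀ p q r p′ q′ r′ → (5 + q + r + p′ + q′ + 0) + (3 + p + r′) ≡ 2 + ((3 + p + q + r) + (3 + p′ + q′ + r′))
      eq = solve-∀

    -- The segments `q` and `q′` opposite to `a` change places, and two edges of K link each to its
    -- new cycle. Both cycles pass through all five vertices.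
    share-a-middle : ∀ {a b c d e} (t : Three K a b c) (t′ : Three K a d e) →
      a ∈ K → b ∈ K → c ∈ K → d ∈ K → e ∈ K → d ≢ b → d ≢ c → e ≢ b → e ≢ c →
      Disj (M (Three.p t)) (M (Three.q t′)) → Disj (M (Three.r t)) (M (Three.q t′)) →
      Disj (M (Three.q t)) (M (Three.p t′)) → Disj (M (Three.q t)) (M (Three.r t′)) → ⊥
    share-a-middle (three p q r ab bc ac pq pr qr s) (three p′ q′ r′ ad de ae p′q′ p′r′ q′r′ s′)
        a∈ b∈ c∈ d∈ e∈ db dc eb ec d₁ d₂ d₃ d₄ =
      overflow 3
        (cyc5 (path r) (path p) (kedge b∈ d∈ (db ∘ sym)) (path q′) (kedge e∈ c∈ ec) c∈ a∈ b∈ d∈ e∈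
          (ac ∘ sym) (bc ∘ sym) (dc ∘ sym) (ec ∘ sym) ab ad ae (db ∘ sym) (eb ∘ sym) de
          (λ u x y → pr u y x) (λ _ _ ()) d₂ (λ _ _ ()) (λ _ _ ()) d₁ (λ _ _ ()) (λ _ ()) (λ _ ()) (λ _ _ ()))
        (cyc5 (path r′) (path p′) (kedge d∈ b∈ db) (path q) (kedge c∈ e∈ (ec ∘ sym)) e∈ a∈ d∈ b∈ c∈
          (ae ∘ sym) (de ∘ sym) eb ec ad ab ac db dc bc
          (λ u x y → p′r′ u y x) (λ _ _ ()) (λ u x y → d₄ u y x) (λ _ _ ()) (λ _ _ ()) (λ u x y → d₃ u y x)
          (λ _ _ ()) (λ _ ()) (λ _ ()) (λ _ _ ()))
        s s′ (eq (len p) (len q) (len r) (len p′) (len q′) (len r′))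
      where
      eq : ∀ p q r p′ q′ r′ → (5 + r + p + 0 + q′ + 0) + (5 + r′ + p′ + 0 + q + 0) ≡ 4 + ((3 + p + q + r) + (3 + p′ + q′ + r′))
      eq = solve-∀

-- Longest cycles with a prescribed trace, and the existence of fences.

module Avoidance {n : ℕ} (G : Graph n) (chordal : Chordal G) (L : ℕ)
  (maxL : ∀ ys → IsCycle G ys → length ys ≤ L)
  (w : ℕ) (clique≤w : ∀ S → IsClique G S → ∣ S ∣ ≤ w)
  (avoid-set : ∀ Z → ∣ Z ∣ ≤ 1 ⊔ (w ∸ 3) →
    (∀ C → IsCycle G C → length C ≡ L → (∀ {u} → u ∈ˡ C → u ∉ Z) → ⊥) → ⊥) where
  open Graph G
  open Longest G L maxL
  open Segments G L maxL
  open Traces G L maxL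

  -- This is where the 1 in the maximum enters.
  avoid-vertex : ∀ a → (∀ C → IsCycle G C → length C ≡ L → a ∉ˡ C → ⊥) → ⊥
  avoid-vertex a k = avoid-set ⁅ a ⁆ (≤-trans (≤-reflexive (∣⁅x⁆∣≡1 a)) (m≤m⊔n 1 (w ∸ 3)))
    λ C cy eq out → k C cy eq λ m → out m (x∈⁅x⁆ a)

  module _ {K : Subset n} (cl : IsClique G K) where

    -- This is where `w ∸ 3` enters: the rest of K after the removal of three vertices has at most
    -- that many elements, and a longest cycle avoiding it meets K only in these three.
    with-trace : ∀ {a b c} → a ∈ K → b ∈ K → c ∈ K → a ≢ b → b ≢ c → a ≢ c →
      (∀ C → IsCycle G C → length C ≡ L → (∀ {u} → u ∈ˡ C → u ∈ K → In3 a b c u) → ⊥) → ⊥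
    with-trace {a} {b} {c} a∈ b∈ c∈ ab bc ac k = avoid-set Z small λ C cy eq out → k C cy eq (trace out)
      where
      Z = K - a - b - c
      b∈′ = x∈p∧x≢y⇒x∈p-y b∈ (ab ∘ sym)
      c∈′ = x∈p∧x≢y⇒x∈p-y (x∈p∧x≢y⇒x∈p-y c∈ (ac ∘ sym)) (bc ∘ sym)
      small : ∣ Z ∣ ≤ 1 ⊔ (w ∸ 3)
      small = ≤-trans (m+n≤o⇒m≤o∸n ∣ Z ∣ (≤-trans (≤-reflexive (+-comm ∣ Z ∣ 3))
          (≤-trans (s≤s (≤-trans (s≤s (x∈p⇒∣p-x∣<∣p∣ c∈′)) (x∈p⇒∣p-x∣<∣p∣ b∈′)))
            (≤-trans (x∈p⇒∣p-x∣<∣p∣ a∈) (clique≤w K cl)))))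
        (m≤n⊔m 1 (w ∸ 3))
      trace : ∀ {C} → (∀ {u} → u ∈ˡ C → u ∉ Z) → ∀ {u} → u ∈ˡ C → u ∈ K → In3 a b c u
      trace out {u} u∈C u∈K with u Fin.≟ a | u Fin.≟ b | u Fin.≟ c
      ... | yes e | _ | _ = inj₁ e
      ... | no _ | yes e | _ = inj₂ (inj₁ e)
      ... | no _ | no _ | yes e = inj₂ (inj₂ e)
      ... | no p | no q | no r =
        contradiction (x∈p∧x≢y⇒x∈p-y (x∈p∧x≢y⇒x∈p-y (x∈p∧x≢y⇒x∈p-y u∈K p) q) r) (out u∈C)

    -- If K = {a, b, x}, then there is no fourth vertex, and y is b.
    avoiding : ∀ {a b x} → a ∈ K → b ∈ K → x ∈ K → b ≢ a → x ≢ a → b ≢ x →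
      (∀ y C → y ∈ K → y ≢ a → IsCycle G C → length C ≡ L → a ∉ˡ C → (∀ {u} → u ∈ˡ C → u ∈ K → In3 b x y u) → ⊥) → ⊥
    avoiding {a} {b} {x} a∈ b∈ x∈ ba xa bx k
      with Fin.any? (λ y → y ∈? K ×-dec ¬? (y Fin.≟ a) ×-dec ¬? (y Fin.≟ b) ×-dec ¬? (y Fin.≟ x))
    ... | yes (y , y∈ , ya , yb , yx) = with-trace b∈ x∈ y∈ bx (yx ∘ sym) (yb ∘ sym) λ C cy eq tr →
      k y C y∈ ya cy eq (λ m → [ ba ∘ sym , [ xa ∘ sym , ya ∘ sym ]′ ]′ (tr m a∈)) tr
    ... | no ¬e = avoid-vertex a λ C cy eq a∉ → k b C b∈ ba cy eq a∉ (trace a∉)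
      where
      trace : ∀ {C} → a ∉ˡ C → ∀ {u} → u ∈ˡ C → u ∈ K → In3 b x b u
      trace a∉ {u} u∈C u∈K with u Fin.≟ b | u Fin.≟ x
      ... | yes e | _ = inj₁ e
      ... | no _ | yes e = inj₂ (inj₁ e)
      ... | no p | no q = contradiction (u , u∈K , (λ { refl → a∉ u∈C }) , p , q) ¬e

    -- For a clique with one or two vertices the cycle only has to avoid `z`, and the three names
    -- for the trace are filled up with repetitions.
    missing-one : ∀ {z} → z ∈ K →
      (∀ b x y C → IsCycle G C → length C ≡ L → z ∉ˡ C → (∀ {u} → u ∈ˡ C → u ∈ K → In3 b x y u) → ⊥) → ⊥
    missing-one {z} z∈ k with Fin.any? (λ b → b ∈? K ×-dec ¬? (b Fin.≟ z))
    ... | no ¬e = avoid-vertex z λ C cy eq z∉ → k z z z C cy eq z∉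
      λ {u} u∈C u∈K → contradiction (u , u∈K , λ { refl → z∉ u∈C }) ¬e
    ... | yes (b , b∈ , bz) with Fin.any? (λ x → x ∈? K ×-dec ¬? (x Fin.≟ z) ×-dec ¬? (x Fin.≟ b))
    ... | yes (x , x∈ , xz , xb) = avoiding z∈ b∈ x∈ bz xz (xb ∘ sym) λ y C _ _ cy eq z∉ tr → k b x y C cy eq z∉ tr
    ... | no ¬e = avoid-vertex z λ C cy eq z∉ → k b b b C cy eq z∉ (trace z∉)
      where
      trace : ∀ {C} → z ∉ˡ C → ∀ {u} → u ∈ˡ C → u ∈ K → In3 b b b u
      trace z∉ {u} u∈C u∈K with u Fin.≟ b
      ... | yes e = inj₁ e
      ... | no p = contradiction (u , u∈K , (λ { refl → z∉ u∈C }) , p) ¬e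

  -- The hypothesis `no-fence` is refuted by `fence`: on two longest cycles that
  -- each visit several components of G − K, the segments can be redistributed
  -- so that the segments joined together lie in different components.
  module Fence {K : Subset n} (cl : IsClique G K) (mx : IsMaximal G K)
    (no-fence : ∀ {v C} → v ∉ K → IsCycle G C → length C ≡ L → Fenced K v C → ⊥) where
    open Combine cl
    open Relabel {K} Crossing crossing-rot crossing-mirror

    missed : ∀ {x y} (s : CSeg K x y) → ∃ λ d → d ∈ K × ¬ Nbr G K (colour s) d
    missed s with member s
    ... | u , m with mono s u m
    ... | u∉ , refl = non-neighbour G chordal cl mx u∉

    not-one : ∀ {C v} w → IsCycle G C → length C ≡ L → v ∉ K →
      (∀ {u} → u ∈ˡ C → (u ∉ K × comp G K u ≡ comp G K v) ⊎ (u ≡ w × u ∈ K × Nbr G K (comp G K v) u)) → ⊥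
    not-one w cy eq v∉ cover = no-fence v∉ cy eq (one w cover)

    two-crosses : ∀ {C a b} → IsCycle G C → length C ≡ L → a ∈ K → b ∈ K → (t : Two K a b) →
      (∀ {u} → u ∈ˡ C → (u ≡ a ⊎ u ≡ b) ⊎ (M (Two.p t) u ⊎ M (Two.q t) u)) → colour (Two.p t) ≢ colour (Two.q t)
    two-crosses cy eq a∈ b∈ t@(two p q _ _ _) cover e with member p
    ... | v , m with mono p v m
    ... | v∉ , ev = no-fence v∉ cy eq (two a∈ b∈ t (sym ev) (trans (sym e) (sym ev)) λ m → cover′ (cover m))
      where
      cover′ : ∀ {u a b} → (u ≡ a ⊎ u ≡ b) ⊎ (M p u ⊎ M q u) → (u ∉ K × comp G K u ≡ comp G K v) ⊎ (u ≡ a ⊎ u ≡ b)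
      cover′ (inj₁ x) = inj₂ x
      cover′ {u} (inj₂ (inj₁ x)) = inj₁ (proj₁ (mono p u x) , trans (proj₂ (mono p u x)) (sym ev))
      cover′ {u} (inj₂ (inj₂ x)) = inj₁ (proj₁ (mono q u x) , trans (proj₂ (mono q u x)) (trans (sym e) (sym ev)))

    three-crosses : ∀ {C a b c} → IsCycle G C → length C ≡ L → a ∈ K → b ∈ K → c ∈ K → (t : Three K a b c) →
      (∀ {u} → u ∈ˡ C → In3 a b c u ⊎ (M (Three.p t) u ⊎ M (Three.q t) u ⊎ M (Three.r t) u)) →
      Crossing t
    three-crosses cy eq a∈ b∈ c∈ t@(three p q r _ _ _ _ _ _ _) cover (e , f) with member p
    ... | v , m with mono p v m
    ... | v∉ , ev = no-fence v∉ cy eq (three a∈ b∈ c∈ t (sym ev) eq-q eq-r λ m → cover′ (cover m))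
      where
      eq-q = trans (sym e) (sym ev)
      eq-r = trans (sym f) eq-q
      cover′ : ∀ {u a b c} → In3 a b c u ⊎ (M p u ⊎ M q u ⊎ M r u) → (u ∉ K × comp G K u ≡ comp G K v) ⊎ In3 a b c u
      cover′ (inj₁ x) = inj₂ x
      cover′ {u} (inj₂ (inj₁ x)) = inj₁ (proj₁ (mono p u x) , trans (proj₂ (mono p u x)) (sym ev))
      cover′ {u} (inj₂ (inj₂ (inj₁ x))) = inj₁ (proj₁ (mono q u x) , trans (proj₂ (mono q u x)) eq-q)
      cover′ {u} (inj₂ (inj₂ (inj₂ x))) = inj₁ (proj₁ (mono r u x) , trans (proj₂ (mono r u x)) eq-r)

    -- Of the two ways to match the segments of one cycle with those of the other, at least one
    -- never matches equal colours.
    two-two-crossing : ∀ {a b c d} → (t : Two K a b) (t′ : Two K c d) → a ∈ K → b ∈ K → c ∈ K → d ∈ K → a ≢ c → a ≢ d →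
      colour (Two.p t) ≢ colour (Two.q t) → colour (Two.p t′) ≢ colour (Two.q t′) → ⊥
    two-two-crossing t@(two p q ab pq s) t′@(two p′ q′ ab′ pq′ s′) a∈ b∈ c∈ d∈ ac ad x x′
      with _≟ˢ_ G (colour p) (colour p′) | _≟ˢ_ G (colour q) (colour q′)
    ... | no np | no nq = two-two t t′ a∈ b∈ c∈ d∈ ac ad (colour-disj p p′ np) (colour-disj q q′ nq)
    ... | yes e | _ = two-two t swapped a∈ b∈ c∈ d∈ ac ad
        (colour-disj p q′ (λ f → x′ (trans (sym e) f))) (colour-disj q p′ (λ f → x (trans e (sym f))))
      where
      swapped = two q′ p′ ab′ (λ u y z → pq′ u z y) (trans (cong (2 +_) (+-comm (len q′) (len p′))) s′)
    ... | no _ | yes e = two-two t swapped a∈ b∈ c∈ d∈ ac ad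
        (colour-disj p q′ (λ f → x (trans f (sym e)))) (colour-disj q p′ (λ f → x′ (trans (sym f) e)))
      where
      swapped = two q′ p′ ab′ (λ u y z → pq′ u z y) (trans (cong (2 +_) (+-comm (len q′) (len p′))) s′)

    -- Let `d` be missed by the component of `p` and `e` by that of `q`. If they differ, a cycle
    -- with trace {b, d, e} has the disjointness that `two-three` needs. If `d` is missed by both,
    -- the two segments at `d` are disjoint from `p` and `q`, and the third differs in colour from
    -- at least one of them, which decides the orientation.
    no-two : ∀ {a b} → a ∈ K → b ∈ K → (t : Two K a b) → colour (Two.p t) ≢ colour (Two.q t) → ⊥
    no-two {a} {b} a∈ b∈ t@(two p q ab pq s) x with missed p | missed q
    ... | d , d∈ , ¬d | e , e∈ , ¬e = case (d Fin.≟ e)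
      where
      da = nbr≢ (start p) ¬d
      db = nbr≢ (end p) ¬d
      ea = nbr≢ (start q) ¬e
      eb = nbr≢ (end q) ¬e
      pair : ∀ {y C} → y ∈ K → y ≢ a → IsCycle G C → length C ≡ L → (∀ {u} → u ∈ˡ C → u ∈ K → In3 b d y u) →
        Decomp K C → ((t′ : Three K b d y) → ⊥) → ⊥
      pair y∈ ya cy eq tr (one w v∉ cover) k = not-one w cy eq v∉ cover
      pair y∈ ya cy eq tr (two c∈C d∈C c∈ d∈ t′ cover) k =
        two-two-crossing t t′ a∈ b∈ c∈ d∈ (≢a c∈C c∈) (≢a d∈C d∈) x (two-crosses cy eq c∈ d∈ t′ cover)
        where
        ≢a : ∀ {u} → u ∈ˡ _ → u ∈ K → a ≢ u
        ≢a m u∈ refl = [ ab , [ da ∘ sym , ya ∘ sym ]′ ]′ (tr m u∈)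
      pair y∈ ya cy eq tr (three x∈C y∈C z∈C x∈ y∈′ z∈ t′ cover) k =
        k (proj₁ (relabel (tr x∈C x∈) (tr y∈C y∈′) (tr z∈C z∈) t′ (three-crosses cy eq x∈ y∈′ z∈ t′ cover)))
      case : Dec (d ≡ e) → ⊥
      case (no d≢e) = with-trace cl b∈ d∈ e∈ (db ∘ sym) d≢e (eb ∘ sym) λ C cy eq tr →
        pair e∈ ea cy eq tr
          (decompose cl a∈ (λ m → [ ab , [ da ∘ sym , ea ∘ sym ]′ ]′ (tr m a∈)) cy eq tr)
          λ t′ → two-three t t′ a∈ b∈ d∈ e∈ da ea
            (colour-disj p (Three.p t′) (colour≢ (end (Three.p t′)) ¬d ∘ sym))
            (colour-disj p (Three.q t′) (colour≢ (start (Three.q t′)) ¬d ∘ sym))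
            (colour-disj q (Three.r t′) (colour≢ (start (Three.r t′)) ¬e ∘ sym))
      case (yes refl) = avoiding cl a∈ b∈ d∈ (ab ∘ sym) da (db ∘ sym) λ y C y∈ ya cy eq a∉ tr →
        pair y∈ ya cy eq tr (decompose cl a∈ a∉ cy eq tr) λ t′ → finish y∈ ya t′ (_≟ˢ_ G (colour q) (colour (Three.r t′)))
        where
        finish : ∀ {y} → y ∈ K → y ≢ a → (t′ : Three K b d y) → Dec (colour q ≡ colour (Three.r t′)) → ⊥
        finish y∈ ya t′ (no ne) = two-three t t′ a∈ b∈ d∈ y∈ da ya
            (colour-disj p (Three.p t′) (colour≢ (end (Three.p t′)) ¬d ∘ sym))
            (colour-disj p (Three.q t′) (colour≢ (start (Three.q t′)) ¬d ∘ sym))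
            (colour-disj q (Three.r t′) ne)
        finish y∈ ya t′ (yes e) = two-three t (mirror t′) a∈ b∈ y∈ d∈ ya da
            (colour-disj p (crev (Three.r t′)) (λ f → x (trans f (sym e))))
            (colour-disj p (crev (Three.q t′)) (colour≢ (start (Three.q t′)) ¬d ∘ sym))
            (colour-disj q (crev (Three.p t′)) (colour≢ (end (Three.p t′)) ¬e ∘ sym))

    -- Smaller traces are already excluded by `not-one` and `no-two`; the vertex `z` outside the
    -- trace makes `decompose` applicable.
    with-three : ∀ {a b c z} → a ∈ K → b ∈ K → c ∈ K → z ∈ K → a ≢ b → b ≢ c → a ≢ c → z ≢ a → z ≢ b → z ≢ c →
      ((t : Three K a b c) → Crossing t → ⊥) → ⊥
    with-three {a} {b} {c} a∈ b∈ c∈ z∈ ab bc ac za zb zc k = with-trace cl a∈ b∈ c∈ ab bc ac λ C cy eq tr →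
      go cy eq tr (decompose cl z∈ (λ m → [ za , [ zb , zc ]′ ]′ (tr m z∈)) cy eq tr)
      where
      go : ∀ {C} → IsCycle G C → length C ≡ L → (∀ {u} → u ∈ˡ C → u ∈ K → In3 a b c u) → Decomp K C → ⊥
      go cy eq tr (one w v∉ cover) = not-one w cy eq v∉ cover
      go cy eq tr (two _ _ x∈ y∈ t cover) = no-two x∈ y∈ t (two-crosses cy eq x∈ y∈ t cover)
      go cy eq tr (three x∈C y∈C z∈C x∈ y∈ z∈ t cover)
        with relabel (tr x∈C x∈) (tr y∈C y∈) (tr z∈C z∈) t (three-crosses cy eq x∈ y∈ z∈ t cover)
      ... | t′ , x = k t′ x

    -- `share-ab` rules out the trace {a, c, d}, where d has no neighbour in the
    -- common component of q and r, unless the segment from c to d lies in the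
    -- component of p; then `share-a` applies to {a, d, e}, with e missed by p.
    bicoloured : ∀ {a b c} → a ∈ K → b ∈ K → c ∈ K → (t : Three K a b c) →
      colour (Three.q t) ≡ colour (Three.r t) → colour (Three.p t) ≢ colour (Three.q t) → ⊥
    bicoloured {a} {b} {c} a∈ b∈ c∈ t@(three p q r ab bc ac _ _ _ _) q≡r p≢q with missed q
    ... | d , d∈ , ¬d = with-three a∈ c∈ d∈ b∈ ac (dc ∘ sym) (da ∘ sym) (ab ∘ sym) bc (db ∘ sym) λ t′ _ → case t′ (_≟ˢ_ G (colour p) (colour (Three.q t′)))
      where
      ¬d′ : ¬ Nbr G K (colour r) d
      ¬d′ = subst (λ A → ¬ Nbr G K A d) q≡r ¬d
      da = nbr≢ (end r) ¬d′
      db = nbr≢ (start q) ¬d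
      dc = nbr≢ (end q) ¬d
      p≢r : colour p ≢ colour r
      p≢r e = p≢q (trans e (sym q≡r))
      case : (t′ : Three K a c d) → Dec (colour p ≡ colour (Three.q t′)) → ⊥
      case t′@(three p′ q′ r′ _ _ _ _ _ _ _) (no p≢q′) with _≟ˢ_ G (colour p) (colour p′)
      ... | no p≢p′ = share-ab (mirror t) t′ a∈ c∈ b∈ d∈ db
        (colour-disj (crev p) p′ p≢p′) (colour-disj (crev p) q′ p≢q′)
        (colour-disj (crev r) r′ (colour≢ (start r′) ¬d′ ∘ sym))
        (colour-disj (crev q) r′ (colour≢ (start r′) ¬d ∘ sym))
      ... | yes p≡p′ = share-ab (mirror (rot (mirror t))) (mirror (rot t′)) c∈ a∈ b∈ d∈ db
        (colour-disj q (crev p′) (λ e → p≢q (trans p≡p′ (sym e))))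
        (colour-disj q (crev r′) (colour≢ (start r′) ¬d ∘ sym))
        (colour-disj r (crev q′) (colour≢ (end q′) ¬d′ ∘ sym))
        (colour-disj p (crev q′) p≢q′)
      case t′@(three p′ q′ r′ _ _ _ _ _ _ _) (yes p≡q′) with missed p
      ... | e , e∈ , ¬e = with-three a∈ d∈ e∈ b∈ (da ∘ sym) (ed ∘ sym) (ea ∘ sym) (ab ∘ sym) (db ∘ sym) (eb ∘ sym)
        λ { t″@(three p″ q″ r″ _ _ _ _ _ _ _) _ → share-a t t″ a∈ b∈ c∈ d∈ e∈ db dc eb ec
          (colour-disj r p″ (colour≢ (end p″) ¬d′ ∘ sym)) (colour-disj r q″ (colour≢ (start q″) ¬d′ ∘ sym))
          (colour-disj q p″ (colour≢ (end p″) ¬d ∘ sym)) (colour-disj q q″ (colour≢ (start q″) ¬d ∘ sym))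
          (colour-disj p r″ (colour≢ (start r″) ¬e ∘ sym)) }
        where
        ¬e′ : ¬ Nbr G K (colour q′) e
        ¬e′ = subst (λ A → ¬ Nbr G K A e) p≡q′ ¬e
        ea = nbr≢ (start p) ¬e
        eb = nbr≢ (end p) ¬e
        ec = nbr≢ (start q′) ¬e′
        ed = nbr≢ (end q′) ¬e′

    Rainbow : ∀ {a b c} → Three K a b c → Set
    Rainbow (three p q r _ _ _ _ _ _ _) = colour p ≢ colour q × colour q ≢ colour r × colour p ≢ colour r

    rainbow : ∀ {a b c} → a ∈ K → b ∈ K → c ∈ K → (t : Three K a b c) → Crossing t → (Rainbow t → ⊥) → ⊥
    rainbow a∈ b∈ c∈ t@(three p q r _ _ _ _ _ _ _) x k
      with _≟ˢ_ G (colour p) (colour q) | _≟ˢ_ G (colour q) (colour r) | _≟ˢ_ G (colour p) (colour r)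
    ... | no ¬pq | no ¬qr | no ¬pr = k (¬pq , ¬qr , ¬pr)
    ... | yes pq | yes qr | _      = x (pq , qr)
    ... | yes pq | no ¬qr | _      = bicoloured c∈ a∈ b∈ (rot (rot t)) pq (λ e → ¬qr (sym (trans e pq)))
    ... | no ¬pq | yes qr | _      = bicoloured a∈ b∈ c∈ t qr ¬pq
    ... | no ¬pq | no ¬qr | yes pr = bicoloured b∈ c∈ a∈ (rot t) (sym pr) ¬qr

    -- A rainbow cycle with trace {a, d, e} has at most one segment of the colour of `q`. If it is
    -- `q′`, the middle segments are exchanged. Otherwise `share-a` applies in the orientation for
    -- which `q` is disjoint from the two segments it has to join.
    two-missed : ∀ {a b c d e} → a ∈ K → b ∈ K → c ∈ K → d ∈ K → e ∈ K → (t : Three K a b c) → Rainbow t →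
      ¬ Nbr G K (colour (Three.p t)) d → ¬ Nbr G K (colour (Three.r t)) e →
      d ≢ a → d ≢ b → d ≢ c → e ≢ a → e ≢ b → e ≢ c → e ≢ d → ⊥
    two-missed {a} {b} {c} {d} {e} a∈ b∈ c∈ d∈ e∈ t@(three p q r ab bc ac _ _ _ _) (p≢q , q≢r , p≢r) ¬d ¬e da db dc ea eb ec ed =
      with-three a∈ d∈ e∈ b∈ (da ∘ sym) (ed ∘ sym) (ea ∘ sym) (ab ∘ sym) (db ∘ sym) (eb ∘ sym) λ t′ x →
        rainbow a∈ d∈ e∈ t′ x (case t′)
      where
      case : (t′ : Three K a d e) → Rainbow t′ → ⊥
      case t′@(three p′ q′ r′ _ _ _ _ _ _ _) (p′≢q′ , q′≢r′ , p′≢r′)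
        with _≟ˢ_ G (colour q) (colour q′) | _≟ˢ_ G (colour q) (colour r′)
      ... | yes q≡q′ | _ = share-a-middle t t′ a∈ b∈ c∈ d∈ e∈ db dc eb ec
        (colour-disj p q′ (λ f → p≢q (trans f (sym q≡q′)))) (colour-disj r q′ (λ f → q≢r (trans q≡q′ (sym f))))
        (colour-disj q p′ (λ f → p′≢q′ (trans (sym f) q≡q′))) (colour-disj q r′ (λ f → q′≢r′ (trans (sym q≡q′) f)))
      ... | no q≢q′ | no q≢r′ = share-a t (mirror t′) a∈ b∈ c∈ e∈ d∈ eb ec db dc
        (colour-disj r (crev r′) (colour≢ (start r′) ¬e ∘ sym)) (colour-disj r (crev q′) (colour≢ (end q′) ¬e ∘ sym))
        (colour-disj q (crev r′) q≢r′) (colour-disj q (crev q′) q≢q′)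
        (colour-disj p (crev p′) (colour≢ (end p′) ¬d ∘ sym))
      ... | no q≢q′ | yes q≡r′ = share-a (mirror t) t′ a∈ c∈ b∈ d∈ e∈ dc db ec eb
        (colour-disj (crev p) p′ (colour≢ (end p′) ¬d ∘ sym)) (colour-disj (crev p) q′ (colour≢ (start q′) ¬d ∘ sym))
        (colour-disj (crev q) p′ (λ f → p′≢r′ (trans (sym f) q≡r′))) (colour-disj (crev q) q′ q≢q′)
        (colour-disj (crev r) r′ (colour≢ (start r′) ¬e ∘ sym))

    -- Otherwise a vertex `d` missed by the component of `p` differs from all of `a`, `b`, `c`. A
    -- cycle with trace {a, b, d} contradicts `share-ab`, unless `q′` has the colour of `r` or `r′`
    -- that of `q`. A vertex missed by such a repeated colour is a fifth one, as `two-missed`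
    -- requires.
    opposite-missed : ∀ {a b c} → a ∈ K → b ∈ K → c ∈ K → (t : Three K a b c) → Rainbow t → ¬ Nbr G K (colour (Three.p t)) c
    opposite-missed {a} {b} {c} a∈ b∈ c∈ t@(three p q r ab bc ac _ _ _ _) rb@(p≢q , q≢r , p≢r) pc with missed p
    ... | d , d∈ , ¬d = with-three a∈ b∈ d∈ c∈ ab (db ∘ sym) (da ∘ sym) (ac ∘ sym) (bc ∘ sym) (dc ∘ sym) λ t′ _ → case t′
      where
      da = nbr≢ (start p) ¬d
      db = nbr≢ (end p) ¬d
      dc = nbr≢ pc ¬d
      case : (t′ : Three K a b d) → ⊥
      case t′@(three p′ q′ r′ _ _ _ _ _ _ _)
        with _≟ˢ_ G (colour q′) (colour r) | _≟ˢ_ G (colour r′) (colour q)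
      ... | yes q′≡r | _ with missed r
      ... | e , e∈ , ¬e = two-missed a∈ b∈ c∈ d∈ e∈ t rb ¬d ¬e da db dc (nbr≢ (end r) ¬e)
          (nbr≢ (start q′) ¬e′) (nbr≢ (start r) ¬e) (nbr≢ (end q′) ¬e′)
        where
        ¬e′ : ¬ Nbr G K (colour q′) e
        ¬e′ = subst (λ A → ¬ Nbr G K A e) (sym q′≡r) ¬e
      case t′@(three p′ q′ r′ _ _ _ _ _ _ _) | no _ | yes r′≡q with missed q
      ... | e , e∈ , ¬e = two-missed b∈ a∈ c∈ d∈ e∈ (mirror (rot t)) (p≢r , (λ f → q≢r (sym f)) , p≢q) ¬d ¬e db da dc
          (nbr≢ (start q) ¬e) (nbr≢ (end r′) ¬e′) (nbr≢ (end q) ¬e) (nbr≢ (start r′) ¬e′)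
        where
        ¬e′ : ¬ Nbr G K (colour r′) e
        ¬e′ = subst (λ A → ¬ Nbr G K A e) (sym r′≡q) ¬e
      case t′@(three p′ q′ r′ _ _ _ _ _ _ _) | no q′≢r | no r′≢q with _≟ˢ_ G (colour p′) (colour r)
      ... | no p′≢r = share-ab t t′ a∈ b∈ c∈ d∈ dc
        (colour-disj r p′ (p′≢r ∘ sym)) (colour-disj r q′ (q′≢r ∘ sym))
        (colour-disj p r′ (colour≢ (start r′) ¬d ∘ sym)) (colour-disj q r′ (r′≢q ∘ sym))
      ... | yes p′≡r = share-ab (mirror (rot t)) (mirror (rot t′)) b∈ a∈ c∈ d∈ dc
        (colour-disj (crev q) (crev p′) (λ f → q≢r (trans f p′≡r))) (colour-disj (crev q) (crev r′) (r′≢q ∘ sym))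
        (colour-disj (crev p) (crev q′) (colour≢ (end q′) ¬d ∘ sym)) (colour-disj (crev r) (crev q′) (q′≢r ∘ sym))

    -- By `opposite-missed` the components of `r` and of `r′` both miss `b`, whereas `p`, `q`, `p′`,
    -- `q′` all end there. This is the disjointness that `share-ab` needs for the traces {a, b, c}
    -- and {a, b, d}.
    no-three : ∀ {a b c z} → a ∈ K → b ∈ K → c ∈ K → z ∈ K → z ≢ a → z ≢ b → z ≢ c → (t : Three K a b c) → Crossing t → ⊥
    no-three {a} {b} {c} {d} a∈ b∈ c∈ d∈ da db dc t@(three p q r ab bc ac _ _ _ _) x =
      rainbow a∈ b∈ c∈ t x λ { (p≢q , q≢r , p≢r) →
      with-three a∈ b∈ d∈ c∈ ab (db ∘ sym) (da ∘ sym) (ac ∘ sym) (bc ∘ sym) (dc ∘ sym) λ { t′@(three p′ q′ r′ _ _ _ _ _ _ _) x′ →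
      rainbow a∈ b∈ d∈ t′ x′ λ { (p′≢q′ , q′≢r′ , p′≢r′) →
      let ¬b  = opposite-missed c∈ a∈ b∈ (rot (rot t)) ((λ f → p≢r (sym f)) , p≢q , (λ f → q≢r (sym f)))
          ¬b′ = opposite-missed d∈ a∈ b∈ (rot (rot t′)) ((λ f → p′≢r′ (sym f)) , p′≢q′ , (λ f → q′≢r′ (sym f)))
      in share-ab t t′ a∈ b∈ c∈ d∈ dc
        (colour-disj r p′ (colour≢ (end p′) ¬b ∘ sym)) (colour-disj r q′ (colour≢ (start q′) ¬b ∘ sym))
        (colour-disj p r′ (colour≢ (end p) ¬b′)) (colour-disj q r′ (colour≢ (start q) ¬b′)) } } }

    fence : ∀ {z} → z ∈ K → ⊥
    fence {z} z∈ = missing-one cl z∈ λ b x y C cy eq z∉ tr → go cy eq z∉ (decompose cl z∈ z∉ cy eq tr)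
      where
      go : ∀ {C} → IsCycle G C → length C ≡ L → z ∉ˡ C → Decomp K C → ⊥
      go cy eq z∉ (one w v∉ cover) = not-one w cy eq v∉ cover
      go cy eq z∉ (two _ _ x∈ y∈ t cover) = no-two x∈ y∈ t (two-crosses cy eq x∈ y∈ t cover)
      go cy eq z∉ (three a∈C b∈C c∈C a∈ b∈ c∈ t cover) =
        no-three a∈ b∈ c∈ z∈ (λ { refl → z∉ a∈C }) (λ { refl → z∉ b∈C }) (λ { refl → z∉ c∈C })
          t (three-crosses cy eq a∈ b∈ c∈ t cover)

-- Whatever can be closed up with a segment that makes up half of a longest cycle has at most
-- `L / 2 − 2` interior vertices.
short-rest : ∀ {L p} ℓ → L ≤ suc p + suc p → 3 + p + ℓ ≤ L → 4 + ℓ + ℓ ≤ L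
short-rest {L} {p} ℓ h le = +-cancelʳ-≤ L _ L (≤-trans (+-monoʳ-≤ (4 + ℓ + ℓ) h)
  (≤-trans (≤-reflexive (eq p ℓ)) (+-mono-≤ le le)))
  where
  eq : ∀ p ℓ → 4 + ℓ + ℓ + (suc p + suc p) ≡ (3 + p + ℓ) + (3 + p + ℓ)
  eq = solve-∀

fit : ∀ {L x y u v} k → u ≤ L → v ≡ L → u ≡ x + k → v ≡ y + k → x ≤ y
fit {x = x} {y} k le refl e f = +-cancelʳ-≤ k x y (subst (_≤ _) e (subst (_ ≤_) f le))

-- Longest cycles on the two sides of S = N(A) ∩ K.

module _ {n : ℕ} (G : Graph n) (conn : KConnected G 2) (chordal : Chordal G) (L : ℕ)
  (maxL : ∀ ys → IsCycle G ys → length ys ≤ L)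
  (w : ℕ) (clique≤w : ∀ S → IsClique G S → ∣ S ∣ ≤ w)
  (avoid-set : ∀ Z → ∣ Z ∣ ≤ 1 ⊔ (w ∸ 3) →
    (∀ C → IsCycle G C → length C ≡ L → (∀ {u} → u ∈ˡ C → u ∉ Z) → ⊥) → ⊥) where
  open Graph G
  open TwoConnected G conn using (share-two)
  open Longest G L maxL
  open Segments G L maxL
  open Traces G L maxL
  open Avoidance G chordal L maxL w clique≤w avoid-set

  long-half : ∀ {X a b} (t : Two X a b) → ∃ λ (s : CSeg X a b) →
    (s ≡ Two.p t ⊎ s ≡ Two.q t) × L ≤ suc (len s) + suc (len s)
  long-half t@(two p q _ _ size) with ≤-total (len p) (len q)
  ... | inj₁ le = q , inj₂ refl , ≤-trans (≤-reflexive (trans (sym size) (sym (cong suc (+-suc (len p) (len q))))))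
                    (+-monoˡ-≤ (suc (len q)) (s≤s le))
  ... | inj₂ le = p , inj₁ refl , ≤-trans (≤-reflexive (trans (sym size) (sym (cong suc (+-suc (len p) (len q))))))
                    (+-monoʳ-≤ (suc (len p)) (s≤s le))

  AllColour : ∀ (A : Subset n) {X a b c} → Three X a b c → Set
  AllColour A t = colour (Three.p t) ≡ A × colour (Three.q t) ≡ A × colour (Three.r t) ≡ A

  allColour-rot : ∀ {A X a b c} (t : Three X a b c) → AllColour A t → AllColour A (rot t)
  allColour-rot _ (x , y , z) = y , z , x

  allColour-mirror : ∀ {A X a b c} (t : Three X a b c) → AllColour A t → AllColour A (mirror t)
  allColour-mirror _ (x , y , z) = z , y , x

  module Side {K : Subset n} (cl : IsClique G K) (mx : IsMaximal G K) {v : Fin n} (v∉ : v ∉ K) where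

    A : Subset n
    A = comp G K v

    Inside : Fin n → Set
    Inside u = u ∉ K × comp G K u ≡ A

    inside? : ∀ u → Dec (Inside u)
    inside? u = ¬? (u ∈? K) ×-dec _≟ˢ_ G (comp G K u) A

    contact? : ∀ d → Dec (d ∈ K × Nbr G K A d)
    contact? d = d ∈? K ×-dec nbr? G K A d

    S : Subset n
    S = ⟦ contact? ⟧

    S⁺ : ∀ {d} → d ∈ K → Nbr G K A d → d ∈ S
    S⁺ d∈ nb = ∈⟦⟧⁺ contact? (d∈ , nb)

    S-start : ∀ {a b} (s : CSeg K a b) → colour s ≡ A → a ∈ K → a ∈ S
    S-start s e a∈ = S⁺ a∈ (subst (λ B → Nbr G K B _) e (start s))

    S⊆K : ∀ {d} → d ∈ S → d ∈ K
    S⊆K m = proj₁ (∈⟦⟧⁻ contact? m)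

    clS : IsClique G S
    clS a b a∈ b∈ = cl a b (S⊆K a∈) (S⊆K b∈)

    -- Segments beyond `S` may run through vertices of K outside `S`, so the two sides are glued
    -- relative to the clique `S`, which the interiors on both sides avoid.
    restrict : ∀ {a b p M} → Seg K a b p M → Seg S a b p M
    restrict s = seg (seg-chain s) (λ m k → Route.avoid s m (S⊆K k))

    inner : ∀ {a b} (s : CSeg K a b) → colour s ≡ A → ∀ u → M s u → Inside u
    inner s e u m with mono s u m
    ... | u∉ , eq = u∉ , trans eq e

    not-inner : ∀ {a b} (s : CSeg K a b) → colour s ≢ A → ∀ u → M s u → ¬ Inside u
    not-inner s ne u m (_ , e) = ne (trans (sym (proj₂ (mono s u m))) e)

    module Opposite {C C′ : List (Fin n)} (cyC : IsCycle G C) (lenC : length C ≡ L)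
      (cyC′ : IsCycle G C′) (lenC′ : length C′ ≡ L)
      (C-in : ∀ {z} → z ∈ˡ C → Inside z ⊎ z ∈ K) (C′-out : ∀ {z} → z ∈ˡ C′ → ¬ Inside z) where

      module inK = Shapes cl
      module inS = Shapes clS
      module onK = Combine cl
      module onS = Combine clS

      -- Apart from `w` such a cycle lies in one component of G - K. If this is `A`, it meets `C′`
      -- at most in `w`; otherwise it meets `C` at most in `w`.
      not-one-trace : ∀ {C″ u} → IsCycle G C″ → length C″ ≡ L → ∀ w →
        (∀ {z} → z ∈ˡ C″ → (z ∉ K × comp G K z ≡ comp G K u) ⊎ (z ≡ w × z ∈ K × Nbr G K (comp G K u) z)) → ⊥
      not-one-trace {u = u} cy eq w cover with _≟ˢ_ G (comp G K u) A
      ... | yes e = share-two L maxL cy eq cyC′ lenC′ w λ z∈ z∈′ →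
        [ (λ (z∉ , f) → contradiction (z∉ , trans f e) (C′-out z∈′)) , proj₁ ]′ (cover z∈)
      ... | no ne = share-two L maxL cy eq cyC lenC w λ z∈ z∈′ →
        [ (λ (z∉ , f) → contradiction (C-in z∈′) [ (λ (_ , g) → ne (trans (sym f) g)) , z∉ ]′) , proj₁ ]′ (cover z∈)

      -- Take x in K with no neighbour in A and a longest cycle that avoids a and
      -- whose trace lies in {b, x, y}: each of its segments can be closed up by the
      -- long a-b segment on the other side, so all of them are too short.
      no-long-pair : ∀ {a b p q M N} → a ∈ S → b ∈ S → a ≢ b → Seg K a b p M → (∀ u → M u → Inside u) →
        Seg S a b q N → (∀ u → N u → ¬ Inside u) → L ≤ suc p + suc p → L ≤ suc q + suc q → ⊥
      no-long-pair {a} {b} {p} {q} a∈S b∈S ab s s-in o o-out hp hq with non-neighbour G chordal cl mx v∉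
      ... | x , x∈ , ¬x = avoiding cl a∈ b∈ x∈ (ab ∘ sym) xa (xb ∘ sym) λ y C″ y∈ ya cy eq a∉ tr →
        go y∈ ya cy eq a∉ tr (decompose cl a∈ a∉ cy eq tr)
        where
        a∈ = S⊆K a∈S
        b∈ = S⊆K b∈S
        xa = nbr≢ (proj₂ (∈⟦⟧⁻ contact? a∈S)) ¬x
        xb = nbr≢ (proj₂ (∈⟦⟧⁻ contact? b∈S)) ¬x
        bound : ∀ {c d} (r : CSeg K c d) → c ∈ K → d ∈ K → c ≢ d → a ≢ c → a ≢ d → 4 + len r + len r ≤ L
        bound r c∈ d∈ cd ac ad with _≟ˢ_ G (colour r) A
        ... | yes e = short-rest (len r) hq
          (onS.joint o (restrict (path r)) a∈S b∈S (S-start r e c∈)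
            (S-start (crev r) e d∈) ab cd ac ad λ u m m′ → o-out u m (inner r e u m′))
        ... | no ne = short-rest (len r) hp
          (onK.joint s (path r) a∈ b∈ c∈ d∈ ab cd ac ad λ u m m′ → not-inner r ne u m′ (s-in u m))
        go : ∀ {y C″} → y ∈ K → y ≢ a → IsCycle G C″ → length C″ ≡ L → a ∉ˡ C″ →
          (∀ {u} → u ∈ˡ C″ → u ∈ K → In3 b x y u) → Decomp K C″ → ⊥
        go y∈ ya cy eq a∉ tr (one {u} w _ cover) = not-one-trace {u = u} cy eq w cover
        go y∈ ya cy eq a∉ tr (two c∈C d∈C c∈ d∈ (two r r′ cd _ size) _) =
          overflow 3 (bound r c∈ d∈ cd (λ { refl → a∉ c∈C }) (λ { refl → a∉ d∈C }))
            (bound r′ c∈ d∈ cd (λ { refl → a∉ c∈C }) (λ { refl → a∉ d∈C })) size size (arith (len r) (len r′))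
          where
          arith : ∀ r r′ → (4 + r + r) + (4 + r′ + r′) ≡ 4 + ((2 + r + r′) + (2 + r + r′))
          arith = solve-∀
        go {y} y∈ ya cy eq a∉ tr (three c∈C d∈C e∈C c∈ d∈ e∈ t _)
          with Relabel.relabel {K} (λ _ → ⊤) _ _ (tr c∈C c∈) (tr d∈C d∈) (tr e∈C e∈) t tt
        ... | three f g h bx xy by fg _ _ size , _ =
          overflow 3
            -- `f` and `g` end at `x` and therefore avoid `A`; together with `x` they count as a
            -- single segment from `b` to `y`.
            (short-rest (1 + len f + len g) hp (subst (_≤ L) (arith (len f) (len g) p)
              (onK.bridge4 s (path f) (path g) a∈ b∈ x∈ y∈ ab (xa ∘ sym) (ya ∘ sym) bx by xy
                (λ u m m′ → not-inner f (colour≢ (end f) ¬x) u m′ (s-in u m))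
                (λ u m m′ → not-inner g (colour≢ (start g) ¬x) u m′ (s-in u m)) fg)))
            (bound h y∈ b∈ (by ∘ sym) (ya ∘ sym) ab)
            size size (arith′ (len f) (len g) (len h))
          where
          arith : ∀ f g p → 4 + p + f + g ≡ 3 + p + (1 + f + g)
          arith = solve-∀
          arith′ : ∀ f g h → (4 + (1 + f + g) + (1 + f + g)) + (4 + h + h) ≡ 4 + ((3 + f + g + h) + (3 + f + g + h))
          arith′ = solve-∀

      -- A longest cycle with trace in {x, b, c}, where x has no neighbour in A, is
      -- shorter than t segment by segment.
      no-triple : ∀ {a b c p′ q′ r′ P Q R} → a ∈ S → b ∈ S → c ∈ S → (t : Three K a b c) → AllColour A t →
        Seg S a b p′ P → Seg S b c q′ Q → Seg S c a r′ R → Disj P Q → Disj P R → Disj Q R →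
        (∀ u → P u → ¬ Inside u) → (∀ u → Q u → ¬ Inside u) → (∀ u → R u → ¬ Inside u) →
        3 + p′ + q′ + r′ ≡ L → ⊥
      no-triple {a} {b} {c} {p′} {q′} {r′} a∈S b∈S c∈S (three p q r ab bc ac pq pr qr size) (cp , cq , cr)
        p° q° r° PQ PR QR p-out q-out r-out size′ with L ≤? suc (len q) + suc (len q)
      -- Here `q` is half of a longest cycle. As it fits into the outer cycle in place of `q°`, the
      -- latter is at least as long, and the two form a long pair.
      ... | yes h = no-long-pair b∈S c∈S bc (path q) (inner q cq) q° q-out h
          (≤-trans h (+-mono-≤ (s≤s q≤q′) (s≤s q≤q′)))
        where
        q≤q′ : len q ≤ q′
        q≤q′ = fit (3 + p′ + r′)
          (inS.cyc3 (restrict (path q)) r° p° b∈S c∈S a∈S bc (ac ∘ sym) (ab ∘ sym)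
            (λ u m m′ → r-out u m′ (inner q cq u m)) (λ u m m′ → p-out u m′ (inner q cq u m)) (λ u m m′ → PR u m′ m))
          size′ (e₁ (len q) p′ r′) (e₂ q′ p′ r′)
          where
          e₁ : ∀ x p r → 3 + x + r + p ≡ x + (3 + p + r)
          e₁ = solve-∀
          e₂ : ∀ q p r → 3 + p + q + r ≡ q + (3 + p + r)
          e₂ = solve-∀
      ... | no ¬h with non-neighbour G chordal cl mx v∉
      ... | x , x∈ , ¬x = with-trace cl x∈ b∈ c∈ xb bc xc λ C″ cy eq tr →
        go cy eq tr (decompose cl a∈ (λ m → [ (xa ∘ sym) , [ ab , ac ]′ ]′ (tr m a∈)) cy eq tr)
        where
        a∈ = S⊆K a∈S
        b∈ = S⊆K b∈S
        c∈ = S⊆K c∈S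
        xa = nbr≢ (proj₂ (∈⟦⟧⁻ contact? a∈S)) ¬x
        xb = nbr≢ (proj₂ (∈⟦⟧⁻ contact? b∈S)) ¬x
        xc = nbr≢ (proj₂ (∈⟦⟧⁻ contact? c∈S)) ¬x
        rp : Disj (M r) (M p)
        rp u m m′ = pr u m′ m
        e₁ : ∀ x p r → 3 + x + r + p ≡ x + (3 + p + r)
        e₁ = solve-∀
        e₂ : ∀ q p r → 3 + p + q + r ≡ q + (3 + p + r)
        e₂ = solve-∀
        e₃ : ∀ s p r → 4 + s + p + r ≡ suc s + (3 + p + r)
        e₃ = solve-∀
        e₄ : ∀ p q r → 3 + p + q + r ≡ p + (3 + q + r)
        e₄ = solve-∀
        e₅ : ∀ s r p → 4 + s + r + p ≡ suc s + (3 + p + r)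
        e₅ = solve-∀
        e₆ : ∀ p q r → 3 + p + q + r ≡ r + (3 + q + p)
        e₆ = solve-∀
        q′≤q : q′ ≤ len q
        q′≤q = fit (3 + len p + len r)
          (inS.cyc3 q° (restrict (path r)) (restrict (path p)) b∈S c∈S a∈S bc (ac ∘ sym) (ab ∘ sym)
            (λ u m m′ → q-out u m (inner r cr u m′)) (λ u m m′ → q-out u m (inner p cp u m′)) rp)
          size (e₁ q′ (len p) (len r)) (e₂ (len q) (len p) (len r))
        -- A segment inside `A` can replace `q°` in the outer cycle, any other one can replace `q`
        -- in the inner cycle, and `q°` is no longer than `q`.
        bc-bound : (s : CSeg K b c) → len s ≤ len q
        bc-bound s with _≟ˢ_ G (colour s) A
        ... | yes e = ≤-trans (fit (3 + p′ + r′)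
          (inS.cyc3 (restrict (path s)) r° p° b∈S c∈S a∈S bc (ac ∘ sym) (ab ∘ sym)
            (λ u m m′ → r-out u m′ (inner s e u m)) (λ u m m′ → p-out u m′ (inner s e u m)) (λ u m m′ → PR u m′ m))
          size′ (e₁ (len s) p′ r′) (e₂ q′ p′ r′)) q′≤q
        ... | no ne = fit (3 + len p + len r)
          (inK.cyc3 (path s) (path r) (path p) b∈ c∈ a∈ bc (ac ∘ sym) (ab ∘ sym)
            (λ u m m′ → not-inner s ne u m (inner r cr u m′)) (λ u m m′ → not-inner s ne u m (inner p cp u m′)) rp)
          size (e₁ (len s) (len p) (len r)) (e₂ (len q) (len p) (len r))
        x-out : ∀ {y} (s : CSeg K x y) → ∀ u → M s u → ¬ Inside u
        x-out s = not-inner s (colour≢ (start s) ¬x)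
        -- `s` avoids `A` because it ends at `x`. The edge from `a` to `x` followed by `s` can
        -- replace `p`, and the additional vertex `x` makes the inequality strict.
        xb-p : (s : CSeg K x b) → suc (len s) ≤ len p
        xb-p s = fit (3 + len q + len r)
          (onK.bridge4 (path s) (path q) (path r) x∈ b∈ c∈ a∈ xb xc xa bc (ab ∘ sym) (ac ∘ sym)
            (λ u m m′ → x-out s u m (inner q cq u m′)) (λ u m m′ → x-out s u m (inner r cr u m′)) qr)
          size (e₃ (len s) (len q) (len r)) (e₄ (len p) (len q) (len r))
        xb-q : (s : CSeg K x b) → suc (len s) ≤ len q
        xb-q s = fit (3 + len p + len r)
          (onK.bridge4 (path s) (seg-rev (path p)) (seg-rev (path r)) x∈ b∈ a∈ c∈ xb xa xc (ab ∘ sym) bc ac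
            (λ u m m′ → x-out s u m (inner p cp u m′)) (λ u m m′ → x-out s u m (inner r cr u m′)) pr)
          size (e₃ (len s) (len p) (len r)) (e₂ (len q) (len p) (len r))
        xc-q : (s : CSeg K x c) → suc (len s) ≤ len q
        xc-q s = fit (3 + len p + len r)
          (onK.bridge4 (path s) (path r) (path p) x∈ c∈ a∈ b∈ xc xa xb (ac ∘ sym) (bc ∘ sym) ab
            (λ u m m′ → x-out s u m (inner r cr u m′)) (λ u m m′ → x-out s u m (inner p cp u m′)) rp)
          size (e₅ (len s) (len r) (len p)) (e₂ (len q) (len p) (len r))
        xc-r : (s : CSeg K x c) → suc (len s) ≤ len r
        xc-r s = fit (3 + len q + len p)
          (onK.bridge4 (path s) (seg-rev (path q)) (seg-rev (path p)) x∈ c∈ b∈ a∈ xc xb xa (bc ∘ sym) (ac ∘ sym) (ab ∘ sym)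
            (λ u m m′ → x-out s u m (inner q cq u m′)) (λ u m m′ → x-out s u m (inner p cp u m′)) (λ u m m′ → pq u m′ m))
          size (e₃ (len s) (len q) (len p)) (e₆ (len p) (len q) (len r))
        -- Two segments no longer than `q` cannot make up a longest cycle, since `q` is less than
        -- half of one by `¬h`.
        bc-case : (s s′ : CSeg K b c) → 2 + len s + len s′ ≡ L → ⊥
        bc-case s s′ e = ¬h (≤-trans (≤-reflexive (trans (sym e) (sym (cong suc (+-suc (len s) (len s′))))))
          (+-mono-≤ (s≤s (bc-bound s)) (s≤s (bc-bound s′))))
        small : ∀ {s s′ y z} → suc s ≤ y → suc s′ ≤ z → suc (y + z) ≤ L → 2 + s + s′ ≡ L → ⊥
        small {s} {s′} p q r refl = <-irrefl refl (≤-trans (s≤s (≤-trans (≤-reflexive (sym (cong suc (+-suc s s′)))) (+-mono-≤ p q))) r)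
        xb-case : (s s′ : CSeg K x b) → 2 + len s + len s′ ≡ L → ⊥
        xb-case s s′ = small (xb-p s) (xb-q s′)
          (≤-trans (≤-trans (m≤m+n _ (2 + len r)) (≤-reflexive (arith (len p) (len q) (len r)))) (≤-reflexive size))
          where
          arith : ∀ p q r → suc (p + q) + (2 + r) ≡ 3 + p + q + r
          arith = solve-∀
        xc-case : (s s′ : CSeg K x c) → 2 + len s + len s′ ≡ L → ⊥
        xc-case s s′ = small (xc-r s) (xc-q s′)
          (≤-trans (≤-trans (m≤m+n _ (2 + len p)) (≤-reflexive (arith (len p) (len q) (len r)))) (≤-reflexive size))
          where
          arith : ∀ p q r → suc (r + q) + (2 + p) ≡ 3 + p + q + r
          arith = solve-∀
        two-case : ∀ {y z} → In3 x b c y → In3 x b c z → (s s′ : CSeg K y z) → y ≢ z → 2 + len s + len s′ ≡ L → ⊥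
        two-case (inj₁ refl) (inj₁ refl) s s′ ne = contradiction refl ne
        two-case (inj₁ refl) (inj₂ (inj₁ refl)) s s′ ne = xb-case s s′
        two-case (inj₁ refl) (inj₂ (inj₂ refl)) s s′ ne = xc-case s s′
        two-case (inj₂ (inj₁ refl)) (inj₁ refl) s s′ ne = xb-case (crev s) (crev s′)
        two-case (inj₂ (inj₁ refl)) (inj₂ (inj₁ refl)) s s′ ne = contradiction refl ne
        two-case (inj₂ (inj₁ refl)) (inj₂ (inj₂ refl)) s s′ ne = bc-case s s′
        two-case (inj₂ (inj₂ refl)) (inj₁ refl) s s′ ne = xc-case (crev s) (crev s′)
        two-case (inj₂ (inj₂ refl)) (inj₂ (inj₁ refl)) s s′ ne = bc-case (crev s) (crev s′)
        two-case (inj₂ (inj₂ refl)) (inj₂ (inj₂ refl)) s s′ ne = contradiction refl ne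
        go : ∀ {C″} → IsCycle G C″ → length C″ ≡ L → (∀ {u} → u ∈ˡ C″ → u ∈ K → In3 x b c u) → Decomp K C″ → ⊥
        go cy eq tr (one {u} w _ cover) = not-one-trace {u = u} cy eq w cover
        go cy eq tr (two y∈C z∈C y∈ z∈ (two s s′ ne _ size″) _) = two-case (tr y∈C y∈) (tr z∈C z∈) s s′ ne size″
        go cy eq tr (three c∈C d∈C e∈C c∈ d∈ e∈ t _)
          with Relabel.relabel {K} (λ _ → ⊤) _ _ (tr c∈C c∈) (tr d∈C d∈) (tr e∈C e∈) t tt
        ... | three f g h _ _ _ _ _ _ size″ , _ =
          <-irrefl refl (≤-trans (≤-trans (s≤s (≤-trans (≤-reflexive (trans (sym size″) (arith (len f) (len g) (len h))))
              (s≤s (+-mono-≤ (+-mono-≤ (xb-p f) (bc-bound g)) (xc-r (crev h))))))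
            (n≤1+n _)) (≤-reflexive size))
          where
          arith : ∀ f g h → 3 + f + g + h ≡ suc (suc f + g + suc h)
          arith = solve-∀

    fenced-in : ∀ {C} → Fenced K v C → ∀ {z} → z ∈ˡ C → Inside z ⊎ z ∈ S
    fenced-in (one w cover) m with cover m
    ... | inj₁ i             = inj₁ i
    ... | inj₂ (_ , z∈ , nb) = inj₂ (S⁺ z∈ nb)
    fenced-in (two a∈ b∈ (two p q _ _ _) refl _ cover) m with cover m
    ... | inj₁ i           = inj₁ i
    ... | inj₂ (inj₁ refl) = inj₂ (S⁺ a∈ (start p))
    ... | inj₂ (inj₂ refl) = inj₂ (S⁺ b∈ (end p))
    fenced-in (three a∈ b∈ c∈ (three p q r _ _ _ _ _ _ _) refl e _ cover) m with cover m
    ... | inj₁ i                  = inj₁ i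
    ... | inj₂ (inj₁ refl)        = inj₂ (S⁺ a∈ (start p))
    ... | inj₂ (inj₂ (inj₁ refl)) = inj₂ (S⁺ b∈ (end p))
    ... | inj₂ (inj₂ (inj₂ refl)) = inj₂ (S-start (crev q) e c∈)

    module Beyond {K′ : Subset n} (S⊆K′ : ∀ {u} → u ∈ S → u ∈ K′) (K′⊆ : ∀ {u} → u ∈ K′ → Inside u ⊎ u ∈ S) where

      -- An edge leaving `A` ends in K, hence in `S`, and all of `S` belongs to `K′`.
      stays : ∀ {u u′} → Inside u → u′ ∉ K′ → Adj u u′ → Inside u′
      stays {u} {u′} (u∉ , e) u′∉ a with u′ ∈? K
      ... | yes u′∈ = contradiction (S⊆K′ (S⁺ u′∈ (u , u∉ , e , a))) u′∉
      ... | no  u′∉K = u′∉K , trans (sym (comp-adj G u∉ u′∉K a)) e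

      stays* : ∀ {u u′} → Star (Step G K′) u u′ → Inside u → Inside u′
      stays* ε i = i
      stays* ((_ , y∉ , a) ◅ s) i = stays* s (stays i y∉ a)

      module _ {v′ : Fin n} (out : ¬ Inside v′) where

        A′ : Subset n
        A′ = comp G K′ v′

        outside : ∀ {u} → comp G K′ u ≡ A′ → ¬ Inside u
        outside e i = out (stays* (comp-≡⁻ G e) i)

        contact-in-S : ∀ {c} → c ∈ K′ → Nbr G K′ A′ c → c ∈ S
        contact-in-S c∈ (u , u∉ , e , a) with K′⊆ c∈
        ... | inj₁ i = contradiction (stays i u∉ (symm a)) (outside e)
        ... | inj₂ k = k

        outer : ∀ {c d} (s : CSeg K′ c d) → colour s ≡ A′ → ∀ u → M s u → ¬ Inside u
        outer s e u m = outside (trans (proj₂ (mono s u m)) e)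

        outer-seg : ∀ {c d} (s : CSeg K′ c d) → Seg S c d (len s) (M s)
        outer-seg s = seg (seg-chain (path s)) λ m k → proj₁ (mono s _ m) (S⊆K′ k)

        start-S : ∀ {c d} (s : CSeg K′ c d) → colour s ≡ A′ → c ∈ K′ → c ∈ S
        start-S s e c∈ = contact-in-S c∈ (subst (λ B → Nbr G K′ B _) e (start s))

        fenced-out : ∀ {C} → Fenced K′ v′ C → ∀ {z} → z ∈ˡ C → ¬ Inside z
        fenced-out f m i with trace f m
          where
          trace : ∀ {C} → Fenced K′ v′ C → ∀ {z} → z ∈ˡ C → (z ∉ K′ × comp G K′ z ≡ A′) ⊎ z ∈ S
          trace (one w cover) m with cover m
          ... | inj₁ i             = inj₁ i
          ... | inj₂ (_ , z∈ , nb) = inj₂ (contact-in-S z∈ nb)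
          trace (two a∈ b∈ (two p q _ _ _) e _ cover) m with cover m
          ... | inj₁ i           = inj₁ i
          ... | inj₂ (inj₁ refl) = inj₂ (start-S p e a∈)
          ... | inj₂ (inj₂ refl) = inj₂ (start-S (crev p) e b∈)
          trace (three a∈ b∈ c∈ (three p q r _ _ _ _ _ _ _) e f g cover) m with cover m
          ... | inj₁ i                  = inj₁ i
          ... | inj₂ (inj₁ refl)        = inj₂ (start-S p e a∈)
          ... | inj₂ (inj₂ (inj₁ refl)) = inj₂ (start-S q f b∈)
          ... | inj₂ (inj₂ (inj₂ refl)) = inj₂ (start-S r g c∈)
        ... | inj₁ (_ , e) = outside e i
        ... | inj₂ k       = proj₁ i (S⊆K k)

        -- The first cycle lies in A ∪ S and the second avoids `A`, so common vertices belong to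
        -- both traces. By `share-two` there are at least two of them, which leaves four cases
        -- according to whether each trace has two or three vertices.
        clash : ∀ {C C′} → IsCycle G C → length C ≡ L → IsCycle G C′ → length C′ ≡ L →
          Fenced K v C → Fenced K′ v′ C′ → ⊥
        clash {C} {C′} cy eq cy′ eq′ fen fen′ = go fen fen′
          where
          open Opposite cy eq cy′ eq′ (λ m → [ inj₁ , inj₂ ∘ S⊆K ]′ (fenced-in fen m)) (fenced-out fen′)

          common : ∀ {T T′ : Fin n → Set} → (∀ {z} → z ∈ˡ C → Inside z ⊎ T z) →
            (∀ {z} → z ∈ˡ C′ → (z ∉ K′ × comp G K′ z ≡ A′) ⊎ T′ z) → ∀ {z} → z ∈ˡ C → z ∈ˡ C′ → T z × T′ z
          common f g m m′ with f m | g m′ | fenced-in fen m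
          ... | inj₁ i | _             | _      = contradiction i (fenced-out fen′ m′)
          ... | inj₂ _ | inj₁ _        | inj₁ i = contradiction i (fenced-out fen′ m′)
          ... | inj₂ _ | inj₁ (z∉ , _) | inj₂ k = contradiction (S⊆K′ k) z∉
          ... | inj₂ t | inj₂ t′       | _      = t , t′

          at-most-one : ∀ w → (∀ {z} → z ∈ˡ C → z ∈ˡ C′ → z ≡ w) → ⊥
          at-most-one = share-two L maxL cy eq cy′ eq′

          in2? : ∀ a b (u : Fin n) → Dec (u ≡ a ⊎ u ≡ b)
          in2? a b u = u Fin.≟ a ⊎-dec u Fin.≟ b

          in3? : ∀ a b c (u : Fin n) → Dec (In3 a b c u)
          in3? a b c u = u Fin.≟ a ⊎-dec in2? b c u

          two-two-case : ∀ {a b} (s : CSeg K a b) (o : CSeg K′ a b) → a ∈ K → b ∈ K → a ≢ b →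
            colour s ≡ A → colour o ≡ A′ → L ≤ suc (len s) + suc (len s) → L ≤ suc (len o) + suc (len o) → ⊥
          two-two-case s o a∈ b∈ ab e f = no-long-pair (S-start s e a∈)
            (S-start (crev s) e b∈) ab (path s) (inner s e) (outer-seg o) (outer o f)

          -- The half `s` fits into the outer cycle in place of `p`. So `p` is at least as long as
          -- `s`, and the two are a long pair on opposite sides.
          two-three-case : ∀ {a b g} (s : CSeg K a b) → a ∈ K → b ∈ K → colour s ≡ A → L ≤ suc (len s) + suc (len s) →
            (t : Three K′ a b g) → AllColour A′ t → g ∈ K′ → ⊥
          two-three-case s a∈ b∈ e h (three p q r ab bg ag pq pr qr size) (cp , cq , cr) g∈ =
            two-two-case s p a∈ b∈ ab e cp h (≤-trans h (+-mono-≤ (s≤s s≤p) (s≤s s≤p)))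
            where
            e₁ : ∀ s q r → 3 + s + q + r ≡ s + (3 + q + r)
            e₁ = solve-∀
            s≤p : len s ≤ len p
            s≤p = fit (3 + len q + len r)
              (inS.cyc3 (restrict (path s)) (outer-seg q) (outer-seg r)
                (S-start s e a∈) (S-start (crev s) e b∈)
                (start-S r cr g∈) ab bg ag
                (λ u m m′ → outer q cq u m′ (inner s e u m)) (λ u m m′ → outer r cr u m′ (inner s e u m)) qr)
              size (e₁ (len s) (len q) (len r)) (e₁ (len p) (len q) (len r))

          three-two-case : ∀ {a b g} (t : Three K a b g) → AllColour A t → a ∈ K → b ∈ K → g ∈ K →
            (o : CSeg K′ a b) → colour o ≡ A′ → L ≤ suc (len o) + suc (len o) → ⊥
          three-two-case (three p q r ab bg ag pq pr qr size) (cp , cq , cr) a∈ b∈ g∈ o e h =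
            two-two-case p o a∈ b∈ ab cp e (≤-trans h (+-mono-≤ (s≤s o≤p) (s≤s o≤p))) h
            where
            e₁ : ∀ s q r → 3 + s + q + r ≡ s + (3 + q + r)
            e₁ = solve-∀
            o≤p : len o ≤ len p
            o≤p = fit (3 + len q + len r)
              (inS.cyc3 (outer-seg o) (restrict (path q)) (restrict (path r))
                (S-start p cp a∈) (S-start (crev p) cp b∈)
                (S-start (crev q) cq g∈) ab bg ag
                (λ u m m′ → outer o e u m (inner q cq u m′)) (λ u m m′ → outer o e u m (inner r cr u m′)) qr)
              size (e₁ (len o) (len q) (len r)) (e₁ (len p) (len q) (len r))

          -- Equal traces are the situation of `no-triple`. Otherwise `r` and `r′` are exchanged as
          -- in `share-ab`, but over `S`, with disjointness coming from the separation instead of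
          -- colours.
          three-three-case : ∀ {a b c g} (t : Three K a b c) → AllColour A t → a ∈ K → b ∈ K → c ∈ K →
            (t′ : Three K′ a b g) → AllColour A′ t′ → g ∈ K′ → ⊥
          three-three-case {a} {b} {c} {g} t@(three p q r ab bc ac pq pr qr size) al@(cp , cq , cr) a∈ b∈ c∈
            t′@(three p′ q′ r′ _ bg ag p′q′ p′r′ q′r′ size′) (cp′ , cq′ , cr′) g∈ with g Fin.≟ c
          ... | yes refl = no-triple a∈S b∈S c∈S t al (outer-seg p′) (outer-seg q′) (outer-seg r′) p′q′ p′r′ q′r′
              (outer p′ cp′) (outer q′ cq′) (outer r′ cr′) size′
            where
            a∈S = S-start p cp a∈
            b∈S = S-start (crev p) cp b∈
            c∈S = S-start (crev q) cq c∈
          ... | no gc = overflow 1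
              (onS.bridge4 (restrict (path r)) (outer-seg p′) (outer-seg q′) c∈S a∈S b∈S g∈S (ac ∘ sym) (bc ∘ sym) (gc ∘ sym)
                ab ag bg (λ u m m′ → outer p′ cp′ u m′ (inner r cr u m)) (λ u m m′ → outer q′ cq′ u m′ (inner r cr u m)) p′q′)
              (onS.bridge4 (outer-seg r′) (restrict (path p)) (restrict (path q)) g∈S a∈S b∈S c∈S (ag ∘ sym) (bg ∘ sym) gc
                ab ac bc (λ u m m′ → outer r′ cr′ u m (inner p cp u m′)) (λ u m m′ → outer r′ cr′ u m (inner q cq u m′)) pq)
              size size′ (arith (len p) (len q) (len r) (len p′) (len q′) (len r′))
            where
            a∈S = S-start p cp a∈
            b∈S = S-start (crev p) cp b∈
            c∈S = S-start (crev q) cq c∈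
            g∈S = start-S r′ cr′ g∈
            arith : ∀ p q r p′ q′ r′ → (4 + r + p′ + q′) + (4 + r′ + p + q) ≡ 2 + ((3 + p + q + r) + (3 + p′ + q′ + r′))
            arith = solve-∀

          half-colour : ∀ {X a b B} (t : Two X a b) {s} → s ≡ Two.p t ⊎ s ≡ Two.q t →
            colour (Two.p t) ≡ B → colour (Two.q t) ≡ B → colour s ≡ B
          half-colour t (inj₁ refl) e f = e
          half-colour t (inj₂ refl) e f = f

          In3-∈ : ∀ {X : Subset n} {a b c u} → a ∈ X → b ∈ X → c ∈ X → In3 a b c u → u ∈ X
          In3-∈ a∈ b∈ c∈ (inj₁ refl)        = a∈
          In3-∈ a∈ b∈ c∈ (inj₂ (inj₁ refl)) = b∈
          In3-∈ a∈ b∈ c∈ (inj₂ (inj₂ refl)) = c∈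

          module relK  = Relabel {K} (AllColour A) allColour-rot allColour-mirror
          module relK′ = Relabel {K′} (AllColour A′) allColour-rot allColour-mirror

          go : Fenced K v C → Fenced K′ v′ C′ → ⊥
          go (one w cover) f′ = at-most-one w λ m m′ →
            [ (λ i → contradiction i (fenced-out f′ m′)) , proj₁ ]′ (cover m)
          go f@(two _ _ _ _ _ cover) (one w cover′) = at-most-one w λ m m′ → proj₁ (proj₂ (common cover cover′ m m′))
          go f@(three _ _ _ _ _ _ _ cover) (one w cover′) = at-most-one w λ m m′ → proj₁ (proj₂ (common cover cover′ m m′))
          go (two {a} {b} a∈ b∈ t e f cover) (two {c} {d} c∈ d∈ t′ e′ f′ cover′)
            with long-half t | long-half t′ | in2? c d a | in2? c d b
          ... | s , i , h | o , j , h′ | no ¬a | _ = at-most-one b λ m m′ →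
            let x , y = common cover cover′ m m′ in [ (λ { refl → contradiction y ¬a }) , id ]′ x
          ... | s , i , h | o , j , h′ | _ | no ¬b = at-most-one a λ m m′ →
            let x , y = common cover cover′ m m′ in [ id , (λ { refl → contradiction y ¬b }) ]′ x
          ... | s , i , h | o , j , h′ | yes (inj₁ refl) | yes (inj₁ refl) = Two.a≢b t refl
          ... | s , i , h | o , j , h′ | yes (inj₂ refl) | yes (inj₂ refl) = Two.a≢b t refl
          ... | s , i , h | o , j , h′ | yes (inj₁ refl) | yes (inj₂ refl) =
            two-two-case s o a∈ b∈ (Two.a≢b t) (half-colour t i e f) (half-colour t′ j e′ f′) h h′
          ... | s , i , h | o , j , h′ | yes (inj₂ refl) | yes (inj₁ refl) =
            two-two-case s (crev o) a∈ b∈ (Two.a≢b t) (half-colour t i e f) (half-colour t′ j e′ f′) h h′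
          go (two {a} {b} a∈ b∈ t e f cover) (three {x} {y} {z} x∈ y∈ z∈ t′ e′ f′ g′ cover′)
            with long-half t | in3? x y z a | in3? x y z b
          ... | s , i , h | no ¬a | _ = at-most-one b λ m m′ →
            let p , q = common cover cover′ m m′ in [ (λ { refl → contradiction q ¬a }) , id ]′ p
          ... | s , i , h | _ | no ¬b = at-most-one a λ m m′ →
            let p , q = common cover cover′ m m′ in [ id , (λ { refl → contradiction q ¬b }) ]′ p
          ... | s , i , h | yes a∈′ | yes b∈′ with relK′.relabel₂ a∈′ b∈′ (Two.a≢b t) t′ (e′ , f′ , g′)
          ... | g , g∈ , t″ , al = two-three-case s a∈ b∈ (half-colour t i e f) h t″ al (In3-∈ x∈ y∈ z∈ g∈)
          go (three {x} {y} {z} x∈ y∈ z∈ t e f g cover) (two {a} {b} a∈ b∈ t′ e′ f′ cover′)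
            with long-half t′ | in3? x y z a | in3? x y z b
          ... | s , i , h | no ¬a | _ = at-most-one b λ m m′ →
            let p , q = common cover cover′ m m′ in [ (λ { refl → contradiction p ¬a }) , id ]′ q
          ... | s , i , h | _ | no ¬b = at-most-one a λ m m′ →
            let p , q = common cover cover′ m m′ in [ id , (λ { refl → contradiction p ¬b }) ]′ q
          ... | s , i , h | yes a∈′ | yes b∈′ with relK.relabel₂ a∈′ b∈′ (Two.a≢b t′) t (e , f , g)
          ... | d , d∈ , t″ , al = three-two-case t″ al (In3-∈ x∈ y∈ z∈ a∈′) (In3-∈ x∈ y∈ z∈ b∈′) (In3-∈ x∈ y∈ z∈ d∈)
            s (half-colour t′ i e′ f′) h
          go (three {a} {b} {c} a∈ b∈ c∈ t e f g cover) (three {x} {y} {z} x∈ y∈ z∈ t′ e′ f′ g′ cover′) =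
            case (in3? x y z a) (in3? x y z b) (in3? x y z c)
            where
            shared : ∀ {a b c} → In3 x y z a → In3 x y z b → a ≢ b → a ∈ K → b ∈ K → c ∈ K →
              (t : Three K a b c) → AllColour A t → ⊥
            shared i j ab a∈ b∈ c∈ t al with relK′.relabel₂ i j ab t′ (e′ , f′ , g′)
            ... | d , d∈ , t″ , al′ = three-three-case t al a∈ b∈ c∈ t″ al′ (In3-∈ x∈ y∈ z∈ d∈)
            case : Dec (In3 x y z a) → Dec (In3 x y z b) → Dec (In3 x y z c) → ⊥
            case (yes i) (yes j) _ = shared i j (Three.a≢b t) a∈ b∈ c∈ t (e , f , g)
            case _ (yes j) (yes k) = shared j k (Three.b≢c t) b∈ c∈ a∈ (rot t) (f , g , e)
            case (yes i) _ (yes k) = shared k i (Three.a≢c t ∘ sym) c∈ a∈ b∈ (rot (rot t)) (g , e , f)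
            case (no ¬a) (no ¬b) _ = at-most-one c λ m m′ →
              let p , q = common cover cover′ m m′ in
              [ (λ { refl → contradiction q ¬a }) , [ (λ { refl → contradiction q ¬b }) , id ]′ ]′ p
            case _ (no ¬b) (no ¬c) = at-most-one a λ m m′ →
              let p , q = common cover cover′ m m′ in
              [ id , [ (λ { refl → contradiction q ¬b }) , (λ { refl → contradiction q ¬c }) ]′ ]′ p
            case (no ¬a) _ (no ¬c) = at-most-one b λ m m′ →
              let p , q = common cover cover′ m m′ in
              [ (λ { refl → contradiction q ¬a }) , [ id , (λ { refl → contradiction q ¬c }) ]′ ]′ p

  -- Descent to a smaller fenced component, and the theorem.

  star-avoids : ∀ {X u u′} → u ∉ X → Star (Step G X) u u′ → u′ ∉ X
  star-avoids u∉ ε = u∉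
  star-avoids u∉ ((_ , y∉ , _) ◅ s) = star-avoids y∉ s

  -- Induction on the size of the component. A component of G - K′ that meets `A` stays in `A` and
  -- loses `x`, so the induction hypothesis excludes it; one outside `A` is excluded by `clash`.
  -- Hence `K′` fences no longest cycle, contrary to `Fence.fence`.
  unfenced : ∀ {K v C} → Acc _<_ ∣ comp G K v ∣ → IsClique G K → IsMaximal G K → v ∉ K →
    IsCycle G C → length C ≡ L → Fenced K v C → ⊥
  unfenced {K} {v} (acc smaller) cl mx v∉ cy eq fen with simplicial-contact G chordal cl v∉
  ... | x , x∉ , ex , adj = go (extend-clique G n S⁺x (m≤n+m n ∣ S⁺x ∣) clique⁺)
    where
    open Side cl mx v∉
    S⁺x = S ∪ ⁅ x ⁆
    x-adj : ∀ {d} → d ∈ S → Adj x d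
    x-adj d∈ = let k , nb = ∈⟦⟧⁻ contact? d∈ in adj _ k nb
    clique⁺ : IsClique G S⁺x
    clique⁺ a b a∈ b∈ ab with x∈p∪q⁻ S ⁅ x ⁆ a∈ | x∈p∪q⁻ S ⁅ x ⁆ b∈
    ... | inj₁ i | inj₁ j = clS a b i j ab
    ... | inj₁ i | inj₂ j with x∈⁅y⁆⇒x≡y x j
    ...   | refl = symm (x-adj i)
    clique⁺ a b a∈ b∈ ab | inj₂ i | inj₁ j with x∈⁅y⁆⇒x≡y x i
    ...   | refl = x-adj j
    clique⁺ a b a∈ b∈ ab | inj₂ i | inj₂ j = contradiction (trans (x∈⁅y⁆⇒x≡y x i) (sym (x∈⁅y⁆⇒x≡y x j))) ab
    go : (∃ λ K′ → IsClique G K′ × IsMaximal G K′ × S⁺x ⊆ K′) → ⊥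
    go (K′ , cl′ , mx′ , sub) = Fence.fence cl′ mx′ no-fence x∈K′
      where
      x∈K′ : x ∈ K′
      x∈K′ = sub (q⊆p∪q S ⁅ x ⁆ (x∈⁅x⁆ x))
      -- Every other vertex of `K′` is adjacent to `x`, so it lies in `A` or is a neighbour of `A`
      -- in K.
      K′⊆ : ∀ {u} → u ∈ K′ → Inside u ⊎ u ∈ S
      K′⊆ {u} u∈ with u Fin.≟ x
      ... | yes refl = inj₁ (x∉ , ex)
      ... | no  u≢x with u ∈? K
      ... | yes u∈K = inj₂ (S⁺ u∈K (x , x∉ , ex , cl′ x u x∈K′ u∈ (u≢x ∘ sym)))
      ... | no  u∉K = inj₁ (u∉K , trans (sym (comp-adj G x∉ u∉K (cl′ x u x∈K′ u∈ (u≢x ∘ sym)))) ex)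
      open Beyond {K′} (sub ∘ p⊆p∪q ⁅ x ⁆) K′⊆
      no-fence : ∀ {v′ C′} → v′ ∉ K′ → IsCycle G C′ → length C′ ≡ L → Fenced K′ v′ C′ → ⊥
      no-fence {v′} v′∉ cy′ eq′ fen′ with inside? v′
      ... | no out = clash out cy eq cy′ eq′ fen fen′
      ... | yes i = unfenced (smaller (p⊂q⇒∣p∣<∣q∣ (below , x , in-A (x∉ , ex) , x-out))) cl′ mx′ v′∉ cy′ eq′ fen′
        where
        in-A : ∀ {u} → Inside u → u ∈ A
        in-A (_ , e) = subst (_ ∈_) e (∈⟦⟧⁺ (reach? G K _) ε)
        below : comp G K′ v′ ⊆ A
        below m = in-A (stays* (∈⟦⟧⁻ (reach? G K′ v′) m) i)
        x-out : x ∉ comp G K′ v′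
        x-out m = star-avoids v′∉ (∈⟦⟧⁻ (reach? G K′ v′) m) x∈K′

  impossible : ⊥
  impossible with extend-clique G n ⁅ v₀ ⁆ (m≤n+m n ∣ ⁅ v₀ ⁆ ∣) singleton
    where
    v₀ : Fin n
    v₀ = fromℕ< (≤-trans (s≤s z≤n) (proj₁ conn))
    singleton : IsClique G ⁅ v₀ ⁆
    singleton a b a∈ b∈ ab = contradiction (trans (x∈⁅y⁆⇒x≡y v₀ a∈) (sym (x∈⁅y⁆⇒x≡y v₀ b∈))) ab
  ... | K , cl , mx , sub = Fence.fence cl mx (unfenced (<-wellFounded _) cl mx) (sub (x∈⁅x⁆ _))

theorem7p2 : ∀ {n : ℕ} (G : Graph n) → KConnected G 2 → Chordal G → lct G ≤ 1 ⊔ (ω G ∸ 3)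
theorem7p2 {n} G conn chordal = decidable-stable (lct G ≤? bound) λ lct≰ →
  let avoidable : ∀ Z → ∣ Z ∣ ≤ bound →
        (∀ C → IsLongestCycle G C → (∀ {u} → u ∈ˡ C → u ∉ Z) → ⊥) → ⊥
      avoidable Z small k = lct≰ (≤-trans (minimal Z λ C longest →
        decidable-stable (Any.any? (_∈? Z) C) λ ¬hit →
          k C longest λ m u∈ → ¬hit (Any.map (λ { refl → u∈ }) m)) small)
  -- The empty set is within the bound, so it is not a transversal; this supplies a longest cycle
  -- `C₀` and thereby the maximum length.
  in avoidable Subset.⊥ (subst (_≤ bound) (sym (∣⊥∣≡0 n)) z≤n) λ C₀ (cy₀ , max₀) _ →
    impossible G conn chordal (length C₀) max₀ (ω G) (proj₂ (proj₂ (cliqueNumber G)))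
      λ Z small k → avoidable Z small λ C (cy , max) → k C cy (≤-antisym (max₀ C cy) (max C₀ cy₀))
  where
  bound = 1 ⊔ (ω G ∸ 3)
  minimal : ∀ S → IsLongestCycleTransversal G S → lct G ≤ ∣ S ∣
  minimal = proj₂ (proj₂ (longestCycleTransversalNumber G))
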